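{- Let $q>1$ and $c$ be such that either $c=1$ or $(q,c)\in\{(2,2),(2,4),(3,3),(4,2)\}$. Let $C_i$ be a sequence of formally self-dual codes over an alphabet of size $q$ in which all Hamming weights are divisible by $c$, and suppose $n(C_i)\to\infty$ as $i\to\infty$. Then \[ \limsup_{i\to\infty}\frac{d(C_i)}{n(C_i)}\le \frac{q-1}{q}\bigl(1-(c+1)^{ -1/c}\bigr). \]
   Context: $n(C)$ denotes the length of the code $C$ and $d(C)$ its minimum (Hamming) distance. A code $C$ of length $n$ over an alphabet of size $q$ is formally self-dual if $|C|=q^{n/2}$ and its Hamming weight enumerator $W_C(x,y)=\sum_{c\in C}x^{n-\mathrm{wt}(c)}y^{\mathrm{wt}(c)}$ is invariant under the MacWilliams transform, i.e. $W_C(x,y)=q^{ -n/2}W_C(x+(q-1)y,\,x-y)$. -}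

module Defs where

open import Data.Nat as ℕ using (ℕ; zero; suc; _≤_; _<_; _∸_; _⊓_)
open import Data.Nat.Divisibility using (_∣_)
open import Data.Integer as ℤ using (ℤ; +_)
open import Data.Fin using (Fin)
open import Data.Vec using (Vec; []; _∷_)
open import Data.Vec.Properties using (≡-dec)
open import Data.Fin.Properties using (_≟_)
open import Data.List using (List; []; _∷_; length; map; concatMap; foldr)
open import Data.List.Relation.Unary.All using (All)
open import Data.List.Relation.Unary.Unique.Propositional using (Unique)
open import Data.Product using (_×_; ∃)
open import Data.Sum using (_⊎_)
open import Relation.Binary.PropositionalEquality using (_≡_)
open import Relation.Nullary using (yes; no)

-- Words of length n over the alphabet Fin q; the symbol 0 (Fin.zero) is the
-- distinguished "zero" symbol used for Hamming weights.
Word : ℕ → ℕ → Set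
Word q n = Vec (Fin q) n

wt : ∀ {q n} → Word q n → ℕ
wt [] = 0
wt (Fin.zero ∷ u) = wt u
wt (Fin.suc _ ∷ u) = suc (wt u)

dist : ∀ {q n} → Word q n → Word q n → ℕ
dist [] [] = 0
dist (a ∷ u) (b ∷ v) with a ≟ b
... | yes _ = dist u v
... | no _  = suc (dist u v)

record Code (q n : ℕ) : Set where
  constructor mkCode
  field
    words  : List (Word q n)
    unique : Unique words
open Code public

size : ∀ {q n} → Code q n → ℕ
size C = length (words C)

pairDists : ∀ {q n} → List (Word q n) → List (Word q n) → List ℕ
pairDists {q} {n} us vs = concatMap (λ u → concatMap (λ v → f u v) vs) us
  where
  f : Word q n → Word q n → List ℕ
  f u v with ≡-dec _≟_ u v
  ... | yes _ = []
  ... | no _  = dist u v ∷ []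

-- minimum distance d(C): minimum Hamming distance between distinct codewords
-- (default value n if C has fewer than two codewords; irrelevant for the theorem)
d : ∀ {q n} → Code q n → ℕ
d {n = n} C = foldr _⊓_ n (pairDists (words C) (words C))

W : ∀ {q n} → Code q n → ℤ → ℤ → ℤ
W {n = n} C x y = foldr ℤ._+_ (+ 0) (map (λ u → (x ℤ.^ (n ∸ wt u)) ℤ.* (y ℤ.^ wt u)) (words C))

-- Formally self-dual: |C| = q^{n/2} (stated as |C|^2 = q^n), and
-- W_C(x,y) = q^{-n/2} W_C(x+(q-1)y, x-y) as polynomials (equivalently as
-- functions on ℤ²), written after multiplying by q^{n/2} = |C|.
FormallySelfDual : ∀ {q n} → Code q n → Set
FormallySelfDual {q} {n} C =
  (size C ℕ.^ 2 ≡ q ℕ.^ n) ×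
  (∀ (x y : ℤ) → (+ size C) ℤ.* W C x y
                ≡ W C (x ℤ.+ (+ (q ∸ 1)) ℤ.* y) (x ℤ.- y))

WeightsDivisibleBy : ∀ {q n} → ℕ → Code q n → Set
WeightsDivisibleBy c C = All (λ u → c ∣ wt u) (words C)

Admissible : ℕ → ℕ → Set
Admissible q c = (c ≡ 1) ⊎ ((q ≡ 2 × c ≡ 2) ⊎ ((q ≡ 2 × c ≡ 4) ⊎ ((q ≡ 3 × c ≡ 3) ⊎ (q ≡ 4 × c ≡ 2))))

-- The rational a/b (b ≥ 1) exceeds the real number
--   B = ((q-1)/q) (1 - (c+1)^{-1/c})     (for q ≥ 2, c ≥ 1).
-- Indeed a/b > B  ⇔  s < (c+1)^{-1/c}  where s = (b(q-1) - a q)/(b(q-1));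
-- if s ≤ 0 this always holds, and if s > 0 it is ⇔ (c+1) s^c < 1.
-- With truncated subtraction both cases are:
--   (c+1) (b(q-1) ∸ aq)^c < (b(q-1))^c.
ExceedsBound : (q c a b : ℕ) → Set
ExceedsBound q c a b =
  (c ℕ.+ 1) ℕ.* ((b ℕ.* (q ∸ 1)) ∸ (a ℕ.* q)) ℕ.^ c < (b ℕ.* (q ∸ 1)) ℕ.^ c

TendsToInfinity : (ℕ → ℕ) → Set
TendsToInfinity f = ∀ N → ∃ λ I → ∀ i → I ≤ i → N ≤ f i

-- limsup_i (x i / y i) ≤ B, where B is given by ExceedsBound:
-- for every rational a/b > B, eventually x i / y i ≤ a/b (i.e. b·x i ≤ a·y i).
LimsupRatioLeBound : (q c : ℕ) → (ℕ → ℕ) → (ℕ → ℕ) → Set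
LimsupRatioLeBound q c x y =
  ∀ a b → 1 ≤ b → ExceedsBound q c a b →
    ∃ λ I → ∀ i → I ≤ i → b ℕ.* x i ≤ a ℕ.* y i

{-# OPTIONS --safe #-}
module Submission where

-- Write W_C(1,y) = f(v) with v = y^c. The lines through 0 and the c-th roots of unity (and ∞ when q = 2 and c > 1)
-- form one orbit of the group generated by the MacWilliams map σ and y ↦ ζy, so P = y(x^c - y^c) (times x in the
-- latter case) is an eigenvector of σ; with an invariant E (Gleason) every f is a combination of E^a P^{ci}.
-- Each of these becomes an exact form after multiplication by J/P^k, J the Jacobian of E and P, which gives
-- the identity [v^K] f(v) g(v) (1-v)^{-(cK+1)} = 0 for g = E^s J H(E^b, P^c) and n ≈ NcK, N = deg P.
-- The weight j = ci enters with the coefficient [v^{K-i}] g (1-v)^{-(cK+1)}, whose sign for large n is that of g at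
-- the saddle point v = (K-i)/(cK+K-i). For i = 0 this is v = 1/(c+1), the critical point y₀ of y(1-y^c), and for the
-- weight n(q-1)/q (1-y₀) it is σ(y₀)^c. The factor J is odd under σ, so g can be made positive both at 1/(c+1) and on
-- [0, σ(y₀)^c - ε] by a factor H changing sign just below t(y₀), t = P^c/E^b. If all nonzero weights
-- exceed the bound, every term of the identity is then nonnegative and the term of the zero word is positive.

open import Defs
open import Data.Empty using (⊥-elim)
open import Data.Fin.Base as Fin using ()
open import Data.Fin.Properties using (_≟_)
open import Data.Integer.Base as ℤ using (ℤ; +_; -[1+_]; _+_; _*_; -_; _-_; _^_; ∣_∣; 0ℤ; 1ℤ; -1ℤ)
import Data.Integer.Properties as ℤₚ
open import Data.Integer.Tactic.RingSolver using (solve-∀)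
open import Data.List.Base using (List; []; _∷_; length; _∷ʳ_; foldr; map; concatMap; InitLast; initLast; _∷ʳ′_)
open import Data.List.Membership.Propositional using (_∈_)
open import Data.List.Membership.Propositional.Properties using (∈-concatMap⁺)
import Data.List.Properties as Listₚ
open import Data.List.Relation.Unary.All as All using (All; []; _∷_)
open import Data.List.Relation.Unary.Any as Any using (here; there)
open import Data.Nat using (ℕ; _≤_)
open import Data.Nat.Base as ℕ using (zero; suc; s≤s; z≤n)
open import Data.Nat.Coprimality as Coprimality using (Coprime; coprime-divisor; coprime-/gcd)
open import Data.Nat.Divisibility using (_∣_; divides; ∣-refl)
import Data.Nat.DivMod as DivMod
open import Data.Nat.GCD using (gcd; gcd[m,n]∣m; gcd[m,n]∣n; gcd[m,n]≢0)
import Data.Nat.Properties as ℕₚ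
import Data.Nat.Tactic.RingSolver as ℕSolver
open import Data.Product.Base using (_×_; _,_; ∃; ∃₂; proj₁; proj₂)
open import Data.Sum.Base using (_⊎_; inj₁; inj₂; [_,_]′)
open import Data.Vec.Base using ([]; _∷_)
open import Data.Vec.Properties using (≡-dec)
open import Function.Base using (_∘_)
open import Relation.Binary.Definitions using (tri<; tri≈; tri>)
open import Relation.Binary.PropositionalEquality using (_≡_; _≢_; refl; sym; trans; cong; cong₂; subst; subst₂; module ≡-Reasoning)
open import Relation.Nullary using (¬_; yes; no)

-- Gleason's theorem is proved in place. Subtracting from f a combination of the first K elements
-- E^a P^(ci) leaves a multiple of v^K, that is, order cK at y = 0. The remainder is again an
-- eigenvector of σ, so it has the same order at y = 1 and, being a polynomial in y^c, at every c-th
-- root of unity; if infinity lies in the orbit, it has this order there too. These are NcK > n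
-- zeros, so the remainder is 0. Exactness fixes the exponent of E modulo b, whereas n is arbitrary:
-- the factor E^s fills the gap, with s < b. H may be any linear form in t because two consecutive
-- powers of P^c both give exact forms; one sign change is all that is wanted. Everything happens
-- over the integers. The saddle point becomes the estimate (M/T)^i for a ratio of binomial
-- coefficients, with an explicit error; a root of unity becomes an integer y modulo y^2 + y + 1 or
-- y^2 + 1; and a constant term is shown to vanish because every positive integer divides it.

Poly : Set
Poly = List ℤ

-- Polynomials over ℤ as coefficient lists, and their linear functionals

infixl 6 _⊕_
infixl 7 _⊛_
infixr 8 _⊛^_

-- Every linear functional on polynomials has the form dot c.
dot : (ℕ → ℤ) → Poly → ℤ
dot c []      = 0ℤ
dot c (a ∷ p) = a * c 0 + dot (c ∘ suc) p

_⊕_ : Poly → Poly → Poly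
[]      ⊕ q       = q
(a ∷ p) ⊕ []      = a ∷ p
(a ∷ p) ⊕ (b ∷ q) = (a + b) ∷ (p ⊕ q)

scale : ℤ → Poly → Poly
scale k []      = []
scale k (a ∷ p) = k * a ∷ scale k p

_⊛_ : Poly → Poly → Poly
[]      ⊛ q = []
(a ∷ p) ⊛ q = scale a q ⊕ (0ℤ ∷ p ⊛ q)

_⊛^_ : Poly → ℕ → Poly
p ⊛^ zero  = 1ℤ ∷ []
p ⊛^ suc k = p ⊛ (p ⊛^ k)

dot-cong-< : ∀ {c d} p → (∀ i → i ℕ.< length p → c i ≡ d i) → dot c p ≡ dot d p
dot-cong-< []      h = refl
dot-cong-< (a ∷ p) h = cong₂ (λ u v → a * u + v) (h 0 (s≤s z≤n)) (dot-cong-< p (λ i i< → h (suc i) (s≤s i<)))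

dot-cong : ∀ {c d} p → (∀ i → c i ≡ d i) → dot c p ≡ dot d p
dot-cong p h = dot-cong-< p (λ i _ → h i)

dot-+ : ∀ c d p → dot (λ i → c i + d i) p ≡ dot c p + dot d p
dot-+ c d []      = refl
dot-+ c d (a ∷ p) = trans (cong (_+_ (a * (c 0 + d 0))) (dot-+ (c ∘ suc) (d ∘ suc) p)) (eq a (c 0) (d 0) _ _)
  where
  eq : ∀ a x y u v → a * (x + y) + (u + v) ≡ (a * x + u) + (a * y + v)
  eq = solve-∀

dot-* : ∀ k c p → dot (λ i → k * c i) p ≡ k * dot c p
dot-* k c []      = sym (ℤₚ.*-zeroʳ k)
dot-* k c (a ∷ p) = trans (cong (_+_ (a * (k * c 0))) (dot-* k (c ∘ suc) p)) (eq a k (c 0) _)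
  where
  eq : ∀ a k x u → a * (k * x) + k * u ≡ k * (a * x + u)
  eq = solve-∀

dot-⊕ : ∀ c p q → dot c (p ⊕ q) ≡ dot c p + dot c q
dot-⊕ c []      q       = sym (ℤₚ.+-identityˡ _)
dot-⊕ c (a ∷ p) []      = sym (ℤₚ.+-identityʳ _)
dot-⊕ c (a ∷ p) (b ∷ q) = trans (cong (_+_ ((a + b) * c 0)) (dot-⊕ (c ∘ suc) p q)) (eq a b (c 0) _ _)
  where
  eq : ∀ a b x u v → (a + b) * x + (u + v) ≡ (a * x + u) + (b * x + v)
  eq = solve-∀

dot-scale : ∀ c k p → dot c (scale k p) ≡ k * dot c p
dot-scale c k []      = sym (ℤₚ.*-zeroʳ k)
dot-scale c k (a ∷ p) = trans (cong (_+_ (k * a * c 0)) (dot-scale (c ∘ suc) k p)) (eq k a (c 0) _)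
  where
  eq : ∀ k a x u → k * a * x + k * u ≡ k * (a * x + u)
  eq = solve-∀

dot-⊛ : ∀ c p q → dot c (p ⊛ q) ≡ dot (λ i → dot (λ j → c (i ℕ.+ j)) q) p
dot-⊛ c []      q = refl
dot-⊛ c (a ∷ p) q = begin
  dot c (scale a q ⊕ (0ℤ ∷ p ⊛ q))                   ≡⟨ dot-⊕ c (scale a q) _ ⟩
  dot c (scale a q) + (0ℤ * c 0 + dot (c ∘ suc) (p ⊛ q))
    ≡⟨ cong₂ _+_ (dot-scale c a q) (trans (ℤₚ.+-identityˡ _) (dot-⊛ (c ∘ suc) p q)) ⟩
  a * dot c q + dot (λ i → dot (λ j → c (suc (i ℕ.+ j))) q) p ∎
  where open ≡-Reasoning

dot-zero : ∀ c {p} → All (_≡ 0ℤ) p → dot c p ≡ 0ℤ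
dot-zero c []          = refl
dot-zero c (refl ∷ zs) = trans (ℤₚ.+-identityˡ _) (dot-zero (c ∘ suc) zs)

eval : ℤ → Poly → ℤ
eval X = dot (X ^_)

eval-∷ : ∀ X a p → eval X (a ∷ p) ≡ a + X * eval X p
eval-∷ X a p = cong₂ _+_ (ℤₚ.*-identityʳ a) (dot-* X (X ^_) p)

eval-⊛ : ∀ X p q → eval X (p ⊛ q) ≡ eval X p * eval X q
eval-⊛ X p q = begin
  eval X (p ⊛ q)                                 ≡⟨ dot-⊛ (X ^_) p q ⟩
  dot (λ i → dot (λ j → X ^ (i ℕ.+ j)) q) p      ≡⟨ dot-cong p (λ i → trans (dot-cong q (λ j → ℤₚ.^-distribˡ-+-* X i j)) (dot-* (X ^ i) (X ^_) q)) ⟩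
  dot (λ i → X ^ i * eval X q) p                 ≡⟨ dot-cong p (λ i → ℤₚ.*-comm (X ^ i) _) ⟩
  dot (λ i → eval X q * X ^ i) p                 ≡⟨ dot-* (eval X q) (X ^_) p ⟩
  eval X q * eval X p                            ≡⟨ ℤₚ.*-comm (eval X q) _ ⟩
  eval X p * eval X q                            ∎
  where open ≡-Reasoning

eval-⊛^ : ∀ X p k → eval X (p ⊛^ k) ≡ eval X p ^ k
eval-⊛^ X p zero    = refl
eval-⊛^ X p (suc k) = trans (eval-⊛ X p (p ⊛^ k)) (cong (eval X p *_) (eval-⊛^ X p k))

-- Integer values determine coefficients

small-multiple⇒zero : ∀ (a : ℤ) m k → a ≡ + suc m * k → ∣ a ∣ ℕ.≤ m → a ≡ 0ℤ
small-multiple⇒zero a m k h small = cases ∣ k ∣ refl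
  where
  cases : ∀ j → ∣ k ∣ ≡ j → a ≡ 0ℤ
  cases zero    e = trans h (trans (cong (+ suc m *_) (ℤₚ.∣i∣≡0⇒i≡0 e)) (ℤₚ.*-zeroʳ (+ suc m)))
  cases (suc j) e = ⊥-elim (ℕₚ.<-irrefl refl (ℕₚ.≤-trans (s≤s small) (ℕₚ.≤-trans (ℕₚ.m≤m*n (suc m) (suc j)) (ℕₚ.≤-reflexive (sym abs)))))
    where
    abs : ∣ a ∣ ≡ suc m ℕ.* suc j
    abs = trans (cong ∣_∣ h) (trans (ℤₚ.abs-* (+ suc m) k) (cong (suc m ℕ.*_) e))

-- This replaces setting `z = 0` in a polynomial identity in `z`: whatever is a multiple of the
-- variable goes into `k`, and the constant term that is left must be zero.
divisible-by-all⇒zero : ∀ (a : ℤ) (k : ℕ → ℤ) → (∀ z → a ≡ + suc z * k z) → a ≡ 0ℤ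
divisible-by-all⇒zero a k h = small-multiple⇒zero a ∣ a ∣ (k ∣ a ∣) (h ∣ a ∣) ℕₚ.≤-refl

cancel-suc : ∀ z {x y} → + suc z * x ≡ + suc z * y → x ≡ y
cancel-suc z {x} {y} = ℤₚ.*-cancelˡ-≡ (+ suc z) x y

-- Modulo the argument only the constant term survives, so it is divisible by every positive integer
-- and vanishes. One factor of the argument then cancels, and the tail is treated in the same way.
eval-zero⇒zero : ∀ p → (∀ z → eval (+ suc z) p ≡ 0ℤ) → All (_≡ 0ℤ) p
eval-zero⇒zero []      h = []
eval-zero⇒zero (a ∷ p) h = a≡0 ∷ eval-zero⇒zero p tail≡0
  where
  eq : ∀ a x u → a ≡ a + x * u + x * - u
  eq = solve-∀
  a≡0 : a ≡ 0ℤ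
  a≡0 = divisible-by-all⇒zero a (λ z → - eval (+ suc z) p) (λ z → trans (eq a (+ suc z) (eval (+ suc z) p))
    (trans (cong (_+ _) (trans (sym (eval-∷ (+ suc z) a p)) (h z))) (ℤₚ.+-identityˡ _)))
  tail≡0 : ∀ z → eval (+ suc z) p ≡ 0ℤ
  tail≡0 z = cancel-suc z (trans (trans (sym (ℤₚ.+-identityˡ _)) (trans (cong (_+ + suc z * eval (+ suc z) p) (sym a≡0))
    (trans (sym (eval-∷ (+ suc z) a p)) (h z)))) (sym (ℤₚ.*-zeroʳ (+ suc z))))

infix 4 _≈_
-- Lists that differ by trailing zeros denote the same polynomial, hence equality of values and not
-- of lists.
_≈_ : Poly → Poly → Set
p ≈ q = ∀ X → eval X p ≡ eval X q

-- The bridge from ring identities between values to coefficient extraction, which is a functional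
-- of another kind than evaluation.
≈⇒dot : ∀ c {p q} → p ≈ q → dot c p ≡ dot c q
≈⇒dot c {p} {q} h = ℤₚ.i-j≡0⇒i≡j (dot c p) (dot c q) (trans (sym (minus c)) (dot-zero c
  (eval-zero⇒zero (p ⊕ scale -1ℤ q) (λ z → trans (minus ((+ suc z) ^_)) (ℤₚ.i≡j⇒i-j≡0 (h (+ suc z)))))))
  where
  minus : ∀ c → dot c (p ⊕ scale -1ℤ q) ≡ dot c p - dot c q
  minus c = trans (dot-⊕ c p _) (cong (_+_ (dot c p)) (trans (dot-scale c -1ℤ q) (ℤₚ.-1*i≡-i _)))

-- Degree bounds and homogenisation

length-scale : ∀ k p → length (scale k p) ≡ length p
length-scale k []      = refl
length-scale k (a ∷ p) = cong suc (length-scale k p)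

length-⊕ : ∀ {d} p q → length p ℕ.≤ d → length q ℕ.≤ d → length (p ⊕ q) ℕ.≤ d
length-⊕ []      q       hp       hq       = hq
length-⊕ (a ∷ p) []      hp       hq       = hp
length-⊕ (a ∷ p) (b ∷ q) (s≤s hp) (s≤s hq) = s≤s (length-⊕ p q hp hq)

length-⊛ : ∀ {d e} p q → length p ℕ.≤ suc d → length q ℕ.≤ suc e → length (p ⊛ q) ℕ.≤ suc (d ℕ.+ e)
length-⊛ []              q hp       hq = z≤n
length-⊛ {d} {e} (a ∷ p) q (s≤s hp) hq = length-⊕ (scale a q) _
  (ℕₚ.≤-trans (ℕₚ.≤-reflexive (length-scale a q)) (ℕₚ.≤-trans hq (s≤s (ℕₚ.m≤n+m e d))))
  (s≤s (rest p d hp))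
  where
  rest : ∀ p d → length p ℕ.≤ d → length (p ⊛ q) ℕ.≤ d ℕ.+ e
  rest []      d       h = z≤n
  rest (b ∷ p) (suc d) h = length-⊛ (b ∷ p) q h hq

length-⊛^ : ∀ {d} p k → length p ℕ.≤ suc d → length (p ⊛^ k) ℕ.≤ suc (k ℕ.* d)
length-⊛^ p zero    h = s≤s z≤n
length-⊛^ p (suc k) h = length-⊛ p (p ⊛^ k) h (length-⊛^ p k h)

-- Constant term 1 allows the triangular expansion to be solved over ℤ without division.
HeadOne : Poly → Set
HeadOne p = ∃ λ t → p ≡ 1ℤ ∷ t

headOne-⊛ : ∀ {p q} → HeadOne p → HeadOne q → HeadOne (p ⊛ q)
headOne-⊛ (t , refl) (u , refl) = _ , refl

headOne-⊛^ : ∀ {p} k → HeadOne p → HeadOne (p ⊛^ k)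
headOne-⊛^ zero    h = _ , refl
headOne-⊛^ (suc k) h = headOne-⊛ h (headOne-⊛^ k h)

-- Homogenisation of p(v), v = (y/x)^c, to degree n.
hom : ℕ → ℕ → ℤ → ℤ → Poly → ℤ
hom c n x y = dot (λ j → x ^ (n ℕ.∸ c ℕ.* j) * y ^ (c ℕ.* j))

-- Guarantees that the truncated subtraction in the exponents of `hom` is a true one.
Fits : ℕ → ℕ → Poly → Set
Fits c n p = ∀ i → i ℕ.< length p → c ℕ.* i ℕ.≤ n

fits : ∀ c {n} d p → length p ℕ.≤ suc d → c ℕ.* d ℕ.≤ n → Fits c n p
fits c d p hp hd i i< = ℕₚ.≤-trans (ℕₚ.*-monoʳ-≤ c (ℕₚ.≤-pred (ℕₚ.≤-trans i< hp))) hd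

∸-+-interchange : ∀ {m n a b} → a ℕ.≤ m → b ℕ.≤ n → (m ℕ.+ n) ℕ.∸ (a ℕ.+ b) ≡ (m ℕ.∸ a) ℕ.+ (n ℕ.∸ b)
∸-+-interchange {m} {n} {a} {b} a≤m b≤n = begin
  (m ℕ.+ n) ℕ.∸ (a ℕ.+ b)   ≡⟨ ℕₚ.∸-+-assoc (m ℕ.+ n) a b ⟨
  (m ℕ.+ n) ℕ.∸ a ℕ.∸ b     ≡⟨ cong (ℕ._∸ b) (ℕₚ.+-∸-comm n a≤m) ⟩
  ((m ℕ.∸ a) ℕ.+ n) ℕ.∸ b   ≡⟨ ℕₚ.+-∸-assoc (m ℕ.∸ a) b≤n ⟩
  (m ℕ.∸ a) ℕ.+ (n ℕ.∸ b)   ∎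
  where open ≡-Reasoning

hom-⊛ : ∀ c {m n} x y {p q} → Fits c m p → Fits c n q → hom c (m ℕ.+ n) x y (p ⊛ q) ≡ hom c m x y p * hom c n x y q
hom-⊛ c {m} {n} x y {p} {q} fp fq = begin
  hom c (m ℕ.+ n) x y (p ⊛ q)
    ≡⟨ dot-⊛ (w (m ℕ.+ n)) p q ⟩
  dot (λ i → dot (λ j → w (m ℕ.+ n) (i ℕ.+ j)) q) p
    ≡⟨ dot-cong-< p (λ i i< → trans (dot-cong-< q (λ j j< → split i j (fp i i<) (fq j j<))) (dot-* (w m i) (w n) q)) ⟩
  dot (λ i → w m i * hom c n x y q) p
    ≡⟨ dot-cong p (λ i → ℤₚ.*-comm (w m i) _) ⟩
  dot (λ i → hom c n x y q * w m i) p
    ≡⟨ dot-* (hom c n x y q) (w m) p ⟩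
  hom c n x y q * hom c m x y p
    ≡⟨ ℤₚ.*-comm (hom c n x y q) _ ⟩
  hom c m x y p * hom c n x y q ∎
  where
  open ≡-Reasoning
  w : ℕ → ℕ → ℤ
  w n j = x ^ (n ℕ.∸ c ℕ.* j) * y ^ (c ℕ.* j)
  eq : ∀ a b u v → (a * b) * (u * v) ≡ (a * u) * (b * v)
  eq = solve-∀
  split : ∀ i j → c ℕ.* i ℕ.≤ m → c ℕ.* j ℕ.≤ n → w (m ℕ.+ n) (i ℕ.+ j) ≡ w m i * w n j
  split i j hi hj rewrite ℕₚ.*-distribˡ-+ c i j | ∸-+-interchange hi hj
    | ℤₚ.^-distribˡ-+-* x (m ℕ.∸ c ℕ.* i) (n ℕ.∸ c ℕ.* j) | ℤₚ.^-distribˡ-+-* y (c ℕ.* i) (c ℕ.* j)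
    = eq (x ^ (m ℕ.∸ c ℕ.* i)) _ _ _

fits-⊛^ : ∀ c {n d} p k → length p ℕ.≤ suc d → c ℕ.* d ℕ.≤ n → Fits c (k ℕ.* n) (p ⊛^ k)
fits-⊛^ c {n} {d} p k hp hd = fits c (k ℕ.* d) (p ⊛^ k) (length-⊛^ p k hp)
  (ℕₚ.≤-trans (ℕₚ.≤-reflexive (eq c k d)) (ℕₚ.*-monoʳ-≤ k hd))
  where
  eq : ∀ c k d → c ℕ.* (k ℕ.* d) ≡ k ℕ.* (c ℕ.* d)
  eq c k d = trans (sym (ℕₚ.*-assoc c k d)) (trans (cong (ℕ._* d) (ℕₚ.*-comm c k)) (ℕₚ.*-assoc k c d))

hom-⊛^ : ∀ c {n d} x y p k → length p ℕ.≤ suc d → c ℕ.* d ℕ.≤ n → hom c (k ℕ.* n) x y (p ⊛^ k) ≡ hom c n x y p ^ k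
hom-⊛^ c x y p zero    hp hd rewrite ℕₚ.*-zeroʳ c = refl
hom-⊛^ c {n} {d} x y p (suc k) hp hd = trans
  (hom-⊛ c x y {p} {p ⊛^ k} (fits c d p hp hd) (fits-⊛^ c p k hp hd))
  (cong (hom c n x y p *_) (hom-⊛^ c x y p k hp hd))

-- Order of vanishing at v = 1 and at infinity

quot : Poly → Poly
quot []          = []
quot (a ∷ [])    = []
quot (a ∷ b ∷ r) = eval 1ℤ (b ∷ r) ∷ quot (b ∷ r)

-- Division with remainder by `X - 1`: `quot` is Horner's scheme, whose coefficients are the values
-- at 1 of the tails.
quot-eval : ∀ X r → eval X r ≡ eval 1ℤ r + (X - 1ℤ) * eval X (quot r)
quot-eval X []          = sym (trans (ℤₚ.+-identityˡ _) (ℤₚ.*-zeroʳ (X - 1ℤ)))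
quot-eval X (a ∷ [])    = sym (trans (cong (_+_ (a * 1ℤ + 0ℤ)) (ℤₚ.*-zeroʳ (X - 1ℤ))) (ℤₚ.+-identityʳ (a * 1ℤ + 0ℤ)))
quot-eval X (a ∷ r@(b ∷ _)) = begin
  eval X (a ∷ r)                                 ≡⟨ eval-∷ X a r ⟩
  a + X * eval X r                               ≡⟨ cong (λ u → a + X * u) (quot-eval X r) ⟩
  a + X * (r1 + (X - 1ℤ) * eval X (quot r))      ≡⟨ eq a X r1 _ ⟩
  (a + 1ℤ * r1) + (X - 1ℤ) * (r1 + X * eval X (quot r))
    ≡⟨ cong₂ (λ u v → u + (X - 1ℤ) * v) (eval-∷ 1ℤ a r) (eval-∷ X r1 (quot r)) ⟨
  eval 1ℤ (a ∷ r) + (X - 1ℤ) * eval X (quot (a ∷ r)) ∎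
  where
  open ≡-Reasoning
  r1 = eval 1ℤ r
  eq : ∀ a X r u → a + X * (r + (X - 1ℤ) * u) ≡ (a + 1ℤ * r) + (X - 1ℤ) * (r + X * u)
  eq = solve-∀

length-quot : ∀ a r → length (quot (a ∷ r)) ≡ length r
length-quot a []      = refl
length-quot a (b ∷ r) = cong suc (length-quot b r)

-- `geo c z` is `((1 + z) ^ c - 1) / z`, and `geo′ c z` is `(geo c z - c) / z`, both as polynomials
-- in `z`.
geo geo′ : ℕ → ℤ → ℤ
geo zero    z = 0ℤ
geo (suc c) z = 1ℤ + geo c z + z * geo c z
geo′ zero    z = 0ℤ
geo′ (suc c) z = geo′ c z + geo c z

geo-spec : ∀ c z → (1ℤ + z) ^ c ≡ 1ℤ + z * geo c z
geo-spec zero    z = sym (cong (_+_ 1ℤ) (ℤₚ.*-zeroʳ z))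
geo-spec (suc c) z = trans (cong ((1ℤ + z) *_) (geo-spec c z)) (eq z (geo c z))
  where
  eq : ∀ z g → (1ℤ + z) * (1ℤ + z * g) ≡ 1ℤ + z * (1ℤ + g + z * g)
  eq = solve-∀

geo′-spec : ∀ c z → geo c z ≡ + c + z * geo′ c z
geo′-spec zero    z = sym (trans (ℤₚ.+-identityˡ _) (ℤₚ.*-zeroʳ z))
geo′-spec (suc c) z = trans (cong (λ u → 1ℤ + u + z * geo c z) (geo′-spec c z)) (eq (+ c) z (geo′ c z) (geo c z))
  where
  eq : ∀ c z g′ g → 1ℤ + (c + z * g′) + z * g ≡ (1ℤ + c) + z * (g′ + g)
  eq = solve-∀

nonzero-* : ∀ {i j} → i ≢ 0ℤ → j ≢ 0ℤ → i * j ≢ 0ℤ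
nonzero-* {i} hi hj ij = [ hi , hj ]′ (ℤₚ.i*j≡0⇒i≡0∨j≡0 i ij)

-- With v = y^c and y = 1 + z, the hypothesis gives `r` order at least `m` at y = 1, which is more
-- than its degree. Since v - 1 is z times `geo c z`, and the latter is `c` at z = 0, splitting off
-- a factor v - 1 costs exactly one power of z. The factor `geo c z` is absorbed into `u`, of which
-- the induction keeps only that its value at z = 0 is nonzero.
high-order⇒zero : ∀ c .{{_ : ℕ.NonZero c}} m r (u k w : ℕ → ℤ) u₀ → u₀ ≢ 0ℤ →
  (∀ z → u z ≡ u₀ + + suc z * k z) →
  (∀ z → u z * eval ((1ℤ + + suc z) ^ c) r ≡ (+ suc z) ^ m * w z) →
  length r ℕ.≤ m → ∀ X → eval X r ≡ 0ℤ
high-order⇒zero c m       []      u k w u₀ u₀≢0 hu h len X = refl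
high-order⇒zero c@(suc _) (suc m) r@(a ∷ t) u k w u₀ u₀≢0 hu h (s≤s len) X =
  trans (quot-eval X r) (trans (cong₂ (λ i j → i + (X - 1ℤ) * j) r1≡0 (ih X)) (trans (ℤₚ.+-identityˡ _) (ℤₚ.*-zeroʳ (X - 1ℤ))))
  where
  Q : ℕ → ℤ
  Q z = eval ((1ℤ + + suc z) ^ c) (quot r)
  r1 = eval 1ℤ r
  expand : ∀ z → u z * (r1 + + suc z * geo c (+ suc z) * Q z) ≡ + suc z * ((+ suc z) ^ m * w z)
  expand z = trans (sym (cong (u z *_) (trans (quot-eval ((1ℤ + + suc z) ^ c) r)
      (cong (λ V → r1 + V * Q z) (trans (cong (_- 1ℤ) (geo-spec c (+ suc z))) (eq (+ suc z) (geo c (+ suc z))))))))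
    (trans (h z) (ℤₚ.*-assoc (+ suc z) ((+ suc z) ^ m) (w z)))
    where
    eq : ∀ z g → 1ℤ + z * g - 1ℤ ≡ z * g
    eq = solve-∀
  u₀r1≡0 : u₀ * r1 ≡ 0ℤ
  -- The equation `expand` read modulo `suc z`.
  u₀r1≡0 = divisible-by-all⇒zero _ (λ z → (+ suc z) ^ m * w z - u z * geo c (+ suc z) * Q z - k z * r1)
    (λ z → begin
      u₀ * r1  ≡⟨ eq₁ u₀ r1 (+ suc z) (k z) (geo c (+ suc z)) (Q z) ⟩
      (u₀ + + suc z * k z) * (r1 + + suc z * geo c (+ suc z) * Q z)
        - + suc z * ((u₀ + + suc z * k z) * geo c (+ suc z) * Q z + k z * r1)
        ≡⟨ cong (λ v → v * (r1 + + suc z * geo c (+ suc z) * Q z) - + suc z * (v * geo c (+ suc z) * Q z + k z * r1)) (hu z) ⟨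
      u z * (r1 + + suc z * geo c (+ suc z) * Q z) - + suc z * (u z * geo c (+ suc z) * Q z + k z * r1)
        ≡⟨ cong (_- + suc z * (u z * geo c (+ suc z) * Q z + k z * r1)) (expand z) ⟩
      + suc z * ((+ suc z) ^ m * w z) - + suc z * (u z * geo c (+ suc z) * Q z + k z * r1)
        ≡⟨ eq₂ (+ suc z) ((+ suc z) ^ m * w z) (u z * geo c (+ suc z) * Q z) (k z * r1) ⟩
      + suc z * ((+ suc z) ^ m * w z - u z * geo c (+ suc z) * Q z - k z * r1) ∎)
    where
    open ≡-Reasoning
    eq₁ : ∀ u r z k g q → u * r ≡ (u + z * k) * (r + z * g * q) - z * ((u + z * k) * g * q + k * r)
    eq₁ = solve-∀
    eq₂ : ∀ z a b c → z * a - z * (b + c) ≡ z * (a - b - c)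
    eq₂ = solve-∀
  r1≡0 : r1 ≡ 0ℤ
  r1≡0 = [ (λ e → ⊥-elim (u₀≢0 e)) , (λ e → e) ]′ (ℤₚ.i*j≡0⇒i≡0∨j≡0 u₀ u₀r1≡0)
  ih : ∀ X → eval X (quot r) ≡ 0ℤ
  ih = high-order⇒zero c m (quot r) (λ z → u z * geo c (+ suc z))
    (λ z → k z * + c + u z * geo′ c (+ suc z)) w (u₀ * + c) (nonzero-* u₀≢0 (λ ()))
    (λ z → trans (cong (u z *_) (geo′-spec c (+ suc z)))
      (trans (eq₁ (u z) (+ c) (+ suc z) (geo′ c (+ suc z))) (trans (cong (λ v → v * + c + + suc z * (u z * geo′ c (+ suc z))) (hu z)) (eq₂ u₀ (+ c) (+ suc z) (k z) _))))
    (λ z → cancel-suc z (trans (trans (eq₃ (+ suc z) (u z) (geo c (+ suc z)) (Q z)) (cong (λ v → u z * (v + + suc z * geo c (+ suc z) * Q z)) (sym r1≡0))) (expand z)))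
    (ℕₚ.≤-trans (ℕₚ.≤-reflexive (length-quot a t)) len)
    where
    eq₁ : ∀ u c z g → u * (c + z * g) ≡ u * c + z * (u * g)
    eq₁ = solve-∀
    eq₂ : ∀ u c z k v → (u + z * k) * c + z * v ≡ u * c + z * (k * c + v)
    eq₂ = solve-∀
    eq₃ : ∀ z u g q → z * (u * g * q) ≡ u * (0ℤ + z * g * q)
    eq₃ = solve-∀

dot-∷ʳ : ∀ c p a → dot c (p ∷ʳ a) ≡ dot c p + a * c (length p)
dot-∷ʳ c []      a = trans (ℤₚ.+-identityʳ (a * c 0)) (sym (ℤₚ.+-identityˡ (a * c 0)))
dot-∷ʳ c (b ∷ p) a = trans (cong (_+_ (b * c 0)) (dot-∷ʳ (c ∘ suc) p a)) (sym (ℤₚ.+-assoc (b * c 0) _ _))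

pow-suc-nonzero : ∀ z m → (+ suc z) ^ m ≢ 0ℤ
pow-suc-nonzero z zero    ()
pow-suc-nonzero z (suc m) = nonzero-* {+ suc z} (λ ()) (pow-suc-nonzero z m)

cancel-nonzero : ∀ i {x y} → i ≢ 0ℤ → i * x ≡ i * y → x ≡ y
cancel-nonzero i {x} {y} i≢0 = ℤₚ.*-cancelˡ-≡ i x y {{ℤ.≢-nonZero i≢0}}

-- The reversed polynomial is divisible by v^K, so the top K coefficients of f vanish.
drop-top : ∀ c .{{_ : ℕ.NonZero c}} K D f (w : ℕ → ℤ) →
  (∀ z → dot (λ j → (+ suc z) ^ (c ℕ.* (D ℕ.∸ j))) f ≡ (+ suc z) ^ (c ℕ.* K) * w z) →
  length f ℕ.≤ suc D → ∃ λ f′ → length f′ ℕ.≤ suc D ℕ.∸ K × (∀ e → dot e f ≡ dot e f′)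
drop-top c          zero    D f w h len = f , len , λ _ → refl
drop-top c@(suc c′) (suc K) D f w h len = split f h len (initLast f)
  where
  Vanishes : ℕ → Poly → Set
  Vanishes D f = ∀ z → dot (λ j → (+ suc z) ^ (c ℕ.* (D ℕ.∸ j))) f ≡ (+ suc z) ^ (c ℕ.* suc K) * w z

  factor : ∀ z D f → length f ℕ.≤ suc D →
    dot (λ j → (+ suc z) ^ (c ℕ.* (suc D ℕ.∸ j))) f ≡ (+ suc z) ^ c * dot (λ j → (+ suc z) ^ (c ℕ.* (D ℕ.∸ j))) f
  factor z D f len = trans
    (dot-cong-< f (λ j j< → trans
      (cong ((+ suc z) ^_) (trans (cong (c ℕ.*_) (ℕₚ.+-∸-assoc 1 (ℕₚ.≤-pred (ℕₚ.≤-trans j< len)))) (ℕₚ.*-suc c (D ℕ.∸ j))))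
      (ℤₚ.^-distribˡ-+-* (+ suc z) c (c ℕ.* (D ℕ.∸ j)))))
    (dot-* ((+ suc z) ^ c) (λ j → (+ suc z) ^ (c ℕ.* (D ℕ.∸ j))) f)

  pow-suc : ∀ z → (+ suc z) ^ (c ℕ.* suc K) * w z ≡ (+ suc z) ^ c * ((+ suc z) ^ (c ℕ.* K) * w z)
  pow-suc z = trans (cong (λ v → (+ suc z) ^ v * w z) (ℕₚ.*-suc c K))
    (trans (cong (_* w z) (ℤₚ.^-distribˡ-+-* (+ suc z) c (c ℕ.* K))) (ℤₚ.*-assoc ((+ suc z) ^ c) ((+ suc z) ^ (c ℕ.* K)) (w z)))

  shorter : ∀ D f → Vanishes D f → length f ℕ.≤ D → ∃ λ f′ → length f′ ℕ.≤ D ℕ.∸ K × (∀ e → dot e f ≡ dot e f′)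
  shorter zero    []  h len = [] , z≤n , λ _ → refl
  shorter (suc D) f   h len = drop-top c K D f w (λ z → cancel-nonzero ((+ suc z) ^ c) (pow-suc-nonzero z c)
    (trans (sym (factor z D f len)) (trans (h z) (pow-suc z)))) len

  split : ∀ f → Vanishes D f → length f ℕ.≤ suc D → InitLast f →
    ∃ λ f′ → length f′ ℕ.≤ D ℕ.∸ K × (∀ e → dot e f ≡ dot e f′)
  split .[] h len InitLast.[] = [] , z≤n , λ _ → refl
  split .(g ∷ʳ a) h len (g ∷ʳ′ a) with ℕₚ.m≤n⇒m<n∨m≡n len
  ... | inj₁ (s≤s len′) = shorter D (g ∷ʳ a) h len′
  ... | inj₂ len′ = proj₁ rec , proj₁ (proj₂ rec) , λ e → trans (same e) (proj₂ (proj₂ rec) e)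
    where
    length-g : length g ≡ D
    length-g = ℕₚ.suc-injective (trans (sym (trans (Listₚ.length-++ g) (ℕₚ.+-comm (length g) 1))) len′)
    top-weight : ∀ z → (+ suc z) ^ (c ℕ.* (D ℕ.∸ length g)) ≡ 1ℤ
    top-weight z rewrite length-g | ℕₚ.n∸n≡0 D | ℕₚ.*-zeroʳ c′ = refl
    divides-init : ∀ D → length g ≡ D → ∃ λ (k : ℕ → ℤ) → ∀ z → dot (λ j → (+ suc z) ^ (c ℕ.* (D ℕ.∸ j))) g ≡ + suc z * k z
    divides-init zero eq = (λ _ → 0ℤ) , λ z → trans (go g eq _) (sym (ℤₚ.*-zeroʳ (+ suc z)))
      where
      go : ∀ g → length g ≡ 0 → ∀ e → dot e g ≡ 0ℤ
      go [] _ e = refl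
    divides-init (suc D) eq =
        (λ z → (+ suc z) ^ c′ * dot (λ j → (+ suc z) ^ (c ℕ.* (D ℕ.∸ j))) g)
      , λ z → trans (factor z D g (ℕₚ.≤-reflexive eq)) (ℤₚ.*-assoc (+ suc z) ((+ suc z) ^ c′) (dot (λ j → (+ suc z) ^ (c ℕ.* (D ℕ.∸ j))) g))
    k = proj₁ (divides-init D length-g)
    -- Here the degree bound is attained, so `a` is the constant term of the reversed polynomial;
    -- all other terms and the right-hand side are multiples of `suc z`.
    a≡0 : a ≡ 0ℤ
    a≡0 = divisible-by-all⇒zero a (λ z → (+ suc z) ^ (c′ ℕ.+ c ℕ.* K) * w z - k z) (λ z → begin
      a ≡⟨ eq₁ a (+ suc z) (k z) ⟩
      (+ suc z * k z + a * 1ℤ) - + suc z * k z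
        ≡⟨ cong (_- + suc z * k z) (cong₂ (λ i j → i + a * j) (sym (proj₂ (divides-init D length-g) z)) (sym (top-weight z))) ⟩
      (dot (λ j → (+ suc z) ^ (c ℕ.* (D ℕ.∸ j))) g + a * (+ suc z) ^ (c ℕ.* (D ℕ.∸ length g))) - + suc z * k z
        ≡⟨ cong (_- + suc z * k z) (trans (sym (dot-∷ʳ _ g a)) (h z)) ⟩
      (+ suc z) ^ (c ℕ.* suc K) * w z - + suc z * k z
        ≡⟨ cong (λ v → (+ suc z) ^ v * w z - + suc z * k z) (ℕₚ.*-suc c K) ⟩
      + suc z * (+ suc z) ^ (c′ ℕ.+ c ℕ.* K) * w z - + suc z * k z
        ≡⟨ eq₂ (+ suc z) ((+ suc z) ^ (c′ ℕ.+ c ℕ.* K)) (w z) (k z) ⟩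
      + suc z * ((+ suc z) ^ (c′ ℕ.+ c ℕ.* K) * w z - k z) ∎)
      where
      open ≡-Reasoning
      eq₁ : ∀ a z k → a ≡ (z * k + a * 1ℤ) - z * k
      eq₁ = solve-∀
      eq₂ : ∀ z p w k → z * p * w - z * k ≡ z * (p * w - k)
      eq₂ = solve-∀
    same : ∀ e → dot e (g ∷ʳ a) ≡ dot e g
    same e = trans (dot-∷ʳ e g a) (trans (cong (λ v → dot e g + v * e (length g)) a≡0) (ℤₚ.+-identityʳ (dot e g)))
    rec = shorter D g (λ z → trans (sym (same (λ j → (+ suc z) ^ (c ℕ.* (D ℕ.∸ j))))) (h z)) (ℕₚ.≤-reflexive length-g)

-- Triangular expansion

sumTo : ℕ → (ℕ → ℤ) → ℤ
sumTo zero    g = 0ℤ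
sumTo (suc K) g = g 0 + sumTo K (g ∘ suc)

sumTo-zero : ∀ K {g} → (∀ i → i ℕ.< K → g i ≡ 0ℤ) → sumTo K g ≡ 0ℤ
sumTo-zero zero    h = refl
sumTo-zero (suc K) h = cong₂ _+_ (h 0 (s≤s z≤n)) (sumTo-zero K (λ i i< → h (suc i) (s≤s i<)))

sumTo-cong : ∀ K {g h} → (∀ i → i ℕ.< K → g i ≡ h i) → sumTo K g ≡ sumTo K h
sumTo-cong zero    e = refl
sumTo-cong (suc K) e = cong₂ _+_ (e 0 (s≤s z≤n)) (sumTo-cong K (λ i i< → e (suc i) (s≤s i<)))

sumTo-* : ∀ k K g → sumTo K (λ i → k * g i) ≡ k * sumTo K g
sumTo-* k zero    g = sym (ℤₚ.*-zeroʳ k)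
sumTo-* k (suc K) g = trans (cong (_+_ (k * g 0)) (sumTo-* k K (g ∘ suc))) (sym (ℤₚ.*-distribˡ-+ k (g 0) (sumTo K (g ∘ suc))))

-- Triangular expansion f = Σ_{i<K} a_i v^i b_i + v^K f′, tested against all functionals.
expand : ∀ K L (f : Poly) (b : ℕ → Poly) → (∀ i → i ℕ.< K → HeadOne (b i) × length (b i) ℕ.≤ L ℕ.∸ i) → length f ℕ.≤ L →
  ∃₂ λ (a : ℕ → ℤ) (f′ : Poly) → length f′ ℕ.≤ L ℕ.∸ K ×
    (∀ c → dot c f ≡ sumTo K (λ i → a i * dot (λ j → c (i ℕ.+ j)) (b i)) + dot (λ j → c (K ℕ.+ j)) f′)
expand zero    L f b hb hf = (λ _ → 0ℤ) , f , hf , λ c → sym (ℤₚ.+-identityˡ (dot c f))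
expand (suc K) L f b hb hf with hb 0 (s≤s z≤n)
expand (suc K) zero    f b hb hf | (t , b0≡) , len₀ = ⊥-elim (ℕₚ.n≮0 (subst (λ u → length u ℕ.≤ 0) b0≡ len₀))
expand (suc K) (suc L) f b hb hf | (t , b0≡) , len₀ = a , f′ , proj₁ (proj₂ (proj₂ rec)) , λ c → begin
  dot c f                                                     ≡⟨ head-split f hf c ⟩
  h * dot c (1ℤ ∷ t) + dot (c ∘ suc) f₁                       ≡⟨ cong₂ (λ u v → h * dot c u + v) (sym b0≡) (proj₂ (proj₂ (proj₂ rec)) (c ∘ suc)) ⟩
  h * dot c (b 0) + (S c + dot (λ j → c (suc K ℕ.+ j)) f′)    ≡⟨ ℤₚ.+-assoc (h * dot c (b 0)) (S c) (dot (λ j → c (suc K ℕ.+ j)) f′) ⟨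
  h * dot c (b 0) + S c + dot (λ j → c (suc K ℕ.+ j)) f′      ∎
  where
  open ≡-Reasoning
  len-t : length t ℕ.≤ L
  len-t = ℕₚ.≤-pred (subst (λ u → length u ℕ.≤ suc L) b0≡ len₀)
  first : Poly → ℤ
  first []      = 0ℤ
  first (x ∷ _) = x
  rest : Poly → Poly
  rest []      = []
  rest (_ ∷ p) = p
  len-rest : ∀ p → length p ℕ.≤ suc L → length (rest p) ℕ.≤ L
  len-rest []      _       = z≤n
  len-rest (_ ∷ p) (s≤s h) = h
  h  = first f
  f₁ = rest f ⊕ scale (- h) t
  rec = expand K L f₁ (b ∘ suc) (λ i i< → hb (suc i) (s≤s i<))
    (length-⊕ (rest f) (scale (- h) t) (len-rest f hf) (ℕₚ.≤-trans (ℕₚ.≤-reflexive (length-scale (- h) t)) len-t))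
  a : ℕ → ℤ
  a zero    = h
  a (suc i) = proj₁ rec i
  f′ = proj₁ (proj₂ rec)
  S : (ℕ → ℤ) → ℤ
  S c = sumTo K (λ i → proj₁ rec i * dot (λ j → c (suc (i ℕ.+ j))) (b (suc i)))
  head-split : ∀ f → length f ℕ.≤ suc L → ∀ c → dot c f ≡ first f * dot c (1ℤ ∷ t) + dot (c ∘ suc) (rest f ⊕ scale (- first f) t)
  head-split f hf c = trans (lemma f) (cong (_+_ (first f * dot c (1ℤ ∷ t)))
      (sym (trans (dot-⊕ (c ∘ suc) (rest f) (scale (- first f) t)) (cong (_+_ (dot (c ∘ suc) (rest f))) (dot-scale (c ∘ suc) (- first f) t)))))
    where
    eq : ∀ x w u v → x * w + u ≡ x * (1ℤ * w + v) + (u + - x * v)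
    eq = solve-∀
    lemma : ∀ f → dot c f ≡ first f * dot c (1ℤ ∷ t) + (dot (c ∘ suc) (rest f) + - first f * dot (c ∘ suc) t)
    lemma []      = eq 0ℤ (c 0) 0ℤ (dot (c ∘ suc) t)
    lemma (x ∷ p) = eq x (c 0) (dot (c ∘ suc) p) (dot (c ∘ suc) t)

-- Coefficient extraction p ↦ [v^M] p(v) (1 - v)^{-(r+1)}

-- mc r M = C(r + M, M)
mc : ℕ → ℕ → ℕ
mc r       zero    = 1
mc zero    (suc M) = 1
mc (suc r) (suc M) = mc r (suc M) ℕ.+ mc (suc r) M

-- The two absorption identities of binomial coefficients are proved together: after Pascal's rule,
-- each induction step uses both of them at the smaller index.
mc-sucʳ : ∀ r M → suc M ℕ.* mc r (suc M) ≡ (suc r ℕ.+ M) ℕ.* mc r M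
mc-sucˡ : ∀ r M → suc r ℕ.* mc (suc r) M ≡ (suc r ℕ.+ M) ℕ.* mc r M

mc-sucʳ zero    zero    = refl
mc-sucʳ zero    (suc M) = refl
mc-sucʳ (suc r) M = begin
  suc M ℕ.* (mc r (suc M) ℕ.+ mc (suc r) M)                     ≡⟨ ℕₚ.*-distribˡ-+ (suc M) (mc r (suc M)) (mc (suc r) M) ⟩
  suc M ℕ.* mc r (suc M) ℕ.+ suc M ℕ.* mc (suc r) M             ≡⟨ cong (ℕ._+ suc M ℕ.* mc (suc r) M) (trans (mc-sucʳ r M) (sym (mc-sucˡ r M))) ⟩
  suc r ℕ.* mc (suc r) M ℕ.+ suc M ℕ.* mc (suc r) M             ≡⟨ ℕₚ.*-distribʳ-+ (mc (suc r) M) (suc r) (suc M) ⟨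
  (suc r ℕ.+ suc M) ℕ.* mc (suc r) M                            ≡⟨ cong (ℕ._* mc (suc r) M) (ℕₚ.+-suc (suc r) M) ⟩
  (suc (suc r) ℕ.+ M) ℕ.* mc (suc r) M                          ∎
  where open ≡-Reasoning

mc-sucˡ r zero    = cong (ℕ._* 1) (sym (ℕₚ.+-identityʳ (suc r)))
mc-sucˡ r (suc M) = begin
  suc r ℕ.* (mc r (suc M) ℕ.+ mc (suc r) M)                     ≡⟨ ℕₚ.*-distribˡ-+ (suc r) (mc r (suc M)) (mc (suc r) M) ⟩
  suc r ℕ.* mc r (suc M) ℕ.+ suc r ℕ.* mc (suc r) M             ≡⟨ cong (suc r ℕ.* mc r (suc M) ℕ.+_) (trans (mc-sucˡ r M) (sym (mc-sucʳ r M))) ⟩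
  suc r ℕ.* mc r (suc M) ℕ.+ suc M ℕ.* mc r (suc M)             ≡⟨ ℕₚ.*-distribʳ-+ (mc r (suc M)) (suc r) (suc M) ⟨
  (suc r ℕ.+ suc M) ℕ.* mc r (suc M)                            ∎
  where open ≡-Reasoning

mc-pos : ∀ r M → 0 ℕ.< mc r M
mc-pos r       zero    = s≤s z≤n
mc-pos zero    (suc M) = s≤s z≤n
mc-pos (suc r) (suc M) = ℕₚ.≤-trans (mc-pos r (suc M)) (ℕₚ.m≤m+n _ _)

-- The coefficient of v^(M - i) in (1 - v)^(-(r+1)), that is, C(r + M - i, r), and 0 for i > M.
coeff : ℕ → ℕ → ℕ → ℕ
coeff r M       zero    = mc r M
coeff r zero    (suc i) = 0
coeff r (suc M) (suc i) = coeff r M i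

extract : ℕ → ℕ → Poly → ℤ
extract r M = dot (λ i → + coeff r M i)

coeff-shift : ∀ r i M j → coeff r (i ℕ.+ M) (i ℕ.+ j) ≡ coeff r M j
coeff-shift r zero    M j = refl
coeff-shift r (suc i) M j = coeff-shift r i M j

coeff-beyond : ∀ r {M i} → M ℕ.< i → coeff r M i ≡ 0
coeff-beyond r {zero}  {suc i} _       = refl
coeff-beyond r {suc M} {suc i} (s≤s h) = coeff-beyond r h

1-v : Poly
1-v = 1ℤ ∷ -1ℤ ∷ []

-- Pascal's rule says that a factor 1 - v cancels one factor of the denominator (1 - v)^(r+2).
extract-1-v : ∀ r M p → extract (suc r) M (1-v ⊛ p) ≡ extract r M p
extract-1-v r M p = trans (dot-⊛ _ 1-v p) (trans (eq (extract (suc r) M p) (dot (λ j → + coeff (suc r) M (suc j)) p))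
  (sym (trans (dot-cong p (pascal M)) (trans (dot-+ (λ i → + coeff (suc r) M i) (λ i → -1ℤ * + coeff (suc r) M (suc i)) p)
    (cong (_+_ (extract (suc r) M p)) (dot-* -1ℤ (λ i → + coeff (suc r) M (suc i)) p))))))
  where
  eq : ∀ a b → 1ℤ * a + (-1ℤ * b + 0ℤ) ≡ a + -1ℤ * b
  eq = solve-∀
  pascal : ∀ M i → + coeff r M i ≡ + coeff (suc r) M i + -1ℤ * + coeff (suc r) M (suc i)
  pascal zero    zero    = refl
  pascal zero    (suc i) = refl
  pascal (suc M) (suc i) = pascal M i
  pascal (suc M) zero    = trans (eq′ (+ mc r (suc M)) (+ mc (suc r) M)) (cong (_+ -1ℤ * + mc (suc r) M) (sym (ℤₚ.pos-+ (mc r (suc M)) (mc (suc r) M))))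
    where
    eq′ : ∀ a b → a ≡ (a + b) + -1ℤ * b
    eq′ = solve-∀

≈-assoc : ∀ p q r → (p ⊛ q) ⊛ r ≈ p ⊛ (q ⊛ r)
≈-assoc p q r X = begin
  eval X ((p ⊛ q) ⊛ r)             ≡⟨ eval-⊛ X (p ⊛ q) r ⟩
  eval X (p ⊛ q) * eval X r        ≡⟨ cong (_* eval X r) (eval-⊛ X p q) ⟩
  eval X p * eval X q * eval X r   ≡⟨ ℤₚ.*-assoc (eval X p) (eval X q) (eval X r) ⟩
  eval X p * (eval X q * eval X r) ≡⟨ cong (eval X p *_) (eval-⊛ X q r) ⟨
  eval X p * eval X (q ⊛ r)        ≡⟨ eval-⊛ X p (q ⊛ r) ⟨
  eval X (p ⊛ (q ⊛ r))             ∎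
  where open ≡-Reasoning

extract-1-v^ : ∀ m r M p → extract (m ℕ.+ r) M ((1-v ⊛^ m) ⊛ p) ≡ extract r M p
extract-1-v^ zero    r M p = trans (dot-⊛ _ (1ℤ ∷ []) p) (eq (extract r M p))
  where
  eq : ∀ a → 1ℤ * a + 0ℤ ≡ a
  eq = solve-∀
extract-1-v^ (suc m) r M p = trans (≈⇒dot _ {(1-v ⊛ (1-v ⊛^ m)) ⊛ p} {1-v ⊛ ((1-v ⊛^ m) ⊛ p)} (≈-assoc 1-v (1-v ⊛^ m) p))
  (trans (extract-1-v (m ℕ.+ r) M ((1-v ⊛^ m) ⊛ p)) (extract-1-v^ m r M p))

-- The derivation v d/dv and exact forms

θ : Poly → Poly
θ []      = []
θ (a ∷ p) = 0ℤ ∷ (p ⊕ θ p)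

dot-θ : ∀ c p → dot c (θ p) ≡ dot (λ i → + i * c i) p
dot-θ c []      = refl
dot-θ c (a ∷ p) = begin
  0ℤ * c 0 + dot (c ∘ suc) (p ⊕ θ p)                                   ≡⟨ ℤₚ.+-identityˡ (dot (c ∘ suc) (p ⊕ θ p)) ⟩
  dot (c ∘ suc) (p ⊕ θ p)                                              ≡⟨ dot-⊕ (c ∘ suc) p (θ p) ⟩
  dot (c ∘ suc) p + dot (c ∘ suc) (θ p)                                ≡⟨ cong (_+_ (dot (c ∘ suc) p)) (dot-θ (c ∘ suc) p) ⟩
  dot (c ∘ suc) p + dot (λ i → + i * c (suc i)) p                      ≡⟨ dot-+ (c ∘ suc) (λ i → + i * c (suc i)) p ⟨
  dot (λ i → c (suc i) + + i * c (suc i)) p                            ≡⟨ dot-cong p (λ i → eq (+ i) (c (suc i))) ⟩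
  dot (λ i → + suc i * c (suc i)) p                                    ≡⟨ ℤₚ.+-identityˡ _ ⟨
  0ℤ + dot (λ i → + suc i * c (suc i)) p                               ≡⟨ cong (_+ dot (λ i → + suc i * c (suc i)) p) (ℤₚ.*-zeroʳ a) ⟨
  a * (0ℤ * c 0) + dot (λ i → + suc i * c (suc i)) p                   ∎
  where
  open ≡-Reasoning
  eq : ∀ i x → x + i * x ≡ (1ℤ + i) * x
  eq = solve-∀

eval-θ-⊛ : ∀ X p q → eval X (θ (p ⊛ q)) ≡ eval X (θ p) * eval X q + eval X p * eval X (θ q)
eval-θ-⊛ X p q = begin
  eval X (θ (p ⊛ q))
    ≡⟨ dot-θ (X ^_) (p ⊛ q) ⟩
  dot (λ k → + k * X ^ k) (p ⊛ q)
    ≡⟨ dot-⊛ (λ k → + k * X ^ k) p q ⟩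
  dot (λ i → dot (λ j → + (i ℕ.+ j) * X ^ (i ℕ.+ j)) q) p
    ≡⟨ dot-cong p (λ i → trans (dot-cong q (leibniz i)) (trans (dot-+ (λ j → (+ i * X ^ i) * X ^ j) (λ j → X ^ i * (+ j * X ^ j)) q)
        (trans (cong₂ _+_ (dot-* (+ i * X ^ i) (X ^_) q) (dot-* (X ^ i) (λ j → + j * X ^ j) q)) (eq₁ (+ i * X ^ i) (eval X q) (X ^ i) Dq)))) ⟩
  dot (λ i → eval X q * (+ i * X ^ i) + Dq * X ^ i) p
    ≡⟨ dot-+ (λ i → eval X q * (+ i * X ^ i)) (λ i → Dq * X ^ i) p ⟩
  dot (λ i → eval X q * (+ i * X ^ i)) p + dot (λ i → Dq * X ^ i) p
    ≡⟨ cong₂ _+_ (dot-* (eval X q) (λ i → + i * X ^ i) p) (dot-* Dq (X ^_) p) ⟩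
  eval X q * dot (λ i → + i * X ^ i) p + Dq * eval X p
    ≡⟨ cong₂ (λ u v → eval X q * u + v * eval X p) (sym (dot-θ (X ^_) p)) (sym (dot-θ (X ^_) q)) ⟩
  eval X q * eval X (θ p) + eval X (θ q) * eval X p
    ≡⟨ cong₂ _+_ (ℤₚ.*-comm (eval X q) (eval X (θ p))) (ℤₚ.*-comm (eval X (θ q)) (eval X p)) ⟩
  eval X (θ p) * eval X q + eval X p * eval X (θ q) ∎
  where
  open ≡-Reasoning
  Dq = dot (λ j → + j * X ^ j) q
  eq₁ : ∀ a b c d → a * b + c * d ≡ b * a + d * c
  eq₁ = solve-∀
  eq₂ : ∀ i j x y → (i + j) * (x * y) ≡ (i * x) * y + x * (j * y)
  eq₂ = solve-∀
  leibniz : ∀ i j → + (i ℕ.+ j) * X ^ (i ℕ.+ j) ≡ (+ i * X ^ i) * X ^ j + X ^ i * (+ j * X ^ j)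
  leibniz i j = trans (cong₂ _*_ (ℤₚ.pos-+ i j) (ℤₚ.^-distribˡ-+-* X i j)) (eq₂ (+ i) (+ j) (X ^ i) (X ^ j))

eval-θ-⊛^ : ∀ X p a → eval X (θ (p ⊛^ suc a)) ≡ + suc a * (eval X p ^ a * eval X (θ p))
eval-θ-⊛^ X p zero    = trans (eval-θ-⊛ X p (1ℤ ∷ [])) (eq (eval X (θ p)) (eval X p))
  where
  eq : ∀ t e → t * (1ℤ * 1ℤ + 0ℤ) + e * 0ℤ ≡ 1ℤ * (1ℤ * t)
  eq = solve-∀
eval-θ-⊛^ X p (suc a) = trans (eval-θ-⊛ X p (p ⊛^ suc a))
  (trans (cong₂ (λ u v → eval X (θ p) * u + eval X p * v) (eval-⊛^ X p (suc a)) (eval-θ-⊛^ X p a))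
    (eq (+ suc a) (eval X (θ p)) (eval X p) (eval X p ^ a)))
  where
  eq : ∀ a t e ea → t * (e * ea) + e * (a * (ea * t)) ≡ (1ℤ + a) * (e * ea * t)
  eq = solve-∀

-- Neighbouring coefficients are in the ratio (r + M - i) : (M - i). In this signed form the
-- relation also holds at and beyond the boundary i = M, so it can be summed against any polynomial.
coeff-absorb : ∀ r M i → (+ i - + M) * + coeff r M i + (+ r + + M - + i) * + coeff r M (suc i) ≡ 0ℤ
coeff-absorb r zero    zero    = trans (ℤₚ.+-identityˡ ((+ r + 0ℤ - 0ℤ) * 0ℤ)) (ℤₚ.*-zeroʳ (+ r + 0ℤ - 0ℤ))
coeff-absorb r zero    (suc i) = cong₂ _+_ (ℤₚ.*-zeroʳ (+ suc i - 0ℤ)) (ℤₚ.*-zeroʳ (+ r + 0ℤ - + suc i))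
coeff-absorb r (suc M) (suc i) = trans (eq (+ i) (+ M) (+ r) (+ coeff r M i) (+ coeff r M (suc i))) (coeff-absorb r M i)
  where
  eq : ∀ i m r a b → ((1ℤ + i) - (1ℤ + m)) * a + (r + (1ℤ + m) - (1ℤ + i)) * b ≡ (i - m) * a + (r + m - i) * b
  eq = solve-∀
coeff-absorb r (suc M) zero    = trans (eq (+ suc M) (+ mc r (suc M)) (+ r) (+ mc r M))
  (ℤₚ.i≡j⇒i-j≡0 (trans (cong (_* + mc r M) (trans (sym (ℤₚ.pos-+ r (suc M))) (cong +_ (ℕₚ.+-suc r M))))
    (trans (sym (ℤₚ.pos-* (suc r ℕ.+ M) (mc r M))) (trans (cong +_ (sym (mc-sucʳ r M))) (ℤₚ.pos-* (suc M) (mc r (suc M)))))))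
  where
  eq : ∀ m a r b → (0ℤ - m) * a + (r + m - 0ℤ) * b ≡ (r + m) * b - m * a
  eq = solve-∀

-- d(E^{a+1} (y(1-y^c))^{-cM}) has no residue at y = 0.
extract-exact : ∀ c N l E J a M → l ℕ.* suc a ≡ N ℕ.* c ℕ.* suc M →
  (∀ X → eval X J ≡ + l * eval X E * (1ℤ - + suc c * X) - + (N ℕ.* c) * (1ℤ - X) * eval X (θ E)) →
  extract (c ℕ.* suc M) (suc M) ((E ⊛^ a) ⊛ J) ≡ 0ℤ
extract-exact c N l E J a M′ hl hJ = cancel-suc M′ (trans (trans (eq₀ (+ M) _) (cong -_ (trans (sym (dot-scale w (- + M) ((E ⊛^ a) ⊛ J)))
   (trans (sym (≈⇒dot w {scale (+ l) Q} {scale (- + M) ((E ⊛^ a) ⊛ J)} same)) (trans (dot-scale w (+ l) Q) (trans (cong (+ l *_) exact) (ℤₚ.*-zeroʳ (+ l)))))))) (sym (ℤₚ.*-zeroʳ (+ M))))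
  where
  M = suc M′
  r = c ℕ.* M
  w : ℕ → ℤ
  w i = + coeff r M i
  p = E ⊛^ suc a
  -- `Q` is v^M (1 - v)^(r+1) times the θ-derivative of p v^(-M) (1 - v)^(-r). Its extraction is
  -- therefore the constant coefficient of a θ-derivative, which is zero.
  Q = (θ p ⊕ scale (- + M) p) ⊕ (0ℤ ∷ (scale (+ (r ℕ.+ M)) p ⊕ scale -1ℤ (θ p)))
  eq₀ : ∀ m x → m * x ≡ - (- m * x)
  eq₀ = solve-∀
  dotQ : ∀ e → dot e Q ≡ (dot e (θ p) + - + M * dot e p) + (+ (r ℕ.+ M) * dot (e ∘ suc) p + -1ℤ * dot (e ∘ suc) (θ p))
  dotQ e = trans (dot-⊕ e (θ p ⊕ scale (- + M) p) _) (cong₂ _+_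
    (trans (dot-⊕ e (θ p) _) (cong (_+_ (dot e (θ p))) (dot-scale e (- + M) p)))
    (trans (ℤₚ.+-identityˡ _) (trans (dot-⊕ (e ∘ suc) (scale (+ (r ℕ.+ M)) p) _)
      (cong₂ _+_ (dot-scale (e ∘ suc) (+ (r ℕ.+ M)) p) (dot-scale (e ∘ suc) -1ℤ (θ p))))))
  exact : dot w Q ≡ 0ℤ
  exact = begin
    dot w Q ≡⟨ dotQ w ⟩
    (dot w (θ p) + - + M * dot w p) + (+ (r ℕ.+ M) * dot (w ∘ suc) p + -1ℤ * dot (w ∘ suc) (θ p))
      ≡⟨ cong₂ _+_ (cong₂ _+_ (dot-θ w p) (sym (dot-* (- + M) w p)))
          (cong₂ _+_ (sym (dot-* (+ (r ℕ.+ M)) (w ∘ suc) p)) (trans (cong (-1ℤ *_) (dot-θ (w ∘ suc) p)) (sym (dot-* -1ℤ (λ i → + i * w (suc i)) p)))) ⟩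
    (dot (λ i → + i * w i) p + dot (λ i → - + M * w i) p) + (dot (λ i → + (r ℕ.+ M) * w (suc i)) p + dot (λ i → -1ℤ * (+ i * w (suc i))) p)
      ≡⟨ cong₂ _+_ (dot-+ (λ i → + i * w i) (λ i → - + M * w i) p) (dot-+ (λ i → + (r ℕ.+ M) * w (suc i)) (λ i → -1ℤ * (+ i * w (suc i))) p) ⟨
    dot (λ i → + i * w i + - + M * w i) p + dot (λ i → + (r ℕ.+ M) * w (suc i) + -1ℤ * (+ i * w (suc i))) p
      ≡⟨ dot-+ (λ i → + i * w i + - + M * w i) (λ i → + (r ℕ.+ M) * w (suc i) + -1ℤ * (+ i * w (suc i))) p ⟨
    dot (λ i → (+ i * w i + - + M * w i) + (+ (r ℕ.+ M) * w (suc i) + -1ℤ * (+ i * w (suc i)))) p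
      ≡⟨ dot-cong p (λ i → trans (cong (λ u → (+ i * w i + - + M * w i) + (u * w (suc i) + -1ℤ * (+ i * w (suc i)))) (ℤₚ.pos-+ r M))
           (trans (eq₁ (+ i) (+ M) (+ r) (w i) (w (suc i))) (coeff-absorb r M i))) ⟩
    dot (λ _ → 0ℤ) p ≡⟨ dot-* 0ℤ (λ _ → 0ℤ) p ⟩
    0ℤ ∎
    where
    open ≡-Reasoning
    eq₁ : ∀ i m r a b → (i * a + - m * a) + ((r + m) * b + -1ℤ * (i * b)) ≡ (i - m) * a + (r + m - i) * b
    eq₁ = solve-∀
  -- By the degree condition l (a + 1) = N c M, the two terms of `l Q` have the common factor -M
  -- E^a, and the cofactor is `J`.
  same : scale (+ l) Q ≈ scale (- + M) ((E ⊛^ a) ⊛ J)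
  same X = begin
    eval X (scale (+ l) Q) ≡⟨ dot-scale (X ^_) (+ l) Q ⟩
    + l * eval X Q ≡⟨ cong (+ l *_) (dotQ (X ^_)) ⟩
    + l * ((eval X (θ p) + - + M * eval X p) + (+ (r ℕ.+ M) * dot (λ i → X * X ^ i) p + -1ℤ * dot (λ i → X * X ^ i) (θ p)))
      ≡⟨ cong (+ l *_) (cong₂ (λ u v → (eval X (θ p) + - + M * eval X p) + (u + -1ℤ * v))
           (cong₂ _*_ (trans (ℤₚ.pos-+ r M) (cong (_+ + M) (ℤₚ.pos-* c M))) (dot-* X (X ^_) p)) (dot-* X (X ^_) (θ p))) ⟩
    + l * ((eval X (θ p) + - + M * eval X p) + ((+ c * + M + + M) * (X * eval X p) + -1ℤ * (X * eval X (θ p))))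
      ≡⟨ cong₂ (λ u v → + l * ((u + - + M * v) + ((+ c * + M + + M) * (X * v) + -1ℤ * (X * u)))) (eval-θ-⊛^ X E a) (eval-⊛^ X E (suc a)) ⟩
    + l * ((+ suc a * (e ^ a * t) + - + M * (e * e ^ a)) + ((+ c * + M + + M) * (X * (e * e ^ a)) + -1ℤ * (X * (+ suc a * (e ^ a * t)))))
      ≡⟨ eq₂ (+ l) (+ suc a) (e ^ a) t (+ M) e (+ c) X ⟩
    (+ l * + suc a) * ((1ℤ - X) * (e ^ a * t)) + - + M * (e ^ a * (+ l * e * (1ℤ - (1ℤ + + c) * X)))
      ≡⟨ cong (λ u → u * ((1ℤ - X) * (e ^ a * t)) + - + M * (e ^ a * (+ l * e * (1ℤ - (1ℤ + + c) * X))))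
           (trans (sym (ℤₚ.pos-* l (suc a))) (trans (cong +_ hl) (ℤₚ.pos-* (N ℕ.* c) M))) ⟩
    (+ (N ℕ.* c) * + M) * ((1ℤ - X) * (e ^ a * t)) + - + M * (e ^ a * (+ l * e * (1ℤ - (1ℤ + + c) * X)))
      ≡⟨ eq₃ (+ (N ℕ.* c)) (+ M) (1ℤ - X) (e ^ a) t (+ l * e * (1ℤ - + suc c * X)) ⟩
    - + M * (e ^ a * (+ l * e * (1ℤ - + suc c * X) - + (N ℕ.* c) * (1ℤ - X) * t))
      ≡⟨ cong₂ (λ u v → - + M * (u * v)) (eval-⊛^ X E a) (hJ X) ⟨
    - + M * (eval X (E ⊛^ a) * eval X J)
      ≡⟨ cong (- + M *_) (eval-⊛ X (E ⊛^ a) J) ⟨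
    - + M * eval X ((E ⊛^ a) ⊛ J)
      ≡⟨ dot-scale (X ^_) (- + M) ((E ⊛^ a) ⊛ J) ⟨
    eval X (scale (- + M) ((E ⊛^ a) ⊛ J)) ∎
    where
    open ≡-Reasoning
    e = eval X E
    t = eval X (θ E)
    eq₂ : ∀ l s ea t m e c X →
      l * ((s * (ea * t) + - m * (e * ea)) + ((c * m + m) * (X * (e * ea)) + -1ℤ * (X * (s * (ea * t)))))
      ≡ (l * s) * ((1ℤ - X) * (ea * t)) + - m * (ea * (l * e * (1ℤ - (1ℤ + c) * X)))
    eq₂ = solve-∀
    eq₃ : ∀ n m x ea t u → (n * m) * (x * (ea * t)) + - m * (ea * u) ≡ - m * (ea * (u - n * x * t))
    eq₃ = solve-∀

-- Asymptotic positivity of coefficient extraction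

mc-mono : ∀ r M → mc r M ℕ.≤ mc r (suc M)
mc-mono zero    zero    = s≤s z≤n
mc-mono zero    (suc M) = s≤s z≤n
mc-mono (suc r) M       = ℕₚ.m≤n+m (mc (suc r) M) (mc r (suc M))

coeff-antitone : ∀ r M i → coeff r M (suc i) ℕ.≤ coeff r M i
coeff-antitone r zero    i       = z≤n
coeff-antitone r (suc M) zero    = mc-mono r M
coeff-antitone r (suc M) (suc i) = coeff-antitone r M i

coeff≤mc : ∀ r M i → coeff r M i ℕ.≤ mc r M
coeff≤mc r M zero    = ℕₚ.≤-refl
coeff≤mc r M (suc i) = ℕₚ.≤-trans (coeff-antitone r M i) (coeff≤mc r M i)

coeff-absorb-ℕ : ∀ r M i → M ℕ.* coeff r M i ℕ.+ i ℕ.* coeff r M (suc i) ≡ (r ℕ.+ M) ℕ.* coeff r M (suc i) ℕ.+ i ℕ.* coeff r M i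
coeff-absorb-ℕ r M i = ℤₚ.+-injective (begin
  + (M ℕ.* a ℕ.+ i ℕ.* b)               ≡⟨ trans (ℤₚ.pos-+ (M ℕ.* a) (i ℕ.* b)) (cong₂ _+_ (ℤₚ.pos-* M a) (ℤₚ.pos-* i b)) ⟩
  + M * + a + + i * + b                 ≡⟨ eq (+ i) (+ M) (+ r) (+ a) (+ b) ⟩
  (+ r + + M) * + b + + i * + a - ((+ i - + M) * + a + (+ r + + M - + i) * + b)
    ≡⟨ cong (λ u → (+ r + + M) * + b + + i * + a - u) (coeff-absorb r M i) ⟩
  (+ r + + M) * + b + + i * + a - 0ℤ    ≡⟨ ℤₚ.+-identityʳ ((+ r + + M) * + b + + i * + a) ⟩
  (+ r + + M) * + b + + i * + a
    ≡⟨ trans (ℤₚ.pos-+ ((r ℕ.+ M) ℕ.* b) (i ℕ.* a)) (cong₂ _+_ (ℤₚ.pos-* (r ℕ.+ M) b) (ℤₚ.pos-* i a)) ⟨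
  + ((r ℕ.+ M) ℕ.* b ℕ.+ i ℕ.* a) ∎)
  where
  open ≡-Reasoning
  a = coeff r M i
  b = coeff r M (suc i)
  eq : ∀ i m r a b → m * a + i * b ≡ (r + m) * b + i * a - ((i - m) * a + (r + m - i) * b)
  eq = solve-∀

coeff-lower : ∀ r M i → M ℕ.* coeff r M i ℕ.≤ (r ℕ.+ M) ℕ.* coeff r M (suc i) ℕ.+ i ℕ.* coeff r M i
coeff-lower r M i = ℕₚ.≤-trans (ℕₚ.m≤m+n _ _) (ℕₚ.≤-reflexive (coeff-absorb-ℕ r M i))

coeff-upper : ∀ r M i → (r ℕ.+ M) ℕ.* coeff r M (suc i) ℕ.≤ M ℕ.* coeff r M i
coeff-upper r M i = ℕₚ.+-cancelʳ-≤ (i ℕ.* coeff r M (suc i)) _ _ (begin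
  (r ℕ.+ M) ℕ.* coeff r M (suc i) ℕ.+ i ℕ.* coeff r M (suc i) ≤⟨ ℕₚ.+-monoʳ-≤ _ (ℕₚ.*-monoʳ-≤ i (coeff-antitone r M i)) ⟩
  (r ℕ.+ M) ℕ.* coeff r M (suc i) ℕ.+ i ℕ.* coeff r M i       ≡⟨ coeff-absorb-ℕ r M i ⟨
  M ℕ.* coeff r M i ℕ.+ i ℕ.* coeff r M (suc i)               ∎)
  where open ℕₚ.≤-Reasoning

pow-upper : ∀ r M i → (r ℕ.+ M) ℕ.^ i ℕ.* coeff r M i ℕ.≤ M ℕ.^ i ℕ.* mc r M
pow-upper r M zero    = ℕₚ.≤-refl
pow-upper r M (suc i) = begin
  T ℕ.* T ℕ.^ i ℕ.* coeff r M (suc i)     ≡⟨ eq₁ T (T ℕ.^ i) (coeff r M (suc i)) ⟩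
  T ℕ.^ i ℕ.* (T ℕ.* coeff r M (suc i))   ≤⟨ ℕₚ.*-monoʳ-≤ (T ℕ.^ i) (coeff-upper r M i) ⟩
  T ℕ.^ i ℕ.* (M ℕ.* coeff r M i)         ≡⟨ eq₂ (T ℕ.^ i) M (coeff r M i) ⟩
  M ℕ.* (T ℕ.^ i ℕ.* coeff r M i)         ≤⟨ ℕₚ.*-monoʳ-≤ M (pow-upper r M i) ⟩
  M ℕ.* (M ℕ.^ i ℕ.* mc r M)              ≡⟨ ℕₚ.*-assoc M (M ℕ.^ i) (mc r M) ⟨
  M ℕ.* M ℕ.^ i ℕ.* mc r M                ∎
  where
  open ℕₚ.≤-Reasoning
  T = r ℕ.+ M
  eq₁ : ∀ t p c → t ℕ.* p ℕ.* c ≡ p ℕ.* (t ℕ.* c)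
  eq₁ = ℕSolver.solve-∀
  eq₂ : ∀ p m c → p ℕ.* (m ℕ.* c) ≡ m ℕ.* (p ℕ.* c)
  eq₂ = ℕSolver.solve-∀

-- i (i - 1) / 2, the accumulated error of the steps 0, ..., i - 1 in `pow-lower`.
tri : ℕ → ℕ
tri zero    = 0
tri (suc i) = tri i ℕ.+ i

-- With T = r + M, passing from `i` to `suc i` multiplies the coefficient by M / T up to an error of
-- i / T relative to `mc r M`, and these errors add up to `tri i` / T. Together with `pow-upper`
-- this is the saddle point estimate.
pow-lower : ∀ r M i → (r ℕ.+ M) ℕ.* (M ℕ.^ i ℕ.* mc r M) ℕ.≤
  (r ℕ.+ M) ℕ.* ((r ℕ.+ M) ℕ.^ i ℕ.* coeff r M i) ℕ.+ tri i ℕ.* ((r ℕ.+ M) ℕ.^ i ℕ.* mc r M)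
pow-lower r M zero    = ℕₚ.m≤m+n _ _
pow-lower r M (suc i) = begin
  T ℕ.* (M ℕ.* M ℕ.^ i ℕ.* C)                         ≡⟨ eq₁ T M (M ℕ.^ i) C ⟩
  M ℕ.* (T ℕ.* (M ℕ.^ i ℕ.* C))                       ≤⟨ ℕₚ.*-monoʳ-≤ M (pow-lower r M i) ⟩
  M ℕ.* (T ℕ.* (P ℕ.* c₀) ℕ.+ t ℕ.* (P ℕ.* C))        ≡⟨ eq₂ M T P c₀ t C ⟩
  T ℕ.* P ℕ.* (M ℕ.* c₀) ℕ.+ M ℕ.* (t ℕ.* (P ℕ.* C))  ≤⟨ ℕₚ.+-mono-≤ (ℕₚ.*-monoʳ-≤ (T ℕ.* P) step) (ℕₚ.*-monoˡ-≤ (t ℕ.* (P ℕ.* C)) (ℕₚ.m≤n+m M r)) ⟩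
  T ℕ.* P ℕ.* (T ℕ.* c₁ ℕ.+ i ℕ.* C) ℕ.+ T ℕ.* (t ℕ.* (P ℕ.* C)) ≡⟨ eq₃ T P c₁ i C t ⟩
  T ℕ.* (T ℕ.* P ℕ.* c₁) ℕ.+ (t ℕ.+ i) ℕ.* (T ℕ.* P ℕ.* C) ∎
  where
  open ℕₚ.≤-Reasoning
  T = r ℕ.+ M
  P = T ℕ.^ i
  C = mc r M
  c₀ = coeff r M i
  c₁ = coeff r M (suc i)
  t = tri i
  step : M ℕ.* c₀ ℕ.≤ T ℕ.* c₁ ℕ.+ i ℕ.* C
  step = ℕₚ.≤-trans (coeff-lower r M i) (ℕₚ.+-monoʳ-≤ (T ℕ.* c₁) (ℕₚ.*-monoʳ-≤ i (coeff≤mc r M i)))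
  eq₁ : ∀ t m p c → t ℕ.* (m ℕ.* p ℕ.* c) ≡ m ℕ.* (t ℕ.* (p ℕ.* c))
  eq₁ = ℕSolver.solve-∀
  eq₂ : ∀ m t p c u d → m ℕ.* (t ℕ.* (p ℕ.* c) ℕ.+ u ℕ.* (p ℕ.* d)) ≡ t ℕ.* p ℕ.* (m ℕ.* c) ℕ.+ m ℕ.* (u ℕ.* (p ℕ.* d))
  eq₂ = ℕSolver.solve-∀
  eq₃ : ∀ t p c i d u → t ℕ.* p ℕ.* (t ℕ.* c ℕ.+ i ℕ.* d) ℕ.+ t ℕ.* (u ℕ.* (p ℕ.* d)) ≡ t ℕ.* (t ℕ.* p ℕ.* c) ℕ.+ (u ℕ.+ i) ℕ.* (t ℕ.* p ℕ.* d)
  eq₃ = ℕSolver.solve-∀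

absDot : (ℕ → ℕ) → Poly → ℕ
absDot t []      = 0
absDot t (a ∷ g) = ∣ a ∣ ℕ.* t 0 ℕ.+ absDot (t ∘ suc) g

-- A negative `a` reverses inequalities, hence the two-sided hypothesis.
*-close : ∀ a (c d e : ℤ) → c ℤ.≤ d + e → d ℤ.≤ c + e → a * c ℤ.≤ a * d + + ∣ a ∣ * e
*-close (+ n)    c d e h₁ h₂ = ℤₚ.≤-trans (ℤₚ.*-monoˡ-≤-nonNeg (+ n) h₁) (ℤₚ.≤-reflexive (ℤₚ.*-distribˡ-+ (+ n) d e))
*-close -[1+ n ] c d e h₁ h₂ = ℤₚ.≤-trans (ℤₚ.≤-reflexive (eq₁ (+ suc n) c e))
  (ℤₚ.≤-trans (ℤₚ.+-monoˡ-≤ (+ suc n * e) (ℤₚ.*-monoˡ-≤-nonPos -[1+ n ] h₂)) ℤₚ.≤-refl)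
  where
  eq₁ : ∀ n c e → - n * c ≡ - n * (c + e) + n * e
  eq₁ = solve-∀

dot-close : ∀ c d t (z : ℕ) g → (∀ i → i ℕ.< length g → c i ℤ.≤ d i + + (t i ℕ.* z) × d i ℤ.≤ c i + + (t i ℕ.* z)) →
  dot c g ℤ.≤ dot d g + + (absDot t g ℕ.* z)
dot-close c d t z []      h = ℤₚ.≤-refl
dot-close c d t z (a ∷ g) h = begin
  a * c 0 + dot (c ∘ suc) g
    ≤⟨ ℤₚ.+-mono-≤ (*-close a (c 0) (d 0) (+ (t 0 ℕ.* z)) (proj₁ (h 0 (s≤s z≤n))) (proj₂ (h 0 (s≤s z≤n))))
         (dot-close (c ∘ suc) (d ∘ suc) (t ∘ suc) z g (λ i i< → h (suc i) (s≤s i<))) ⟩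
  (a * d 0 + + ∣ a ∣ * + (t 0 ℕ.* z)) + (dot (d ∘ suc) g + + (A ℕ.* z))
    ≡⟨ cong₂ (λ u v → (a * d 0 + u) + (dot (d ∘ suc) g + v)) (trans (sym (ℤₚ.pos-* ∣ a ∣ (t 0 ℕ.* z))) (cong +_ (sym (ℕₚ.*-assoc ∣ a ∣ (t 0) z)))) refl ⟩
  (a * d 0 + + (∣ a ∣ ℕ.* t 0 ℕ.* z)) + (dot (d ∘ suc) g + + (A ℕ.* z))
    ≡⟨ eq (a * d 0) (+ (∣ a ∣ ℕ.* t 0 ℕ.* z)) (dot (d ∘ suc) g) (+ (A ℕ.* z)) ⟩
  (a * d 0 + dot (d ∘ suc) g) + (+ (∣ a ∣ ℕ.* t 0 ℕ.* z) + + (A ℕ.* z))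
    ≡⟨ cong (_+_ (a * d 0 + dot (d ∘ suc) g)) (trans (sym (ℤₚ.pos-+ (∣ a ∣ ℕ.* t 0 ℕ.* z) (A ℕ.* z))) (cong +_ (sym (ℕₚ.*-distribʳ-+ z (∣ a ∣ ℕ.* t 0) A)))) ⟩
  (a * d 0 + dot (d ∘ suc) g) + + ((∣ a ∣ ℕ.* t 0 ℕ.+ A) ℕ.* z) ∎
  where
  open ℤₚ.≤-Reasoning
  A = absDot (t ∘ suc) g
  eq : ∀ a b c d → (a + b) + (c + d) ≡ (a + c) + (b + d)
  eq = solve-∀

pos-^ : ∀ m k → + (m ℕ.^ k) ≡ (+ m) ^ k
pos-^ m zero    = refl
pos-^ m (suc k) = trans (ℤₚ.pos-* m (m ℕ.^ k)) (cong (+ m *_) (pos-^ m k))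

-- The M-th coefficient of g (1-v)^{-(r+1)} is C(T,M) T^{-e} (hom g(T,M) + O(T^{e-1})), where T = r + M.
extract-close : ∀ g e r M → length g ℕ.≤ suc e →
  + ((r ℕ.+ M) ℕ.* mc r M) * hom 1 e (+ (r ℕ.+ M)) (+ M) g ℤ.≤
  + ((r ℕ.+ M) ℕ.* (r ℕ.+ M) ℕ.^ e) * extract r M g + + (absDot tri g ℕ.* ((r ℕ.+ M) ℕ.^ e ℕ.* mc r M))
extract-close g e r M len = begin
  + (T ℕ.* C) * hom 1 e (+ T) (+ M) g
    ≡⟨ dot-* (+ (T ℕ.* C)) _ g ⟨
  dot (λ i → + (T ℕ.* C) * ((+ T) ^ (e ℕ.∸ 1 ℕ.* i) * (+ M) ^ (1 ℕ.* i))) g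
    ≡⟨ dot-cong g (λ i → nat i) ⟩
  dot (λ i → + (S i)) g
    ≤⟨ dot-close (λ i → + (S i)) (λ i → + (R i)) tri Z g (λ i i< → ℤ.+≤+ (close₁ i (ℕₚ.≤-pred (ℕₚ.≤-trans i< len))) , ℤ.+≤+ (close₂ i (ℕₚ.≤-pred (ℕₚ.≤-trans i< len)))) ⟩
  dot (λ i → + (R i)) g + + (absDot tri g ℕ.* Z)
    ≡⟨ cong (_+ + (absDot tri g ℕ.* Z)) (trans (dot-cong g (λ i → ℤₚ.pos-* (T ℕ.* T ℕ.^ e) (coeff r M i))) (dot-* (+ (T ℕ.* T ℕ.^ e)) (λ i → + coeff r M i) g)) ⟩
  + (T ℕ.* T ℕ.^ e) * extract r M g + + (absDot tri g ℕ.* Z) ∎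
  where
  open ℤₚ.≤-Reasoning
  T = r ℕ.+ M
  C = mc r M
  Z = T ℕ.^ e ℕ.* C
  S R : ℕ → ℕ
  S i = T ℕ.* C ℕ.* (T ℕ.^ (e ℕ.∸ i) ℕ.* M ℕ.^ i)
  R i = T ℕ.* T ℕ.^ e ℕ.* coeff r M i
  nat : ∀ i → + (T ℕ.* C) * ((+ T) ^ (e ℕ.∸ 1 ℕ.* i) * (+ M) ^ (1 ℕ.* i)) ≡ + (S i)
  nat i rewrite ℕₚ.*-identityˡ i = sym (trans (ℤₚ.pos-* (T ℕ.* C) (T ℕ.^ (e ℕ.∸ i) ℕ.* M ℕ.^ i))
    (cong (+ (T ℕ.* C) *_) (trans (ℤₚ.pos-* (T ℕ.^ (e ℕ.∸ i)) (M ℕ.^ i)) (cong₂ _*_ (pos-^ T (e ℕ.∸ i)) (pos-^ M i)))))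
  split : ∀ i → i ℕ.≤ e → T ℕ.^ e ≡ T ℕ.^ (e ℕ.∸ i) ℕ.* T ℕ.^ i
  split i i≤e = trans (cong (T ℕ.^_) (sym (ℕₚ.m∸n+n≡m i≤e))) (ℕₚ.^-distribˡ-+-* T (e ℕ.∸ i) i)
  eq₁ : ∀ t c p m → t ℕ.* c ℕ.* (p ℕ.* m) ≡ p ℕ.* (t ℕ.* (m ℕ.* c))
  eq₁ = ℕSolver.solve-∀
  eq₂ : ∀ t p q w u c → p ℕ.* (t ℕ.* (q ℕ.* w) ℕ.+ u ℕ.* (q ℕ.* c)) ≡ t ℕ.* (p ℕ.* q) ℕ.* w ℕ.+ u ℕ.* (p ℕ.* q ℕ.* c)
  eq₂ = ℕSolver.solve-∀
  eq₃ : ∀ t p q w → t ℕ.* (p ℕ.* q) ℕ.* w ≡ p ℕ.* (t ℕ.* (q ℕ.* w))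
  eq₃ = ℕSolver.solve-∀
  close₁ : ∀ i → i ℕ.≤ e → S i ℕ.≤ R i ℕ.+ tri i ℕ.* Z
  close₁ i i≤e = ℕₚ.≤-trans (ℕₚ.≤-reflexive (eq₁ T C (T ℕ.^ (e ℕ.∸ i)) (M ℕ.^ i)))
    (ℕₚ.≤-trans (ℕₚ.*-monoʳ-≤ (T ℕ.^ (e ℕ.∸ i)) (pow-lower r M i))
    (ℕₚ.≤-reflexive (trans (eq₂ T (T ℕ.^ (e ℕ.∸ i)) (T ℕ.^ i) (coeff r M i) (tri i) C)
      (cong (λ u → T ℕ.* u ℕ.* coeff r M i ℕ.+ tri i ℕ.* (u ℕ.* C)) (sym (split i i≤e))))))
  close₂ : ∀ i → i ℕ.≤ e → R i ℕ.≤ S i ℕ.+ tri i ℕ.* Z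
  close₂ i i≤e = ℕₚ.≤-trans (ℕₚ.≤-reflexive (trans (cong (λ u → T ℕ.* u ℕ.* coeff r M i) (split i i≤e)) (eq₃ T (T ℕ.^ (e ℕ.∸ i)) (T ℕ.^ i) (coeff r M i))))
    (ℕₚ.≤-trans (ℕₚ.*-monoʳ-≤ (T ℕ.^ (e ℕ.∸ i)) (ℕₚ.*-monoʳ-≤ T (pow-upper r M i)))
    (ℕₚ.≤-trans (ℕₚ.≤-reflexive (sym (eq₁ T C (T ℕ.^ (e ℕ.∸ i)) (M ℕ.^ i)))) (ℕₚ.m≤m+n _ _)))

-- The hypothesis `lower` says that g(M/T) is at least 1/D, where T = r + M. If the extracted
-- coefficient were not positive, `extract-close` would bound this main term by the error
-- `absDot tri g` / T, which is smaller than 1/D once T is large.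
extract-pos : ∀ g e r M D → length g ℕ.≤ suc e →
  + ((r ℕ.+ M) ℕ.^ e) ℤ.≤ + D * hom 1 e (+ (r ℕ.+ M)) (+ M) g →
  D ℕ.* absDot tri g ℕ.< r ℕ.+ M → 0ℤ ℤ.< extract r M g
extract-pos g e r M D len lower large with 0ℤ ℤₚ.<? extract r M g
... | yes pos = pos
... | no  neg = ⊥-elim (ℕₚ.<⇒≱ big (ℤₚ.drop‿+≤+ small))
  where
  T = r ℕ.+ M
  C = mc r M
  A = absDot tri g
  Z = T ℕ.^ e ℕ.* C
  T>0 : 0 ℕ.< T
  T>0 = ℕₚ.≤-trans (s≤s z≤n) large
  Z>0 : 0 ℕ.< Z
  Z>0 = ℕₚ.*-mono-< (ℕₚ.m^n>0 T {{ℕ.>-nonZero T>0}} e) (mc-pos r M)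
  big : D ℕ.* A ℕ.* Z ℕ.< T ℕ.* Z
  big = ℕₚ.*-monoˡ-< Z {{ℕ.>-nonZero Z>0}} large
  eq₁ : ∀ d tc h → tc * (d * h) ≡ d * (tc * h)
  eq₁ = solve-∀
  eq₂ : ∀ t p c → t ℕ.* (p ℕ.* c) ≡ t ℕ.* c ℕ.* p
  eq₂ = ℕSolver.solve-∀
  small : + (T ℕ.* Z) ℤ.≤ + (D ℕ.* A ℕ.* Z)
  small = begin
    + (T ℕ.* Z)                                  ≡⟨ cong +_ (eq₂ T (T ℕ.^ e) C) ⟩
    + (T ℕ.* C ℕ.* T ℕ.^ e)                      ≡⟨ ℤₚ.pos-* (T ℕ.* C) (T ℕ.^ e) ⟩
    + (T ℕ.* C) * + (T ℕ.^ e)                    ≤⟨ ℤₚ.*-monoˡ-≤-nonNeg (+ (T ℕ.* C)) lower ⟩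
    + (T ℕ.* C) * (+ D * hom 1 e (+ T) (+ M) g)  ≡⟨ eq₁ (+ D) (+ (T ℕ.* C)) (hom 1 e (+ T) (+ M) g) ⟩
    + D * (+ (T ℕ.* C) * hom 1 e (+ T) (+ M) g)  ≤⟨ ℤₚ.*-monoˡ-≤-nonNeg (+ D) (extract-close g e r M len) ⟩
    + D * (+ (T ℕ.* T ℕ.^ e) * extract r M g + + (A ℕ.* Z))
      ≤⟨ ℤₚ.*-monoˡ-≤-nonNeg (+ D) (ℤₚ.+-monoˡ-≤ (+ (A ℕ.* Z)) (ℤₚ.≤-trans (ℤₚ.*-monoˡ-≤-nonNeg (+ (T ℕ.* T ℕ.^ e)) (ℤₚ.≮⇒≥ neg)) (ℤₚ.≤-reflexive (ℤₚ.*-zeroʳ (+ (T ℕ.* T ℕ.^ e)))))) ⟩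
    + D * (0ℤ + + (A ℕ.* Z))                     ≡⟨ ℤₚ.pos-* D (A ℕ.* Z) ⟨
    + (D ℕ.* (A ℕ.* Z))                          ≡⟨ cong +_ (ℕₚ.*-assoc D A Z) ⟨
    + (D ℕ.* A ℕ.* Z)                            ∎
    where open ℤₚ.≤-Reasoning

-- Invariants and the vanishing functional

*-self-injective : ∀ {s t} → s ℕ.* s ≡ t ℕ.* t → s ≡ t
*-self-injective {s} {t} e with ℕₚ.<-cmp s t
... | tri< s<t _ _ = ⊥-elim (ℕₚ.<-irrefl e (ℕₚ.*-mono-< s<t s<t))
... | tri≈ _ s≡t _ = s≡t
... | tri> _ _ t<s = ⊥-elim (ℕₚ.<-irrefl (sym e) (ℕₚ.*-mono-< t<s t<s))

^-distrib-* : ∀ x y k → (x * y) ^ k ≡ x ^ k * y ^ k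
^-distrib-* x y zero    = refl
^-distrib-* x y (suc k) = trans (cong (x * y *_) (^-distrib-* x y k)) (eq x y (x ^ k) (y ^ k))
  where
  eq : ∀ x y p q → x * y * (p * q) ≡ x * p * (y * q)
  eq = solve-∀

σ₁ σ₂ : ℕ → ℤ → ℤ → ℤ
σ₁ q x y = x + + (q ℕ.∸ 1) * y
σ₂ q x y = x - y

-- P(x,y) = y (x^{N-1} - x^{N-1-c} y^c) with N = suc N′ and E(x,y) are eigenvectors of σ
-- generating the invariants; J is the Jacobian of E and P in the variable v = (y/x)^c.
record Invariants (q c : ℕ) : Set where
  field
    N′ l b dE μ ν : ℕ
    E′ J    : Poly
    c≤N′    : c ℕ.≤ N′
    len-E   : length E′ ℕ.≤ dE
    c*dE≤l  : c ℕ.* dE ℕ.≤ l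
    l>0     : 0 ℕ.< l
    b>0     : 0 ℕ.< b
    -- E^b and P^c have the same degree in x and y, so that t = P^c / E^b is a rational function of
    -- v alone.
    l*b     : l ℕ.* b ≡ suc N′ ℕ.* c
    μ²      : μ ℕ.* μ ≡ q ℕ.^ l
    ν²      : ν ℕ.* ν ≡ q ℕ.^ suc N′
    P-inv   : ∀ x y → σ₂ q x y * hom c N′ (σ₁ q x y) (σ₂ q x y) 1-v ≡ + ν * (y * hom c N′ x y 1-v)
    E-inv   : ∀ x y → hom c l (σ₁ q x y) (σ₂ q x y) (1ℤ ∷ E′) ≡ + μ * hom c l x y (1ℤ ∷ E′)
    J-def   : ∀ X → eval X J ≡ + l * eval X (1ℤ ∷ E′) * (1ℤ - + suc c * X) - + (suc N′ ℕ.* c) * (1ℤ - X) * eval X (θ (1ℤ ∷ E′))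
    -- Whether P also vanishes at infinity. If it does, its degree is c + 2 instead of c + 1, and
    -- the conditions on q, c and l make the enumerators symmetric under exchange of x and y.
    infinity : N′ ≡ c ⊎ (q ≡ 2 × N′ ≡ suc c × ∃ (λ h → c ≡ 2 ℕ.* h) × ∃ (λ h → l ≡ c ℕ.* h))

  E : Poly
  E = 1ℤ ∷ E′

  -- E^s J (A E^b + B v(1-v)^c): against it, coefficient extraction annihilates every invariant enumerator.
  kernel : ℕ → ℤ → ℤ → Poly
  kernel s A B = ((E ⊛^ s) ⊛ J) ⊛ (scale A (E ⊛^ b) ⊕ scale B (0ℤ ∷ (1-v ⊛^ c)))

module Vanishing {q c : ℕ} .{{c≢0 : ℕ.NonZero c}} (inv : Invariants q c) where
  open Invariants inv

  module _ (n′ s : ℕ) (s>0 : 0 ℕ.< s) (s² : s ℕ.* s ≡ q ℕ.^ (l ℕ.* n′)) where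
    n = l ℕ.* n′
    D = n DivMod./ c

    weight : ℤ → ℤ → ℕ → ℤ
    weight x y j = x ^ (n ℕ.∸ c ℕ.* j) * y ^ (c ℕ.* j)

    -- v^i times `basis i` is P^(ci) E^(n′ - bi) at x = 1. The factor y^(ci) of P^(ci) is kept apart
    -- as v^i, which leaves constant term 1.
    basis : ℕ → Poly
    basis i = (1-v ⊛^ (c ℕ.* i)) ⊛ (E ⊛^ (n′ ℕ.∸ b ℕ.* i))

    weight-shift : ∀ x y i p → dot (λ j → weight x y (i ℕ.+ j)) p ≡ y ^ (c ℕ.* i) * hom c (n ℕ.∸ c ℕ.* i) x y p
    weight-shift x y i p = trans (dot-cong p pointwise) (dot-* (y ^ (c ℕ.* i)) (λ j → x ^ (n ℕ.∸ c ℕ.* i ℕ.∸ c ℕ.* j) * y ^ (c ℕ.* j)) p)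
      where
      eq : ∀ a b c → a * (b * c) ≡ b * (a * c)
      eq = solve-∀
      pointwise : ∀ j → weight x y (i ℕ.+ j) ≡ y ^ (c ℕ.* i) * (x ^ (n ℕ.∸ c ℕ.* i ℕ.∸ c ℕ.* j) * y ^ (c ℕ.* j))
      pointwise j rewrite ℕₚ.*-distribˡ-+ c i j | ℕₚ.∸-+-assoc n (c ℕ.* i) (c ℕ.* j) | ℤₚ.^-distribˡ-+-* y (c ℕ.* i) (c ℕ.* j)
        = eq (x ^ (n ℕ.∸ (c ℕ.* i ℕ.+ c ℕ.* j))) (y ^ (c ℕ.* i)) (y ^ (c ℕ.* j))

    module _ (i : ℕ) (bi≤n′ : b ℕ.* i ℕ.≤ n′) where
      e = n′ ℕ.∸ b ℕ.* i

      n-split : n ≡ c ℕ.* i ℕ.+ (c ℕ.* i ℕ.* N′ ℕ.+ e ℕ.* l)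
      n-split = begin
        l ℕ.* n′                                       ≡⟨ cong (l ℕ.*_) (ℕₚ.m+[n∸m]≡n bi≤n′) ⟨
        l ℕ.* (b ℕ.* i ℕ.+ e)                          ≡⟨ eq₁ l b i e ⟩
        (l ℕ.* b) ℕ.* i ℕ.+ e ℕ.* l                    ≡⟨ cong (λ u → u ℕ.* i ℕ.+ e ℕ.* l) l*b ⟩
        (suc N′ ℕ.* c) ℕ.* i ℕ.+ e ℕ.* l               ≡⟨ eq₂ N′ c i (e ℕ.* l) ⟩
        c ℕ.* i ℕ.+ (c ℕ.* i ℕ.* N′ ℕ.+ e ℕ.* l)       ∎
        where
        open ≡-Reasoning
        eq₁ : ∀ l b i e → l ℕ.* (b ℕ.* i ℕ.+ e) ≡ (l ℕ.* b) ℕ.* i ℕ.+ e ℕ.* l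
        eq₁ = ℕSolver.solve-∀
        eq₂ : ∀ N c i u → (suc N ℕ.* c) ℕ.* i ℕ.+ u ≡ c ℕ.* i ℕ.+ (c ℕ.* i ℕ.* N ℕ.+ u)
        eq₂ = ℕSolver.solve-∀

      len-1-v : length 1-v ℕ.≤ 2
      len-1-v = ℕₚ.≤-refl

      c*1≤N′ : c ℕ.* 1 ℕ.≤ N′
      c*1≤N′ = ℕₚ.≤-trans (ℕₚ.≤-reflexive (ℕₚ.*-identityʳ c)) c≤N′

      basis-value : ∀ x y → dot (λ j → weight x y (i ℕ.+ j)) (basis i) ≡ (y * hom c N′ x y 1-v) ^ (c ℕ.* i) * hom c l x y E ^ e
      basis-value x y = begin
        dot (λ j → weight x y (i ℕ.+ j)) (basis i)
          ≡⟨ weight-shift x y i (basis i) ⟩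
        y ^ (c ℕ.* i) * hom c (n ℕ.∸ c ℕ.* i) x y (basis i)
          ≡⟨ cong (λ m → y ^ (c ℕ.* i) * hom c m x y (basis i)) (trans (cong (ℕ._∸ c ℕ.* i) n-split) (ℕₚ.m+n∸m≡n (c ℕ.* i) _)) ⟩
        y ^ (c ℕ.* i) * hom c (c ℕ.* i ℕ.* N′ ℕ.+ e ℕ.* l) x y (basis i)
          ≡⟨ cong (y ^ (c ℕ.* i) *_) (trans (hom-⊛ c x y {1-v ⊛^ (c ℕ.* i)} {E ⊛^ e} (fits-⊛^ c 1-v (c ℕ.* i) len-1-v c*1≤N′) (fits-⊛^ c E e (s≤s len-E) c*dE≤l))
               (cong₂ _*_ (hom-⊛^ c x y 1-v (c ℕ.* i) len-1-v c*1≤N′) (hom-⊛^ c x y E e (s≤s len-E) c*dE≤l))) ⟩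
        y ^ (c ℕ.* i) * (hom c N′ x y 1-v ^ (c ℕ.* i) * hom c l x y E ^ e)
          ≡⟨ ℤₚ.*-assoc (y ^ (c ℕ.* i)) (hom c N′ x y 1-v ^ (c ℕ.* i)) (hom c l x y E ^ e) ⟨
        y ^ (c ℕ.* i) * hom c N′ x y 1-v ^ (c ℕ.* i) * hom c l x y E ^ e
          ≡⟨ cong (_* hom c l x y E ^ e) (^-distrib-* y (hom c N′ x y 1-v) (c ℕ.* i)) ⟨
        (y * hom c N′ x y 1-v) ^ (c ℕ.* i) * hom c l x y E ^ e ∎
        where open ≡-Reasoning

      -- The eigenvalue of a basis element agrees with the size of the code because both are natural
      -- numbers with square q^n.
      s-split : s ≡ ν ℕ.^ (c ℕ.* i) ℕ.* μ ℕ.^ e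
      s-split = *-self-injective (begin
        s ℕ.* s                                                    ≡⟨ s² ⟩
        q ℕ.^ n                                                    ≡⟨ cong (q ℕ.^_) (trans n-split (eq₁ c i N′ (e ℕ.* l))) ⟩
        q ℕ.^ (suc N′ ℕ.* (c ℕ.* i) ℕ.+ e ℕ.* l)                   ≡⟨ ℕₚ.^-distribˡ-+-* q (suc N′ ℕ.* (c ℕ.* i)) (e ℕ.* l) ⟩
        q ℕ.^ (suc N′ ℕ.* (c ℕ.* i)) ℕ.* q ℕ.^ (e ℕ.* l)           ≡⟨ cong₂ ℕ._*_ (ℕₚ.^-*-assoc q (suc N′) (c ℕ.* i)) (trans (ℕₚ.^-*-assoc q l e) (cong (q ℕ.^_) (ℕₚ.*-comm l e))) ⟨
        (q ℕ.^ suc N′) ℕ.^ (c ℕ.* i) ℕ.* (q ℕ.^ l) ℕ.^ e           ≡⟨ cong₂ (λ u v → u ℕ.^ (c ℕ.* i) ℕ.* v ℕ.^ e) ν² μ² ⟨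
        (ν ℕ.* ν) ℕ.^ (c ℕ.* i) ℕ.* (μ ℕ.* μ) ℕ.^ e                ≡⟨ cong₂ ℕ._*_ (sq ν (c ℕ.* i)) (sq μ e) ⟩
        (A ℕ.* A) ℕ.* (B ℕ.* B)                                    ≡⟨ eq₂ A B ⟩
        A ℕ.* B ℕ.* (A ℕ.* B)                                      ∎)
        where
        open ≡-Reasoning
        A = ν ℕ.^ (c ℕ.* i)
        B = μ ℕ.^ e
        eq₁ : ∀ c i N u → c ℕ.* i ℕ.+ (c ℕ.* i ℕ.* N ℕ.+ u) ≡ suc N ℕ.* (c ℕ.* i) ℕ.+ u
        eq₁ = ℕSolver.solve-∀
        eq₂ : ∀ a b → (a ℕ.* a) ℕ.* (b ℕ.* b) ≡ a ℕ.* b ℕ.* (a ℕ.* b)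
        eq₂ = ℕSolver.solve-∀
        eq₃ : ∀ a p → a ℕ.* a ℕ.* (p ℕ.* p) ≡ a ℕ.* p ℕ.* (a ℕ.* p)
        eq₃ = ℕSolver.solve-∀
        sq : ∀ a k → (a ℕ.* a) ℕ.^ k ≡ a ℕ.^ k ℕ.* a ℕ.^ k
        sq a zero    = refl
        sq a (suc k) = trans (cong (a ℕ.* a ℕ.*_) (sq a k)) (eq₃ a (a ℕ.^ k))

      basis-inv : ∀ x y → + s * dot (λ j → weight x y (i ℕ.+ j)) (basis i) ≡ dot (λ j → weight (σ₁ q x y) (σ₂ q x y) (i ℕ.+ j)) (basis i)
      basis-inv x y = begin
        + s * dot (λ j → weight x y (i ℕ.+ j)) (basis i)
          ≡⟨ cong₂ _*_ (trans (cong +_ s-split) (trans (ℤₚ.pos-* (ν ℕ.^ (c ℕ.* i)) (μ ℕ.^ e)) (cong₂ _*_ (pos-^ ν (c ℕ.* i)) (pos-^ μ e)))) (basis-value x y) ⟩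
        ((+ ν) ^ (c ℕ.* i) * (+ μ) ^ e) * (P ^ (c ℕ.* i) * Eh ^ e)
          ≡⟨ eq ((+ ν) ^ (c ℕ.* i)) ((+ μ) ^ e) (P ^ (c ℕ.* i)) (Eh ^ e) ⟩
        ((+ ν) ^ (c ℕ.* i) * P ^ (c ℕ.* i)) * ((+ μ) ^ e * Eh ^ e)
          ≡⟨ cong₂ _*_ (^-distrib-* (+ ν) P (c ℕ.* i)) (^-distrib-* (+ μ) Eh e) ⟨
        (+ ν * P) ^ (c ℕ.* i) * (+ μ * Eh) ^ e
          ≡⟨ cong₂ (λ u v → u ^ (c ℕ.* i) * v ^ e) (P-inv x y) (E-inv x y) ⟨
        (σ₂ q x y * hom c N′ (σ₁ q x y) (σ₂ q x y) 1-v) ^ (c ℕ.* i) * hom c l (σ₁ q x y) (σ₂ q x y) E ^ e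
          ≡⟨ basis-value (σ₁ q x y) (σ₂ q x y) ⟨
        dot (λ j → weight (σ₁ q x y) (σ₂ q x y) (i ℕ.+ j)) (basis i) ∎
        where
        open ≡-Reasoning
        P  = y * hom c N′ x y 1-v
        Eh = hom c l x y E
        eq : ∀ a b c d → (a * b) * (c * d) ≡ (a * c) * (b * d)
        eq = solve-∀

      basis-length : length (basis i) ℕ.≤ suc D ℕ.∸ i
      basis-length = ℕₚ.≤-trans
        (length-⊛ (1-v ⊛^ (c ℕ.* i)) (E ⊛^ e) (length-⊛^ 1-v (c ℕ.* i) len-1-v) (length-⊛^ E e (s≤s len-E)))
        (ℕₚ.m+n≤o⇒m≤o∸n (suc deg) (s≤s (ℕₚ.≤-trans (ℕₚ.≤-reflexive (sym (DivMod.m*n/n≡m (deg ℕ.+ i) c))) (DivMod./-monoˡ-≤ c bound))))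
        where
        deg = c ℕ.* i ℕ.* 1 ℕ.+ e ℕ.* dE
        open ℕₚ.≤-Reasoning
        eq : ∀ c i e d → (c ℕ.* i ℕ.* 1 ℕ.+ e ℕ.* d ℕ.+ i) ℕ.* c ≡ c ℕ.* i ℕ.+ (c ℕ.* i ℕ.* c ℕ.+ e ℕ.* (c ℕ.* d))
        eq = ℕSolver.solve-∀
        bound : (deg ℕ.+ i) ℕ.* c ℕ.≤ n
        bound = begin
          (deg ℕ.+ i) ℕ.* c                                         ≡⟨ eq c i e dE ⟩
          c ℕ.* i ℕ.+ (c ℕ.* i ℕ.* c ℕ.+ e ℕ.* (c ℕ.* dE))          ≤⟨ ℕₚ.+-monoʳ-≤ (c ℕ.* i) (ℕₚ.+-mono-≤ (ℕₚ.*-monoʳ-≤ (c ℕ.* i) c≤N′) (ℕₚ.*-monoʳ-≤ e c*dE≤l)) ⟩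
          c ℕ.* i ℕ.+ (c ℕ.* i ℕ.* N′ ℕ.+ e ℕ.* l)                  ≡⟨ n-split ⟨
          n                                                         ∎

    instance
      b≢0 : ℕ.NonZero b
      b≢0 = ℕ.>-nonZero b>0

    -- The number of basis elements: `i < K` holds exactly when b i ≤ n′.
    K : ℕ
    K = suc (n′ DivMod./ b)

    n′<b*K : n′ ℕ.< b ℕ.* K
    n′<b*K = ℕₚ.≤-trans (s≤s (ℕₚ.≤-reflexive (DivMod.m≡m%n+[m/n]*n n′ b)))
      (ℕₚ.≤-trans (ℕₚ.+-monoˡ-≤ (n′ DivMod./ b ℕ.* b) (DivMod.m%n<n n′ b)) (ℕₚ.≤-reflexive (ℕₚ.*-comm K b)))

    i<K⇒bi≤n′ : ∀ {i} → i ℕ.< K → b ℕ.* i ℕ.≤ n′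
    i<K⇒bi≤n′ {i} (s≤s h) = ℕₚ.≤-trans (ℕₚ.*-monoʳ-≤ b h) (ℕₚ.≤-trans (ℕₚ.≤-reflexive (ℕₚ.*-comm b _)) (DivMod.m/n*n≤m n′ b))

    -- The count of zeros behind the whole argument: order K in v at 0, order cK at v = 1 and, if
    -- infinity is in the orbit, order K there add up to N K, which exceeds the degree.
    D<N*K : D ℕ.< suc N′ ℕ.* K
    D<N*K = DivMod.m<n*o⇒m/o<n (begin-strict
      l ℕ.* n′                  <⟨ ℕₚ.*-monoʳ-< l {{ℕ.>-nonZero l>0}} n′<b*K ⟩
      l ℕ.* (b ℕ.* K)           ≡⟨ ℕₚ.*-assoc l b K ⟨
      l ℕ.* b ℕ.* K             ≡⟨ cong (ℕ._* K) l*b ⟩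
      suc N′ ℕ.* c ℕ.* K        ≡⟨ eq (suc N′) c K ⟩
      suc N′ ℕ.* K ℕ.* c        ∎)
      where
      open ℕₚ.≤-Reasoning
      eq : ∀ a b c → a ℕ.* b ℕ.* c ≡ a ℕ.* c ℕ.* b
      eq = ℕSolver.solve-∀

    Remainder-inv : Poly → Set
    Remainder-inv f = ∀ x y → + s * dot (λ j → weight x y (K ℕ.+ j)) f ≡ dot (λ j → weight (σ₁ q x y) (σ₂ q x y) (K ℕ.+ j)) f

    -- The form belonging to v^K f vanishes to order cK at y = 0, a point that σ interchanges with y
    -- = 1. Hence f has order cK at v = 1, which exceeds its degree.
    short⇒zero : ∀ f → Remainder-inv f → length f ℕ.≤ c ℕ.* K → ∀ X → eval X f ≡ 0ℤ
    short⇒zero f hf len = high-order⇒zero c (c ℕ.* K) f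
      (λ z → + s * (1ℤ + + suc z) ^ (c ℕ.* K)) (λ z → + s * geo (c ℕ.* K) (+ suc z))
      (λ z → -1ℤ ^ (c ℕ.* K) * w z) (+ s) (λ e → ℕₚ.<-irrefl (sym (ℤₚ.+-injective e)) s>0)
      (λ z → trans (cong (+ s *_) (geo-spec (c ℕ.* K) (+ suc z))) (eq₁ (+ s) (+ suc z) (geo (c ℕ.* K) (+ suc z))))
      at-1+z len
      where
      w : ℕ → ℤ
      w z = hom c (n ℕ.∸ c ℕ.* K) (σ₁ q 1ℤ (1ℤ + + suc z)) (σ₂ q 1ℤ (1ℤ + + suc z)) f
      eq₁ : ∀ s z g → s * (1ℤ + z * g) ≡ s + z * (s * g)
      eq₁ = solve-∀
      eq₂ : ∀ z → 1ℤ - (1ℤ + z) ≡ z * -1ℤ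
      eq₂ = solve-∀
      one-left : ∀ Y → dot (λ j → weight 1ℤ Y (K ℕ.+ j)) f ≡ Y ^ (c ℕ.* K) * eval (Y ^ c) f
      one-left Y = trans (weight-shift 1ℤ Y K f) (cong (Y ^ (c ℕ.* K) *_) (dot-cong f (λ j →
        trans (cong₂ _*_ (ℤₚ.^-zeroˡ (n ℕ.∸ c ℕ.* K ℕ.∸ c ℕ.* j)) (sym (ℤₚ.^-*-assoc Y c j))) (ℤₚ.*-identityˡ ((Y ^ c) ^ j)))))
      at-1+z : ∀ z → + s * (1ℤ + + suc z) ^ (c ℕ.* K) * eval ((1ℤ + + suc z) ^ c) f ≡ (+ suc z) ^ (c ℕ.* K) * (-1ℤ ^ (c ℕ.* K) * w z)
      at-1+z z = begin
        + s * Y ^ (c ℕ.* K) * eval (Y ^ c) f                            ≡⟨ ℤₚ.*-assoc (+ s) (Y ^ (c ℕ.* K)) (eval (Y ^ c) f) ⟩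
        + s * (Y ^ (c ℕ.* K) * eval (Y ^ c) f)                          ≡⟨ cong (+ s *_) (one-left Y) ⟨
        + s * dot (λ j → weight 1ℤ Y (K ℕ.+ j)) f                       ≡⟨ hf 1ℤ Y ⟩
        dot (λ j → weight (σ₁ q 1ℤ Y) (σ₂ q 1ℤ Y) (K ℕ.+ j)) f          ≡⟨ weight-shift (σ₁ q 1ℤ Y) (σ₂ q 1ℤ Y) K f ⟩
        (1ℤ - Y) ^ (c ℕ.* K) * w z                                      ≡⟨ cong (λ u → u ^ (c ℕ.* K) * w z) (eq₂ (+ suc z)) ⟩
        (+ suc z * -1ℤ) ^ (c ℕ.* K) * w z                               ≡⟨ cong (_* w z) (^-distrib-* (+ suc z) -1ℤ (c ℕ.* K)) ⟩
        (+ suc z) ^ (c ℕ.* K) * -1ℤ ^ (c ℕ.* K) * w z                   ≡⟨ ℤₚ.*-assoc ((+ suc z) ^ (c ℕ.* K)) (-1ℤ ^ (c ℕ.* K)) (w z) ⟩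
        (+ suc z) ^ (c ℕ.* K) * (-1ℤ ^ (c ℕ.* K) * w z)                 ∎
        where
        open ≡-Reasoning
        Y = 1ℤ + + suc z

    -- For q = 2 and even c, σ conjugates y ↦ -y into the swap of x and y.
    palindromic⇒shorter : q ≡ 2 → ∃ (λ h → c ≡ 2 ℕ.* h) → ∃ (λ h → l ≡ c ℕ.* h) →
      ∀ f → Remainder-inv f → length f ℕ.≤ suc D ℕ.∸ K →
      ∃ λ f′ → length f′ ℕ.≤ suc (D ℕ.∸ K) ℕ.∸ K × (∀ e → dot e f ≡ dot e f′)
    palindromic⇒shorter q≡2 (h , c≡2h) (h′ , l≡ch′) f hfq len = drop-top c K (D ℕ.∸ K) f
      (λ z → dot (λ j → (+ suc z) ^ (c ℕ.* j)) f) reversed (ℕₚ.≤-trans len (suc-∸ D K))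
      where
      hf : ∀ x y → + s * dot (λ j → weight x y (K ℕ.+ j)) f ≡ dot (λ j → weight (σ₁ 2 x y) (σ₂ 2 x y) (K ℕ.+ j)) f
      hf x y = trans (hfq x y) (cong (λ q → dot (λ j → weight (σ₁ q x y) (σ₂ q x y) (K ℕ.+ j)) f) q≡2)
      suc-∸ : ∀ D K → suc D ℕ.∸ K ℕ.≤ suc (D ℕ.∸ K)
      suc-∸ D       zero    = ℕₚ.≤-refl
      suc-∸ zero    (suc K) = ℕₚ.≤-trans (ℕₚ.m∸n≤m 0 K) z≤n
      suc-∸ (suc D) (suc K) = suc-∸ D K
      n≡cD : n ≡ c ℕ.* D
      n≡cD = trans n≡ (cong (c ℕ.*_) (sym (trans (cong (DivMod._/ c) (trans n≡ (ℕₚ.*-comm c (h′ ℕ.* n′)))) (DivMod.m*n/n≡m (h′ ℕ.* n′) c))))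
        where
        n≡ : n ≡ c ℕ.* (h′ ℕ.* n′)
        n≡ = trans (cong (ℕ._* n′) l≡ch′) (ℕₚ.*-assoc c h′ n′)
      even-^ : ∀ y k → (- y) ^ (c ℕ.* k) ≡ y ^ (c ℕ.* k)
      even-^ y k = subst (λ m → (- y) ^ m ≡ y ^ m) (trans (sym (ℕₚ.*-assoc 2 h k)) (cong (ℕ._* k) (sym c≡2h)))
        (trans (sym (ℤₚ.^-*-assoc (- y) 2 (h ℕ.* k))) (trans (cong (_^ (h ℕ.* k)) (eq y)) (ℤₚ.^-*-assoc y 2 (h ℕ.* k))))
        where
        eq : ∀ y → - y * (- y * 1ℤ) ≡ y * (y * 1ℤ)
        eq = solve-∀
      swap : ∀ X → dot (λ j → weight (+ 2 * X) (+ 2) (K ℕ.+ j)) f ≡ dot (λ j → weight (+ 2) (+ 2 * X) (K ℕ.+ j)) f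
      swap X = begin
        dot (λ j → weight (+ 2 * X) (+ 2) (K ℕ.+ j)) f
          ≡⟨ cong₂ (λ u v → dot (λ j → weight u v (K ℕ.+ j)) f) (eq₁ X) (eq₂ X) ⟩
        dot (λ j → weight (σ₁ 2 x y) (σ₂ 2 x y) (K ℕ.+ j)) f
          ≡⟨ hf x y ⟨
        + s * dot (λ j → weight x y (K ℕ.+ j)) f
          ≡⟨ cong (+ s *_) (dot-cong f (λ j → cong (x ^ (n ℕ.∸ c ℕ.* (K ℕ.+ j)) *_) (sym (even-^ y (K ℕ.+ j))))) ⟩
        + s * dot (λ j → weight x (- y) (K ℕ.+ j)) f
          ≡⟨ hf x (- y) ⟩
        dot (λ j → weight (σ₁ 2 x (- y)) (σ₂ 2 x (- y)) (K ℕ.+ j)) f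
          ≡⟨ cong₂ (λ u v → dot (λ j → weight u v (K ℕ.+ j)) f) (eq₃ X) (eq₄ X) ⟩
        dot (λ j → weight (+ 2) (+ 2 * X) (K ℕ.+ j)) f ∎
        where
        open ≡-Reasoning
        -- Chosen so that σ sends (x, y) to (2X, 2) and (x, -y) to (2, 2X); an even `c` does not see
        -- the sign of y.
        x = X + 1ℤ
        y = X - 1ℤ
        eq₁ : ∀ X → + 2 * X ≡ (X + 1ℤ) + 1ℤ * (X - 1ℤ)
        eq₁ = solve-∀
        eq₂ : ∀ X → + 2 ≡ (X + 1ℤ) - (X - 1ℤ)
        eq₂ = solve-∀
        eq₃ : ∀ X → (X + 1ℤ) + 1ℤ * - (X - 1ℤ) ≡ + 2
        eq₃ = solve-∀
        eq₄ : ∀ X → (X + 1ℤ) - - (X - 1ℤ) ≡ + 2 * X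
        eq₄ = solve-∀
      in-range : ∀ j → j ℕ.< length f → K ℕ.+ j ℕ.≤ D
      in-range j j< = go D K (ℕₚ.≤-trans j< len)
        where
        go : ∀ D K → j ℕ.< suc D ℕ.∸ K → K ℕ.+ j ℕ.≤ D
        go D       zero    h = ℕₚ.≤-pred h
        go zero    (suc K) h = ⊥-elim (ℕₚ.n≮0 (ℕₚ.≤-trans h (ℕₚ.≤-reflexive (ℕₚ.0∸n≡0 K))))
        go (suc D) (suc K) h = s≤s (go D K h)
      two-pow : ∀ u v → u ℕ.+ v ≡ n → ∀ X → (+ 2) ^ u * (+ 2 * X) ^ v ≡ (+ 2) ^ n * X ^ v
      two-pow u v e X = trans (cong ((+ 2) ^ u *_) (^-distrib-* (+ 2) X v)) (trans (sym (ℤₚ.*-assoc ((+ 2) ^ u) ((+ 2) ^ v) (X ^ v)))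
        (cong (_* X ^ v) (trans (sym (ℤₚ.^-distribˡ-+-* (+ 2) u v)) (cong ((+ 2) ^_) e))))
      reversed : ∀ z → dot (λ j → (+ suc z) ^ (c ℕ.* (D ℕ.∸ K ℕ.∸ j))) f ≡ (+ suc z) ^ (c ℕ.* K) * dot (λ j → (+ suc z) ^ (c ℕ.* j)) f
      reversed z = cancel-nonzero ((+ 2) ^ n) (pow-suc-nonzero 1 n) (begin
        (+ 2) ^ n * dot (λ j → X ^ (c ℕ.* (D ℕ.∸ K ℕ.∸ j))) f
          ≡⟨ dot-* ((+ 2) ^ n) (λ j → X ^ (c ℕ.* (D ℕ.∸ K ℕ.∸ j))) f ⟨
        dot (λ j → (+ 2) ^ n * X ^ (c ℕ.* (D ℕ.∸ K ℕ.∸ j))) f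
          ≡⟨ dot-cong-< f left ⟨
        dot (λ j → weight (+ 2 * X) (+ 2) (K ℕ.+ j)) f
          ≡⟨ swap X ⟩
        dot (λ j → weight (+ 2) (+ 2 * X) (K ℕ.+ j)) f
          ≡⟨ dot-cong-< f right ⟩
        dot (λ j → (+ 2) ^ n * (X ^ (c ℕ.* K) * X ^ (c ℕ.* j))) f
          ≡⟨ dot-* ((+ 2) ^ n) (λ j → X ^ (c ℕ.* K) * X ^ (c ℕ.* j)) f ⟩
        (+ 2) ^ n * dot (λ j → X ^ (c ℕ.* K) * X ^ (c ℕ.* j)) f
          ≡⟨ cong ((+ 2) ^ n *_) (dot-* (X ^ (c ℕ.* K)) (λ j → X ^ (c ℕ.* j)) f) ⟩
        (+ 2) ^ n * (X ^ (c ℕ.* K) * dot (λ j → X ^ (c ℕ.* j)) f) ∎)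
        where
        open ≡-Reasoning
        X = + suc z
        n∸ : ∀ j → n ℕ.∸ c ℕ.* (K ℕ.+ j) ≡ c ℕ.* (D ℕ.∸ K ℕ.∸ j)
        n∸ j = trans (cong (ℕ._∸ c ℕ.* (K ℕ.+ j)) n≡cD) (trans (sym (ℕₚ.*-distribˡ-∸ c D (K ℕ.+ j))) (cong (c ℕ.*_) (sym (ℕₚ.∸-+-assoc D K j))))
        cK≤n : ∀ j → j ℕ.< length f → c ℕ.* (K ℕ.+ j) ℕ.≤ n
        cK≤n j j< = ℕₚ.≤-trans (ℕₚ.*-monoʳ-≤ c (in-range j j<)) (ℕₚ.≤-reflexive (sym n≡cD))
        left : ∀ j → j ℕ.< length f → weight (+ 2 * X) (+ 2) (K ℕ.+ j) ≡ (+ 2) ^ n * X ^ (c ℕ.* (D ℕ.∸ K ℕ.∸ j))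
        left j j< = trans (ℤₚ.*-comm ((+ 2 * X) ^ (n ℕ.∸ c ℕ.* (K ℕ.+ j))) ((+ 2) ^ (c ℕ.* (K ℕ.+ j))))
          (trans (two-pow (c ℕ.* (K ℕ.+ j)) (n ℕ.∸ c ℕ.* (K ℕ.+ j)) (ℕₚ.m+[n∸m]≡n (cK≤n j j<)) X) (cong (λ u → (+ 2) ^ n * X ^ u) (n∸ j)))
        right : ∀ j → j ℕ.< length f → weight (+ 2) (+ 2 * X) (K ℕ.+ j) ≡ (+ 2) ^ n * (X ^ (c ℕ.* K) * X ^ (c ℕ.* j))
        right j j< = trans (two-pow (n ℕ.∸ c ℕ.* (K ℕ.+ j)) (c ℕ.* (K ℕ.+ j)) (ℕₚ.m∸n+n≡m (cK≤n j j<)) X)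
          (cong ((+ 2) ^ n *_) (trans (cong (X ^_) (ℕₚ.*-distribˡ-+ c K j)) (ℤₚ.^-distribˡ-+-* X (c ℕ.* K) (c ℕ.* j))))

    -- If infinity is not in the orbit, D + 1 - K ≤ cK and the order at v = 1 suffices. Otherwise
    -- the exchange of x and y first removes K more coefficients from the top.
    remainder-zero : ∀ f → Remainder-inv f → length f ℕ.≤ suc D ℕ.∸ K → ∀ e → dot e f ≡ 0ℤ
    remainder-zero f hf len e = cases infinity
      where
      cases : N′ ≡ c ⊎ (q ≡ 2 × N′ ≡ suc c × ∃ (λ h → c ≡ 2 ℕ.* h) × ∃ (λ h → l ≡ c ℕ.* h)) → dot e f ≡ 0ℤ
      cases (inj₁ N′≡) = dot-zero e (eval-zero⇒zero f (λ z → short⇒zero f hf (ℕₚ.≤-trans len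
        (ℕₚ.m≤n+o⇒m∸n≤o (suc D) K (subst (λ u → D ℕ.< suc u ℕ.* K) N′≡ D<N*K))) (+ suc z)))
      cases (inj₂ (q≡2 , N′≡ , 2∣c , c∣l)) = trans (same e) (dot-zero e (eval-zero⇒zero f′ (λ z → short⇒zero f′ f′-inv short (+ suc z))))
        where
        shorter = palindromic⇒shorter q≡2 2∣c c∣l f hf len
        f′   = proj₁ shorter
        same : ∀ e → dot e f ≡ dot e f′
        same = proj₂ (proj₂ shorter)
        f′-inv : Remainder-inv f′
        f′-inv x y = trans (cong (+ s *_) (sym (same (λ j → weight x y (K ℕ.+ j)))))
          (trans (hf x y) (same (λ j → weight (σ₁ q x y) (σ₂ q x y) (K ℕ.+ j))))
        short : length f′ ℕ.≤ c ℕ.* K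
        short = ℕₚ.≤-trans (proj₁ (proj₂ shorter)) (ℕₚ.m≤n+o⇒m∸n≤o (suc (D ℕ.∸ K)) K
          (ℕₚ.m<n+o⇒m∸n<o D K (subst (λ u → D ℕ.< suc u ℕ.* K) N′≡ D<N*K)))

    module _ (f : Poly) (len-f : length f ℕ.≤ suc D)
             (f-inv : ∀ x y → + s * hom c n x y f ≡ hom c n (σ₁ q x y) (σ₂ q x y) f) where

      -- Gleason's theorem in dual form. Both `f` and its expansion have eigenvalue `s`, hence so
      -- does the remainder, and `remainder-zero` applies to it.
      functional-vanishes : (φ : ℕ → ℤ) → (∀ i → b ℕ.* i ℕ.≤ n′ → dot (λ j → φ (i ℕ.+ j)) (basis i) ≡ 0ℤ) → dot φ f ≡ 0ℤ
      functional-vanishes φ hφ = trans (expansion φ) (cong₂ _+_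
        (sumTo-zero K (λ i i< → trans (cong (a i *_) (hφ i (i<K⇒bi≤n′ i<))) (ℤₚ.*-zeroʳ (a i))))
        (remainder-zero f′ f′-inv len-f′ (λ j → φ (K ℕ.+ j))))
        where
        expanded = expand K (suc D) f basis
          (λ i i< → headOne-⊛ (headOne-⊛^ (c ℕ.* i) (-1ℤ ∷ [] , refl)) (headOne-⊛^ (n′ ℕ.∸ b ℕ.* i) (E′ , refl)) , basis-length i (i<K⇒bi≤n′ i<)) len-f
        a = proj₁ expanded
        f′ = proj₁ (proj₂ expanded)
        len-f′ : length f′ ℕ.≤ suc D ℕ.∸ K
        len-f′ = proj₁ (proj₂ (proj₂ expanded))
        expansion : ∀ e → dot e f ≡ sumTo K (λ i → a i * dot (λ j → e (i ℕ.+ j)) (basis i)) + dot (λ j → e (K ℕ.+ j)) f′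
        expansion = proj₂ (proj₂ (proj₂ expanded))
        Σ-basis : ℤ → ℤ → ℤ
        Σ-basis x y = sumTo K (λ i → a i * dot (λ j → weight x y (i ℕ.+ j)) (basis i))
        eq₁ : ∀ s a d → s * (a * d) ≡ a * (s * d)
        eq₁ = solve-∀
        eq₂ : ∀ s u v w → s * v ≡ s * (u + v) - w + (w - s * u)
        eq₂ = solve-∀
        eq₃ : ∀ w v → w + v - w + (w - w) ≡ v
        eq₃ = solve-∀
        Σ-inv : ∀ x y → + s * Σ-basis x y ≡ Σ-basis (σ₁ q x y) (σ₂ q x y)
        Σ-inv x y = trans (sym (sumTo-* (+ s) K (λ i → a i * dot (λ j → weight x y (i ℕ.+ j)) (basis i)))) (sumTo-cong K (λ i i< →
          trans (eq₁ (+ s) (a i) (dot (λ j → weight x y (i ℕ.+ j)) (basis i))) (cong (a i *_) (basis-inv i (i<K⇒bi≤n′ i<) x y))))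
        f′-inv : Remainder-inv f′
        f′-inv x y = begin
          + s * R x y                                                       ≡⟨ eq₂ (+ s) (Σ-basis x y) (R x y) (Σ-basis x′ y′) ⟩
          + s * (Σ-basis x y + R x y) - Σ-basis x′ y′ + (Σ-basis x′ y′ - + s * Σ-basis x y)
            ≡⟨ cong₂ (λ u v → u - Σ-basis x′ y′ + (Σ-basis x′ y′ - v))
                 (trans (cong (+ s *_) (sym (expansion (weight x y)))) (trans (f-inv x y) (expansion (weight x′ y′)))) (Σ-inv x y) ⟩
          Σ-basis x′ y′ + R x′ y′ - Σ-basis x′ y′ + (Σ-basis x′ y′ - Σ-basis x′ y′) ≡⟨ eq₃ (Σ-basis x′ y′) (R x′ y′) ⟩
          R x′ y′ ∎
          where
          open ≡-Reasoning
          x′ = σ₁ q x y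
          y′ = σ₂ q x y
          R : ℤ → ℤ → ℤ
          R x y = dot (λ j → weight x y (K ℕ.+ j)) f′

-- The kernel annihilates all invariant enumerators

module KernelVanishing {q c : ℕ} .{{c≢0 : ℕ.NonZero c}} (inv : Invariants q c) where
  open Invariants inv

  module _ (s : ℕ) (A B : ℤ) where
    g = kernel s A B

    separate : ∀ m e → (1-v ⊛^ m) ⊛ (E ⊛^ e) ⊛ g ≈
      (1-v ⊛^ m) ⊛ (scale A ((E ⊛^ (e ℕ.+ s ℕ.+ b)) ⊛ J) ⊕ scale B (0ℤ ∷ (1-v ⊛^ c) ⊛ ((E ⊛^ (e ℕ.+ s)) ⊛ J)))
    separate m e X = begin
      eval X ((1-v ⊛^ m) ⊛ (E ⊛^ e) ⊛ g)
        ≡⟨ trans (eval-⊛ X ((1-v ⊛^ m) ⊛ (E ⊛^ e)) g) (cong₂ _*_ (trans (eval-⊛ X (1-v ⊛^ m) (E ⊛^ e)) (cong (eval X (1-v ⊛^ m) *_) (eval-⊛^ X E e))) eval-g) ⟩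
      V * ε ^ e * (ε ^ s * j * (A * ε ^ b + B * (X * u)))
        ≡⟨ eq₁ V (ε ^ e) (ε ^ s) j A (ε ^ b) B X u ⟩
      V * (A * (ε ^ e * ε ^ s * ε ^ b * j) + B * (X * (u * (ε ^ e * ε ^ s * j))))
        ≡⟨ cong₂ (λ v w → V * (A * (v * j) + B * (X * (u * (w * j)))))
             (trans (ℤₚ.^-distribˡ-+-* ε (e ℕ.+ s) b) (cong (_* ε ^ b) (ℤₚ.^-distribˡ-+-* ε e s))) (ℤₚ.^-distribˡ-+-* ε e s) ⟨
      V * (A * (ε ^ (e ℕ.+ s ℕ.+ b) * j) + B * (X * (u * (ε ^ (e ℕ.+ s) * j))))
        ≡⟨ cong (V *_) (trans (dot-⊕ (X ^_) (scale A ((E ⊛^ (e ℕ.+ s ℕ.+ b)) ⊛ J)) _) (cong₂ _+_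
             (trans (dot-scale (X ^_) A ((E ⊛^ (e ℕ.+ s ℕ.+ b)) ⊛ J)) (cong (A *_) (eval-EJ (e ℕ.+ s ℕ.+ b))))
             (trans (dot-scale (X ^_) B (0ℤ ∷ (1-v ⊛^ c) ⊛ ((E ⊛^ (e ℕ.+ s)) ⊛ J))) (cong (B *_) (trans (eval-∷ X 0ℤ ((1-v ⊛^ c) ⊛ ((E ⊛^ (e ℕ.+ s)) ⊛ J)))
               (trans (ℤₚ.+-identityˡ _) (cong (X *_) (trans (eval-⊛ X (1-v ⊛^ c) ((E ⊛^ (e ℕ.+ s)) ⊛ J)) (cong (u *_) (eval-EJ (e ℕ.+ s))))))))))) ⟨
      V * eval X (scale A ((E ⊛^ (e ℕ.+ s ℕ.+ b)) ⊛ J) ⊕ scale B (0ℤ ∷ (1-v ⊛^ c) ⊛ ((E ⊛^ (e ℕ.+ s)) ⊛ J)))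
        ≡⟨ eval-⊛ X (1-v ⊛^ m) _ ⟨
      eval X ((1-v ⊛^ m) ⊛ (scale A ((E ⊛^ (e ℕ.+ s ℕ.+ b)) ⊛ J) ⊕ scale B (0ℤ ∷ (1-v ⊛^ c) ⊛ ((E ⊛^ (e ℕ.+ s)) ⊛ J)))) ∎
      where
      open ≡-Reasoning
      ε = eval X E
      j = eval X J
      u = eval X (1-v ⊛^ c)
      V = eval X (1-v ⊛^ m)
      eq₁ : ∀ V e s j A b B X u → V * e * (s * j * (A * b + B * (X * u))) ≡ V * (A * (e * s * b * j) + B * (X * (u * (e * s * j))))
      eq₁ = solve-∀
      eval-EJ : ∀ k → eval X ((E ⊛^ k) ⊛ J) ≡ ε ^ k * j
      eval-EJ k = trans (eval-⊛ X (E ⊛^ k) J) (cong (_* j) (eval-⊛^ X E k))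
      eval-g : eval X g ≡ ε ^ s * j * (A * ε ^ b + B * (X * u))
      eval-g = trans (eval-⊛ X ((E ⊛^ s) ⊛ J) (scale A (E ⊛^ b) ⊕ scale B (0ℤ ∷ (1-v ⊛^ c)))) (cong₂ _*_ (eval-EJ s)
        (trans (dot-⊕ (X ^_) (scale A (E ⊛^ b)) (scale B (0ℤ ∷ (1-v ⊛^ c)))) (cong₂ _+_
          (trans (dot-scale (X ^_) A (E ⊛^ b)) (cong (A *_) (eval-⊛^ X E b)))
          (trans (dot-scale (X ^_) B (0ℤ ∷ (1-v ⊛^ c))) (cong (B *_) (trans (eval-∷ X 0ℤ (1-v ⊛^ c)) (ℤₚ.+-identityˡ (X * u))))))))

    -- The factor (1 - v)^(ci) lowers the exponent to cK with K = t + 2. The term with `A` is then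
    -- exact at level K. In the term with `B`, the factors v and (1 - v)^c lower the level once
    -- more, to t + 1. Exactness concerns E^a J with a + 1 a multiple of b, hence `suc s` in the
    -- hypothesis.
    kernel-basis : ∀ i e t → e ℕ.+ suc s ≡ b ℕ.* suc t →
      extract (c ℕ.* (i ℕ.+ suc (suc t))) (suc (suc t)) ((1-v ⊛^ (c ℕ.* i)) ⊛ (E ⊛^ e) ⊛ g) ≡ 0ℤ
    kernel-basis i e t he = begin
      extract (c ℕ.* (i ℕ.+ K)) K ((1-v ⊛^ (c ℕ.* i)) ⊛ (E ⊛^ e) ⊛ g)
        ≡⟨ ≈⇒dot (λ k → + coeff (c ℕ.* (i ℕ.+ K)) K k) {(1-v ⊛^ (c ℕ.* i)) ⊛ (E ⊛^ e) ⊛ g} {(1-v ⊛^ (c ℕ.* i)) ⊛ (scale A p₁ ⊕ scale B (0ℤ ∷ p₂))} (separate (c ℕ.* i) e) ⟩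
      extract (c ℕ.* (i ℕ.+ K)) K ((1-v ⊛^ (c ℕ.* i)) ⊛ (scale A p₁ ⊕ scale B (0ℤ ∷ p₂)))
        ≡⟨ cong (λ r → extract r K ((1-v ⊛^ (c ℕ.* i)) ⊛ (scale A p₁ ⊕ scale B (0ℤ ∷ p₂)))) (ℕₚ.*-distribˡ-+ c i K) ⟩
      extract (c ℕ.* i ℕ.+ c ℕ.* K) K ((1-v ⊛^ (c ℕ.* i)) ⊛ (scale A p₁ ⊕ scale B (0ℤ ∷ p₂)))
        ≡⟨ extract-1-v^ (c ℕ.* i) (c ℕ.* K) K (scale A p₁ ⊕ scale B (0ℤ ∷ p₂)) ⟩
      extract (c ℕ.* K) K (scale A p₁ ⊕ scale B (0ℤ ∷ p₂))
        ≡⟨ trans (dot-⊕ w (scale A p₁) (scale B (0ℤ ∷ p₂))) (cong₂ _+_ (dot-scale w A p₁) (dot-scale w B (0ℤ ∷ p₂))) ⟩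
      A * extract (c ℕ.* K) K p₁ + B * (0ℤ * + coeff (c ℕ.* K) K 0 + extract (c ℕ.* K) (suc t) p₂)
        ≡⟨ cong₂ (λ u v → A * u + B * v) first (trans (ℤₚ.+-identityˡ (extract (c ℕ.* K) (suc t) p₂)) second) ⟩
      A * 0ℤ + B * 0ℤ
        ≡⟨ cong₂ _+_ (ℤₚ.*-zeroʳ A) (ℤₚ.*-zeroʳ B) ⟩
      0ℤ ∎
      where
      open ≡-Reasoning
      K = suc (suc t)
      w : ℕ → ℤ
      w k = + coeff (c ℕ.* K) K k
      p₁ p₂ : Poly
      p₁ = (E ⊛^ (e ℕ.+ s ℕ.+ b)) ⊛ J
      p₂ = (1-v ⊛^ c) ⊛ ((E ⊛^ (e ℕ.+ s)) ⊛ J)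
      degree : ∀ a k → suc a ≡ b ℕ.* k → l ℕ.* suc a ≡ suc N′ ℕ.* c ℕ.* k
      degree a k h = trans (cong (l ℕ.*_) h) (trans (sym (ℕₚ.*-assoc l b k)) (cong (ℕ._* k) l*b))
      he′ : suc (e ℕ.+ s) ≡ b ℕ.* suc t
      he′ = trans (sym (ℕₚ.+-suc e s)) he
      first : extract (c ℕ.* K) K p₁ ≡ 0ℤ
      first = extract-exact c (suc N′) l E J (e ℕ.+ s ℕ.+ b) (suc t)
        (degree (e ℕ.+ s ℕ.+ b) K (trans (cong (ℕ._+ b) he′) (trans (ℕₚ.+-comm (b ℕ.* suc t) b) (sym (ℕₚ.*-suc b (suc t)))))) J-def
      second : extract (c ℕ.* K) (suc t) p₂ ≡ 0ℤ
      second = trans (cong (λ r → extract r (suc t) p₂) (ℕₚ.*-suc c (suc t)))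
        (trans (extract-1-v^ c (c ℕ.* suc t) (suc t) ((E ⊛^ (e ℕ.+ s)) ⊛ J))
          (extract-exact c (suc N′) l E J (e ℕ.+ s) t (degree (e ℕ.+ s) (suc t) he′) J-def))

    -- The coefficient of v^(K - j) in g (1 - v)^(-(cK+1)): the amount that a word of weight cj
    -- contributes to the identity.
    functional : ℕ → ℕ → ℤ
    functional K j = dot (λ k → + coeff (c ℕ.* K) K (j ℕ.+ k)) g

    kernel-annihilates : ∀ n′ size → 0 ℕ.< size → size ℕ.* size ≡ q ℕ.^ (l ℕ.* n′) →
      ∀ f → length f ℕ.≤ suc (l ℕ.* n′ DivMod./ c) →
      (∀ x y → + size * hom c (l ℕ.* n′) x y f ≡ hom c (l ℕ.* n′) (σ₁ q x y) (σ₂ q x y) f) →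
      ∀ K → n′ ℕ.+ suc s ≡ b ℕ.* K → dot (functional (suc K)) f ≡ 0ℤ
    kernel-annihilates n′ size size>0 size² f len-f f-inv K hK =
      Vanishing.functional-vanishes inv n′ size size>0 size² f len-f f-inv (functional (suc K)) on-basis
      where
      on-basis : ∀ i → b ℕ.* i ℕ.≤ n′ → dot (λ j → functional (suc K) (i ℕ.+ j)) ((1-v ⊛^ (c ℕ.* i)) ⊛ (E ⊛^ (n′ ℕ.∸ b ℕ.* i))) ≡ 0ℤ
      on-basis i bi≤n′ = begin
        dot (λ j → dot (λ k → + coeff (c ℕ.* suc K) (suc K) (i ℕ.+ j ℕ.+ k)) g) basis
          ≡⟨ dot-cong basis (λ j → dot-cong g (λ k → cong (λ m → + coeff (c ℕ.* suc K) (suc K) m) (ℕₚ.+-assoc i j k))) ⟩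
        dot (λ j → dot (λ k → + coeff (c ℕ.* suc K) (suc K) (i ℕ.+ (j ℕ.+ k))) g) basis
          ≡⟨ dot-⊛ (λ m → + coeff (c ℕ.* suc K) (suc K) (i ℕ.+ m)) basis g ⟨
        dot (λ m → + coeff (c ℕ.* suc K) (suc K) (i ℕ.+ m)) (basis ⊛ g)
          ≡⟨ cong (λ L → dot (λ m → + coeff (c ℕ.* L) L (i ℕ.+ m)) (basis ⊛ g)) K-split ⟩
        dot (λ m → + coeff (c ℕ.* (i ℕ.+ suc (suc t))) (i ℕ.+ suc (suc t)) (i ℕ.+ m)) (basis ⊛ g)
          ≡⟨ dot-cong (basis ⊛ g) (λ m → cong +_ (coeff-shift (c ℕ.* (i ℕ.+ suc (suc t))) i (suc (suc t)) m)) ⟩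
        extract (c ℕ.* (i ℕ.+ suc (suc t))) (suc (suc t)) (basis ⊛ g)
          ≡⟨ kernel-basis i e t e-eq ⟩
        0ℤ ∎
        where
        open ≡-Reasoning
        e = n′ ℕ.∸ b ℕ.* i
        basis = (1-v ⊛^ (c ℕ.* i)) ⊛ (E ⊛^ e)
        i<K : i ℕ.< K
        i<K = ℕₚ.*-cancelˡ-< b i K (ℕₚ.≤-trans (s≤s bi≤n′) (ℕₚ.≤-trans (ℕₚ.≤-trans (ℕₚ.m≤m+n (suc n′) s) (ℕₚ.≤-reflexive (sym (ℕₚ.+-suc n′ s)))) (ℕₚ.≤-reflexive hK)))
        t = K ℕ.∸ suc i
        K≡ : i ℕ.+ suc t ≡ K
        K≡ = trans (ℕₚ.+-suc i t) (ℕₚ.m+[n∸m]≡n i<K)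
        K-split : suc K ≡ i ℕ.+ suc (suc t)
        K-split = trans (cong suc (sym K≡)) (sym (ℕₚ.+-suc i (suc t)))
        e-eq : e ℕ.+ suc s ≡ b ℕ.* suc t
        e-eq = ℕₚ.+-cancelˡ-≡ (b ℕ.* i) (e ℕ.+ suc s) (b ℕ.* suc t) (trans (sym (ℕₚ.+-assoc (b ℕ.* i) e (suc s)))
          (trans (cong (ℕ._+ suc s) (ℕₚ.m+[n∸m]≡n bi≤n′)) (trans hK (trans (cong (b ℕ.*_) (sym K≡)) (ℕₚ.*-distribˡ-+ b i (suc t))))))

-- Positivity of the kernel

hom-pad : ∀ c k {n} x y p → Fits c n p → hom c (k ℕ.+ n) x y p ≡ x ^ k * hom c n x y p
hom-pad c k {n} x y p fp = trans (dot-cong-< p (λ i i< → trans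
    (cong (_* y ^ (c ℕ.* i)) (trans (cong (x ^_) (ℕₚ.+-∸-assoc k (fp i i<))) (ℤₚ.^-distribˡ-+-* x k (n ℕ.∸ c ℕ.* i))))
    (ℤₚ.*-assoc (x ^ k) (x ^ (n ℕ.∸ c ℕ.* i)) (y ^ (c ℕ.* i)))))
  (dot-* (x ^ k) (λ i → x ^ (n ℕ.∸ c ℕ.* i) * y ^ (c ℕ.* i)) p)

hom-dilate : ∀ n k x y p → Fits 1 n p → hom 1 n (k * x) (k * y) p ≡ k ^ n * hom 1 n x y p
hom-dilate n k x y p fp = trans (dot-cong-< p pointwise) (dot-* (k ^ n) (λ i → x ^ (n ℕ.∸ 1 ℕ.* i) * y ^ (1 ℕ.* i)) p)
  where
  eq : ∀ a b x y → (a * x) * (b * y) ≡ (a * b) * (x * y)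
  eq = solve-∀
  pointwise : ∀ i → i ℕ.< length p →
    (k * x) ^ (n ℕ.∸ 1 ℕ.* i) * (k * y) ^ (1 ℕ.* i) ≡ k ^ n * (x ^ (n ℕ.∸ 1 ℕ.* i) * y ^ (1 ℕ.* i))
  pointwise i i< = trans (cong₂ _*_ (^-distrib-* k x (n ℕ.∸ 1 ℕ.* i)) (^-distrib-* k y (1 ℕ.* i)))
    (trans (eq (k ^ (n ℕ.∸ 1 ℕ.* i)) (k ^ (1 ℕ.* i)) (x ^ (n ℕ.∸ 1 ℕ.* i)) (y ^ (1 ℕ.* i)))
      (cong (_* (x ^ (n ℕ.∸ 1 ℕ.* i) * y ^ (1 ℕ.* i))) (trans (sym (ℤₚ.^-distribˡ-+-* k (n ℕ.∸ 1 ℕ.* i) (1 ℕ.* i))) (cong (k ^_) (ℕₚ.m∸n+n≡m (fp i i<))))))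

hom-v∷ : ∀ n x y p → hom 1 (suc n) x y (0ℤ ∷ p) ≡ y * hom 1 n x y p
hom-v∷ n x y p = trans (ℤₚ.+-identityˡ _) (trans (dot-cong p (λ i → trans
    (cong₂ (λ u v → x ^ (suc n ℕ.∸ u) * y ^ v) (ℕₚ.*-suc 1 i) (ℕₚ.*-suc 1 i))
    (eq (x ^ (n ℕ.∸ 1 ℕ.* i)) y (y ^ (1 ℕ.* i)))))
  (dot-* y (λ i → x ^ (n ℕ.∸ 1 ℕ.* i) * y ^ (1 ℕ.* i)) p))
  where
  eq : ∀ a y b → a * (y * b) ≡ y * (a * b)
  eq = solve-∀

hom-1-v : ∀ x y → hom 1 1 x y 1-v ≡ x - y
hom-1-v = eq
  where
  eq : ∀ x y → 1ℤ * (x * 1ℤ * 1ℤ) + (-1ℤ * (1ℤ * (y * 1ℤ)) + 0ℤ) ≡ x - y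
  eq = solve-∀

fits₁ : ∀ n p → length p ℕ.≤ suc n → Fits 1 n p
fits₁ n p len = fits 1 n p len (ℕₚ.≤-reflexive (ℕₚ.*-identityˡ n))

dot-mono : ∀ {c d} p → All (0ℤ ℤ.≤_) p → (∀ i → i ℕ.< length p → c i ℤ.≤ d i) → dot c p ℤ.≤ dot d p
dot-mono []      []       h = ℤₚ.≤-refl
dot-mono (a ∷ p) (0≤a ∷ ps) h = ℤₚ.+-mono-≤ (ℤₚ.*-monoˡ-≤-nonNeg a {{ℤ.nonNegative 0≤a}} (h 0 (s≤s z≤n))) (dot-mono p ps (λ i i< → h (suc i) (s≤s i<)))

*-mono-≤-nonNeg : ∀ {a b c d} → 0ℤ ℤ.≤ a → a ℤ.≤ b → 0ℤ ℤ.≤ c → c ℤ.≤ d → a * c ℤ.≤ b * d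
*-mono-≤-nonNeg {a} {b} {c} {d} 0≤a a≤b 0≤c c≤d = ℤₚ.≤-trans
  (ℤₚ.*-monoˡ-≤-nonNeg a {{ℤ.nonNegative 0≤a}} c≤d)
  (ℤₚ.*-monoʳ-≤-nonNeg d {{ℤ.nonNegative (ℤₚ.≤-trans 0≤c c≤d)}} a≤b)

^-nonNeg : ∀ {a} k → 0ℤ ℤ.≤ a → 0ℤ ℤ.≤ a ^ k
^-nonNeg zero    h = ℤ.+≤+ z≤n
^-nonNeg {a} (suc k) h = *-mono-≤-nonNeg {0ℤ} {a} {0ℤ} {a ^ k} ℤₚ.≤-refl h ℤₚ.≤-refl (^-nonNeg k h)

^-mono-≤ : ∀ {a b} k → 0ℤ ℤ.≤ a → a ℤ.≤ b → a ^ k ℤ.≤ b ^ k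
^-mono-≤ zero    h₁ h₂ = ℤₚ.≤-refl
^-mono-≤ {a} {b} (suc k) h₁ h₂ = *-mono-≤-nonNeg {a} {b} {a ^ k} {b ^ k} h₁ h₂ (^-nonNeg k h₁) (^-mono-≤ k h₁ h₂)

*-pos : ∀ {a b} → 0ℤ ℤ.< a → 0ℤ ℤ.< b → 0ℤ ℤ.< a * b
*-pos {a} {b} 0<a 0<b = ℤₚ.≤-<-trans (ℤₚ.≤-reflexive (sym (ℤₚ.*-zeroʳ a))) (ℤₚ.*-monoˡ-<-pos a {{ℤ.positive 0<a}} 0<b)

^-pos : ∀ {a} k → 0ℤ ℤ.< a → 0ℤ ℤ.< a ^ k
^-pos zero    h = ℤ.+<+ (s≤s z≤n)
^-pos {a} (suc k) h = *-pos {a} {a ^ k} h (^-pos k h)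

-- For R = cK and M = K - j, numer / denom = 1 - (q/(q-1)) cj/n with n = NcK,
-- the quantity compared with (c+1)^{-1/c} in ExceedsBound for the relative weight cj/n.
numer denom : ℕ → ℕ → ℕ → ℕ → ℕ → ℕ
numer q c N R M = ((q ℕ.∸ 1) ℕ.* N ℕ.∸ q) ℕ.* R ℕ.+ c ℕ.* q ℕ.* M
denom q c N R M = (q ℕ.∸ 1) ℕ.* N ℕ.* R

-- Z = α E^b - β v(1-v)^c vanishes at v = 1/(c+1), the critical point of y(1-y^c).
record Estimates {q c : ℕ} (inv : Invariants q c) : Set where
  open Invariants inv
  field
    jd pE pP α β Δ : ℕ
    len-J     : length J ℕ.≤ suc jd
    -- The paddings `pE` and `pP` give both terms of `Z` the same degree in v after homogenisation.
    hd-eq     : pE ℕ.+ b ℕ.* dE ≡ pP ℕ.+ suc c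
    E-nonNeg  : All (0ℤ ℤ.≤_) E′
    J-peak    : hom 1 jd (+ suc c) 1ℤ J ℤ.< 0ℤ
    Z-peak    : + α * ((+ suc c) ^ pE * hom 1 dE (+ suc c) 1ℤ E ^ b) ≡ + β * ((+ suc c) ^ pP * (1ℤ * (+ suc c - 1ℤ) ^ c))

  Z : ℤ → ℤ → ℤ
  Z x y = + α * (x ^ pE * hom 1 dE x y E ^ b) - + β * (x ^ pP * (y * (x - y) ^ c))

  field
    -- The hypothesis reads (c+1) (numer/denom)^c ≤ 1 - 1/δ. With T = R + M, the conclusion is that
    -- J is at least 1/Δ and Z at least 1/(Δδ) at v = M/T.
    in-range  : ∀ (R M δ : ℕ) → 0 ℕ.< R →
      δ ℕ.* (suc c ℕ.* numer q c (suc N′) R M ℕ.^ c) ℕ.+ denom q c (suc N′) R M ℕ.^ c ℕ.≤ δ ℕ.* denom q c (suc N′) R M ℕ.^ c →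
      (+ (R ℕ.+ M)) ^ jd ℤ.≤ + Δ * hom 1 jd (+ (R ℕ.+ M)) (+ M) J ×
      (+ (R ℕ.+ M)) ^ (pP ℕ.+ suc c) ℤ.≤ + (Δ ℕ.* δ) * Z (+ (R ℕ.+ M)) (+ M)

module KernelPositivity {q c : ℕ} .{{c≢0 : ℕ.NonZero c}} (inv : Invariants q c) (est : Estimates inv) where
  open Invariants inv
  open Estimates est
  open KernelVanishing inv using (functional)

  hd = pP ℕ.+ suc c

  factor : ℤ → ℤ → ℤ → ℤ → ℤ
  factor A B x y = A * (x ^ pE * hom 1 dE x y E ^ b) + B * (x ^ pP * (y * (x - y) ^ c))

  degree : ℕ → ℕ
  degree s = (s ℕ.* dE ℕ.+ jd) ℕ.+ hd

  length-factor : ∀ A B → length (scale A (E ⊛^ b) ⊕ scale B (0ℤ ∷ (1-v ⊛^ c))) ℕ.≤ suc hd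
  length-factor A B = length-⊕ (scale A (E ⊛^ b)) (scale B (0ℤ ∷ (1-v ⊛^ c)))
    (ℕₚ.≤-trans (ℕₚ.≤-reflexive (length-scale A (E ⊛^ b))) (ℕₚ.≤-trans (length-⊛^ E b (s≤s len-E))
      (s≤s (ℕₚ.≤-trans (ℕₚ.m≤n+m (b ℕ.* dE) pE) (ℕₚ.≤-reflexive hd-eq)))))
    (ℕₚ.≤-trans (ℕₚ.≤-reflexive (length-scale B (0ℤ ∷ (1-v ⊛^ c)))) (s≤s (ℕₚ.≤-trans (length-⊛^ 1-v c (s≤s (s≤s z≤n)))
      (ℕₚ.≤-trans (s≤s (ℕₚ.≤-reflexive (ℕₚ.*-identityʳ c))) (ℕₚ.m≤n+m (suc c) pP)))))

  length-EJ : ∀ s → length ((E ⊛^ s) ⊛ J) ℕ.≤ suc (s ℕ.* dE ℕ.+ jd)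
  length-EJ s = length-⊛ (E ⊛^ s) J (length-⊛^ E s (s≤s len-E)) len-J

  length-kernel : ∀ s A B → length (kernel s A B) ℕ.≤ suc (degree s)
  length-kernel s A B = length-⊛ ((E ⊛^ s) ⊛ J) (scale A (E ⊛^ b) ⊕ scale B (0ℤ ∷ (1-v ⊛^ c))) (length-EJ s) (length-factor A B)

  hom-factor : ∀ A B x y → hom 1 hd x y (scale A (E ⊛^ b) ⊕ scale B (0ℤ ∷ (1-v ⊛^ c))) ≡ factor A B x y
  hom-factor A B x y = trans (dot-⊕ (w hd) (scale A (E ⊛^ b)) (scale B (0ℤ ∷ (1-v ⊛^ c)))) (cong₂ _+_
      (trans (dot-scale (w hd) A (E ⊛^ b)) (cong (A *_) E-part))
      (trans (dot-scale (w hd) B (0ℤ ∷ (1-v ⊛^ c))) (cong (B *_) P-part)))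
    where
    w : ℕ → ℕ → ℤ
    w n i = x ^ (n ℕ.∸ 1 ℕ.* i) * y ^ (1 ℕ.* i)
    dE≤ : 1 ℕ.* dE ℕ.≤ dE
    dE≤ = ℕₚ.≤-reflexive (ℕₚ.*-identityˡ dE)
    E-part : hom 1 hd x y (E ⊛^ b) ≡ x ^ pE * hom 1 dE x y E ^ b
    E-part = trans (cong (λ n → hom 1 n x y (E ⊛^ b)) (sym hd-eq))
      (trans (hom-pad 1 pE x y (E ⊛^ b) (fits-⊛^ 1 E b (s≤s len-E) dE≤))
        (cong (x ^ pE *_) (hom-⊛^ 1 x y E b (s≤s len-E) dE≤)))
    P-part : hom 1 hd x y (0ℤ ∷ (1-v ⊛^ c)) ≡ x ^ pP * (y * (x - y) ^ c)
    P-part = trans (hom-pad 1 pP x y (0ℤ ∷ (1-v ⊛^ c)) (fits₁ (suc c) (0ℤ ∷ (1-v ⊛^ c)) (s≤s (ℕₚ.≤-trans (length-⊛^ 1-v c (s≤s (s≤s z≤n))) (s≤s (ℕₚ.≤-reflexive (ℕₚ.*-identityʳ c)))))))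
      (cong (x ^ pP *_) (trans (hom-v∷ c x y (1-v ⊛^ c)) (cong (y *_)
        (trans (cong (λ n → hom 1 n x y (1-v ⊛^ c)) (sym (ℕₚ.*-identityʳ c)))
          (trans (hom-⊛^ 1 x y 1-v c (s≤s (s≤s z≤n)) ℕₚ.≤-refl) (cong (_^ c) (hom-1-v x y)))))))

  hom-kernel : ∀ s A B x y → hom 1 (degree s) x y (kernel s A B) ≡ hom 1 dE x y E ^ s * hom 1 jd x y J * factor A B x y
  hom-kernel s A B x y = trans
    (hom-⊛ 1 x y {(E ⊛^ s) ⊛ J} {scale A (E ⊛^ b) ⊕ scale B (0ℤ ∷ (1-v ⊛^ c))} (fits₁ _ ((E ⊛^ s) ⊛ J) (length-EJ s)) (fits₁ _ (scale A (E ⊛^ b) ⊕ scale B (0ℤ ∷ (1-v ⊛^ c))) (length-factor A B)))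
    (cong₂ _*_ (trans (hom-⊛ 1 x y {E ⊛^ s} {J} (fits-⊛^ 1 E s (s≤s len-E) dE≤) (fits₁ jd J len-J)) (cong (_* hom 1 jd x y J) (hom-⊛^ 1 x y E s (s≤s len-E) dE≤)))
      (hom-factor A B x y))
    where
    dE≤ : 1 ℕ.* dE ℕ.≤ dE
    dE≤ = ℕₚ.≤-reflexive (ℕₚ.*-identityˡ dE)

  E≥ : ∀ (T M : ℕ) → (+ T) ^ dE ℤ.≤ hom 1 dE (+ T) (+ M) E
  E≥ T M = ℤₚ.≤-trans (ℤₚ.≤-reflexive (eq ((+ T) ^ dE)))
    (ℤₚ.+-monoʳ-≤ (1ℤ * ((+ T) ^ dE * 1ℤ)) (ℤₚ.≤-trans (ℤₚ.≤-reflexive (sym (dot-* 0ℤ (λ _ → 0ℤ) E′)))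
      (dot-mono E′ E-nonNeg (λ i _ → *-mono-≤-nonNeg {0ℤ} {(+ T) ^ (dE ℕ.∸ 1 ℕ.* suc i)} {0ℤ} {(+ M) ^ (1 ℕ.* suc i)} ℤₚ.≤-refl (^-nonNeg (dE ℕ.∸ 1 ℕ.* suc i) (ℤ.+≤+ z≤n)) ℤₚ.≤-refl (^-nonNeg (1 ℕ.* suc i) (ℤ.+≤+ z≤n))))))
    where
    eq : ∀ a → a ≡ 1ℤ * (a * 1ℤ) + 0ℤ
    eq = solve-∀

  ΣE : ℕ
  ΣE = ∣ dot (λ _ → 1ℤ) E ∣

  E≤ : ∀ (T M : ℕ) → M ℕ.≤ T → hom 1 dE (+ T) (+ M) E ℤ.≤ + ΣE * (+ T) ^ dE
  E≤ T M M≤T = begin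
    hom 1 dE (+ T) (+ M) E               ≤⟨ dot-mono E (ℤ.+≤+ z≤n ∷ E-nonNeg) bound ⟩
    dot (λ _ → (+ T) ^ dE * 1ℤ) E        ≡⟨ dot-* ((+ T) ^ dE) (λ _ → 1ℤ) E ⟩
    (+ T) ^ dE * dot (λ _ → 1ℤ) E        ≤⟨ ℤₚ.*-monoˡ-≤-nonNeg ((+ T) ^ dE) {{ℤ.nonNegative (^-nonNeg dE (ℤ.+≤+ z≤n))}} (i≤+∣i∣ (dot (λ _ → 1ℤ) E)) ⟩
    (+ T) ^ dE * + ΣE                    ≡⟨ ℤₚ.*-comm ((+ T) ^ dE) (+ ΣE) ⟩
    + ΣE * (+ T) ^ dE                    ∎
    where
    open ℤₚ.≤-Reasoning
    i≤+∣i∣ : ∀ i → i ℤ.≤ + ∣ i ∣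
    i≤+∣i∣ (+ n)    = ℤₚ.≤-refl
    i≤+∣i∣ -[1+ n ] = ℤ.-≤+
    bound : ∀ i → i ℕ.< length E → (+ T) ^ (dE ℕ.∸ 1 ℕ.* i) * (+ M) ^ (1 ℕ.* i) ℤ.≤ (+ T) ^ dE * 1ℤ
    bound i i< = begin
      (+ T) ^ (dE ℕ.∸ 1 ℕ.* i) * (+ M) ^ (1 ℕ.* i)
        ≤⟨ ℤₚ.*-monoˡ-≤-nonNeg ((+ T) ^ (dE ℕ.∸ 1 ℕ.* i)) {{ℤ.nonNegative (^-nonNeg (dE ℕ.∸ 1 ℕ.* i) (ℤ.+≤+ z≤n))}} (^-mono-≤ (1 ℕ.* i) (ℤ.+≤+ z≤n) (ℤ.+≤+ M≤T)) ⟩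
      (+ T) ^ (dE ℕ.∸ 1 ℕ.* i) * (+ T) ^ (1 ℕ.* i)
        ≡⟨ trans (sym (ℤₚ.^-distribˡ-+-* (+ T) (dE ℕ.∸ 1 ℕ.* i) (1 ℕ.* i))) (cong ((+ T) ^_) (ℕₚ.m∸n+n≡m (fits₁ dE E (s≤s len-E) i i<))) ⟩
      (+ T) ^ dE
        ≡⟨ ℤₚ.*-identityʳ ((+ T) ^ dE) ⟨
      (+ T) ^ dE * 1ℤ ∎

  module _ (δ : ℕ) where
    -- The factor H is m Z - E^b. It equals -E^b at the peak, where Z = 0. In the range, m Z is at
    -- least `ΣE ^ b + 1` times the top power of T, while E^b is at most `ΣE ^ b` times it, so H is
    -- bounded below by that power.
    m = (ΣE ℕ.^ b ℕ.+ 1) ℕ.* (Δ ℕ.* δ)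
    A B : ℤ
    A = + m * + α - 1ℤ
    B = - (+ m * + β)

    factor-Z : ∀ x y → factor A B x y ≡ + m * Z x y - x ^ pE * hom 1 dE x y E ^ b
    factor-Z x y = eq (+ m) (+ α) (+ β) (x ^ pE * hom 1 dE x y E ^ b) (x ^ pP * (y * (x - y) ^ c))
      where
      eq : ∀ m α β u v → (m * α - 1ℤ) * u + - (m * β) * v ≡ m * (α * u - β * v) - u
      eq = solve-∀

    -- At v = 1/(c+1) both J and H are negative, and E is positive.
    peak-pos : ∀ s → 0ℤ ℤ.< hom 1 (degree s) (+ suc c) 1ℤ (kernel s A B)
    peak-pos s = ℤₚ.<-≤-trans (*-pos {ε ^ s * - j} {(+ suc c) ^ pE * ε ^ b} (*-pos {ε ^ s} { - j} (^-pos s ε>0) (ℤₚ.neg-mono-< J-peak)) (*-pos {(+ suc c) ^ pE} {ε ^ b} (^-pos pE (ℤ.+<+ (s≤s z≤n))) (^-pos b ε>0)))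
      (ℤₚ.≤-reflexive (sym (begin
        hom 1 (degree s) (+ suc c) 1ℤ (kernel s A B)
          ≡⟨ hom-kernel s A B (+ suc c) 1ℤ ⟩
        ε ^ s * j * factor A B (+ suc c) 1ℤ
          ≡⟨ cong (ε ^ s * j *_) (trans (factor-Z (+ suc c) 1ℤ) (cong (λ z → + m * z - (+ suc c) ^ pE * ε ^ b) (ℤₚ.i≡j⇒i-j≡0 Z-peak))) ⟩
        ε ^ s * j * (+ m * 0ℤ - (+ suc c) ^ pE * ε ^ b)
          ≡⟨ eq (ε ^ s) j (+ m) ((+ suc c) ^ pE * ε ^ b) ⟩
        ε ^ s * - j * ((+ suc c) ^ pE * ε ^ b) ∎)))
      where
      open ≡-Reasoning
      ε = hom 1 dE (+ suc c) 1ℤ E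
      j = hom 1 jd (+ suc c) 1ℤ J
      ε>0 : 0ℤ ℤ.< ε
      ε>0 = ℤₚ.<-≤-trans (^-pos dE (ℤ.+<+ (s≤s z≤n))) (E≥ (suc c) 1)
      eq : ∀ e j m u → e * j * (m * 0ℤ - u) ≡ e * - j * u
      eq = solve-∀

    threshold : ℕ → ℕ
    threshold s = (suc c ℕ.^ degree s ℕ.+ Δ) ℕ.* absDot tri (kernel s A B)

    -- Here M/T is exactly 1/(c+1), so the homogenised kernel is K^e times the integer of
    -- `peak-pos`, which is at least 1. This gives the constant D = (c+1)^e.
    extract-peak : ∀ s K → threshold s ℕ.< K → 0ℤ ℤ.< extract (c ℕ.* K) K (kernel s A B)
    extract-peak s K large = extract-pos (kernel s A B) e (c ℕ.* K) K (suc c ℕ.^ e) (length-kernel s A B) lower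
      (ℕₚ.≤-trans (s≤s (ℕₚ.*-monoˡ-≤ (absDot tri (kernel s A B)) (ℕₚ.m≤m+n (suc c ℕ.^ e) Δ))) (ℕₚ.≤-trans large (ℕₚ.m≤n+m K (c ℕ.* K))))
      where
      open ℤₚ.≤-Reasoning
      e = degree s
      T≡ : c ℕ.* K ℕ.+ K ≡ K ℕ.* suc c
      T≡ = eq c K
        where
        eq : ∀ c K → c ℕ.* K ℕ.+ K ≡ K ℕ.* suc c
        eq = ℕSolver.solve-∀
      eq : ∀ a b h → (a * b) * h ≡ b * (a * h)
      eq = solve-∀
      lower : + ((c ℕ.* K ℕ.+ K) ℕ.^ e) ℤ.≤ + (suc c ℕ.^ e) * hom 1 e (+ (c ℕ.* K ℕ.+ K)) (+ K) (kernel s A B)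
      lower = begin
        + ((c ℕ.* K ℕ.+ K) ℕ.^ e)               ≡⟨ trans (pos-^ (c ℕ.* K ℕ.+ K) e) (cong (_^ e) (trans (cong +_ T≡) (ℤₚ.pos-* K (suc c)))) ⟩
        (+ K * + suc c) ^ e                     ≡⟨ ^-distrib-* (+ K) (+ suc c) e ⟩
        (+ K) ^ e * (+ suc c) ^ e               ≡⟨ ℤₚ.*-identityʳ ((+ K) ^ e * (+ suc c) ^ e) ⟨
        (+ K) ^ e * (+ suc c) ^ e * 1ℤ          ≤⟨ ℤₚ.*-monoˡ-≤-nonNeg ((+ K) ^ e * (+ suc c) ^ e) {{ℤ.nonNegative nonneg}} (ℤₚ.i<j⇒suc[i]≤j (peak-pos s)) ⟩
        (+ K) ^ e * (+ suc c) ^ e * hom 1 e (+ suc c) 1ℤ (kernel s A B)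
                                                ≡⟨ eq ((+ K) ^ e) ((+ suc c) ^ e) (hom 1 e (+ suc c) 1ℤ (kernel s A B)) ⟩
        (+ suc c) ^ e * ((+ K) ^ e * hom 1 e (+ suc c) 1ℤ (kernel s A B))
                                                ≡⟨ cong₂ _*_ (pos-^ (suc c) e) (hom-dilate e (+ K) (+ suc c) 1ℤ (kernel s A B) (fits₁ e (kernel s A B) (length-kernel s A B))) ⟨
        + (suc c ℕ.^ e) * hom 1 e (+ K * + suc c) (+ K * 1ℤ) (kernel s A B)
                                                ≡⟨ cong₂ (λ u v → + (suc c ℕ.^ e) * hom 1 e u v (kernel s A B)) (trans (cong +_ T≡) (ℤₚ.pos-* K (suc c))) (sym (ℤₚ.*-identityʳ (+ K))) ⟨
        + (suc c ℕ.^ e) * hom 1 e (+ (c ℕ.* K ℕ.+ K)) (+ K) (kernel s A B) ∎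
        where
        nonneg : 0ℤ ℤ.≤ (+ K) ^ e * (+ suc c) ^ e
        nonneg = *-mono-≤-nonNeg {0ℤ} {(+ K) ^ e} {0ℤ} {(+ suc c) ^ e} ℤₚ.≤-refl (^-nonNeg e (ℤ.+≤+ z≤n)) ℤₚ.≤-refl (^-nonNeg e (ℤ.+≤+ z≤n))

    extract-range : ∀ s R M → threshold s ℕ.< R →
      δ ℕ.* (suc c ℕ.* numer q c (suc N′) R M ℕ.^ c) ℕ.+ denom q c (suc N′) R M ℕ.^ c ℕ.≤ δ ℕ.* denom q c (suc N′) R M ℕ.^ c →
      0ℤ ℤ.< extract R M (kernel s A B)
    extract-range s R M large gap = extract-pos (kernel s A B) e R M Δ (length-kernel s A B) lower
      (ℕₚ.≤-trans (s≤s (ℕₚ.*-monoˡ-≤ (absDot tri (kernel s A B)) (ℕₚ.m≤n+m Δ (suc c ℕ.^ e)))) (ℕₚ.≤-trans large (ℕₚ.m≤m+n R M)))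
      where
      open ℤₚ.≤-Reasoning
      e = degree s
      T = R ℕ.+ M
      ε = hom 1 dE (+ T) (+ M) E
      j = hom 1 jd (+ T) (+ M) J
      z = Z (+ T) (+ M)
      est-J = proj₁ (in-range R M δ (ℕₚ.≤-trans (s≤s z≤n) large) gap)
      est-Z = proj₂ (in-range R M δ (ℕₚ.≤-trans (s≤s z≤n) large) gap)
      T^ : ∀ k → 0ℤ ℤ.≤ (+ T) ^ k
      T^ k = ^-nonNeg k (ℤ.+≤+ z≤n)
      E^b≤ : (+ T) ^ pE * ε ^ b ℤ.≤ + (ΣE ℕ.^ b) * (+ T) ^ hd
      E^b≤ = begin
        (+ T) ^ pE * ε ^ b
          ≤⟨ ℤₚ.*-monoˡ-≤-nonNeg ((+ T) ^ pE) {{ℤ.nonNegative (T^ pE)}} (^-mono-≤ b (ℤₚ.≤-trans (T^ dE) (E≥ T M)) (E≤ T M (ℕₚ.m≤n+m M R))) ⟩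
        (+ T) ^ pE * (+ ΣE * (+ T) ^ dE) ^ b
          ≡⟨ cong ((+ T) ^ pE *_) (trans (^-distrib-* (+ ΣE) ((+ T) ^ dE) b) (cong₂ _*_ (sym (pos-^ ΣE b)) (trans (ℤₚ.^-*-assoc (+ T) dE b) (cong ((+ T) ^_) (ℕₚ.*-comm dE b))))) ⟩
        (+ T) ^ pE * (+ (ΣE ℕ.^ b) * (+ T) ^ (b ℕ.* dE))
          ≡⟨ eq ((+ T) ^ pE) (+ (ΣE ℕ.^ b)) ((+ T) ^ (b ℕ.* dE)) ⟩
        + (ΣE ℕ.^ b) * ((+ T) ^ pE * (+ T) ^ (b ℕ.* dE))
          ≡⟨ cong (+ (ΣE ℕ.^ b) *_) (trans (sym (ℤₚ.^-distribˡ-+-* (+ T) pE (b ℕ.* dE))) (cong ((+ T) ^_) hd-eq)) ⟩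
        + (ΣE ℕ.^ b) * (+ T) ^ hd ∎
        where
        eq : ∀ a b c → a * (b * c) ≡ b * (a * c)
        eq = solve-∀
      factor≥ : (+ T) ^ hd ℤ.≤ factor A B (+ T) (+ M)
      factor≥ = begin
        (+ T) ^ hd
          ≡⟨ eq₁ (+ (ΣE ℕ.^ b)) ((+ T) ^ hd) ⟩
        (+ (ΣE ℕ.^ b) + 1ℤ) * (+ T) ^ hd - + (ΣE ℕ.^ b) * (+ T) ^ hd
          ≤⟨ ℤₚ.+-mono-≤ (ℤₚ.*-monoˡ-≤-nonNeg (+ (ΣE ℕ.^ b) + 1ℤ) est-Z) (ℤₚ.neg-mono-≤ E^b≤) ⟩
        (+ (ΣE ℕ.^ b) + 1ℤ) * (+ (Δ ℕ.* δ) * z) - (+ T) ^ pE * ε ^ b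
          ≡⟨ cong (_- (+ T) ^ pE * ε ^ b) (trans (sym (ℤₚ.*-assoc (+ (ΣE ℕ.^ b) + 1ℤ) (+ (Δ ℕ.* δ)) z)) (cong (_* z) (sym (ℤₚ.pos-* (ΣE ℕ.^ b ℕ.+ 1) (Δ ℕ.* δ))))) ⟩
        + m * z - (+ T) ^ pE * ε ^ b
          ≡⟨ factor-Z (+ T) (+ M) ⟨
        factor A B (+ T) (+ M) ∎
        where
        eq₁ : ∀ a t → t ≡ (a + 1ℤ) * t - a * t
        eq₁ = solve-∀
      lower : + (T ℕ.^ e) ℤ.≤ + Δ * hom 1 e (+ T) (+ M) (kernel s A B)
      lower = begin
        + (T ℕ.^ e)                                                ≡⟨ pos-^ T e ⟩
        (+ T) ^ e                                                  ≡⟨ trans (ℤₚ.^-distribˡ-+-* (+ T) (s ℕ.* dE ℕ.+ jd) hd) (cong (_* (+ T) ^ hd) (ℤₚ.^-distribˡ-+-* (+ T) (s ℕ.* dE) jd)) ⟩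
        (+ T) ^ (s ℕ.* dE) * (+ T) ^ jd * (+ T) ^ hd
          ≤⟨ *-mono-≤-nonNeg {(+ T) ^ (s ℕ.* dE) * (+ T) ^ jd} {ε ^ s * (+ Δ * j)} {(+ T) ^ hd} {factor A B (+ T) (+ M)}
               (*-mono-≤-nonNeg {0ℤ} {(+ T) ^ (s ℕ.* dE)} {0ℤ} {(+ T) ^ jd} ℤₚ.≤-refl (T^ (s ℕ.* dE)) ℤₚ.≤-refl (T^ jd))
               (*-mono-≤-nonNeg {(+ T) ^ (s ℕ.* dE)} {ε ^ s} {(+ T) ^ jd} {+ Δ * j} (T^ (s ℕ.* dE)) E^s≥ (T^ jd) est-J) (T^ hd) factor≥ ⟩
        ε ^ s * (+ Δ * j) * factor A B (+ T) (+ M)                 ≡⟨ eq₂ (ε ^ s) (+ Δ) j (factor A B (+ T) (+ M)) ⟩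
        + Δ * (ε ^ s * j * factor A B (+ T) (+ M))                 ≡⟨ cong (+ Δ *_) (hom-kernel s A B (+ T) (+ M)) ⟨
        + Δ * hom 1 e (+ T) (+ M) (kernel s A B)                   ∎
        where
        eq₂ : ∀ e d j f → e * (d * j) * f ≡ d * (e * j * f)
        eq₂ = solve-∀
        E^s≥ : (+ T) ^ (s ℕ.* dE) ℤ.≤ ε ^ s
        E^s≥ = ℤₚ.≤-trans (ℤₚ.≤-reflexive (trans (cong ((+ T) ^_) (ℕₚ.*-comm s dE)) (sym (ℤₚ.^-*-assoc (+ T) dE s)))) (^-mono-≤ s (T^ dE) (E≥ T M))

    functional-extract : ∀ s K j → j ℕ.≤ K → functional s A B K j ≡ extract (c ℕ.* K) (K ℕ.∸ j) (kernel s A B)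
    functional-extract s K j j≤K = dot-cong (kernel s A B) (λ k → cong +_
      (trans (cong (λ L → coeff (c ℕ.* K) L (j ℕ.+ k)) (sym (ℕₚ.m+[n∸m]≡n j≤K))) (coeff-shift (c ℕ.* K) j (K ℕ.∸ j) k)))

    functional-beyond : ∀ s K j → K ℕ.< j → functional s A B K j ≡ 0ℤ
    functional-beyond s K j K<j = trans (dot-cong (kernel s A B) (λ k → cong +_ (coeff-beyond (c ℕ.* K) (ℕₚ.≤-trans K<j (ℕₚ.m≤m+n j k)))))
      (dot-* 0ℤ (λ _ → 0ℤ) (kernel s A B))

-- Weight enumerators as polynomials in v = (y/x)^c

wt≤n : ∀ {q n} (u : Word q n) → wt u ℕ.≤ n
wt≤n []              = z≤n
wt≤n (Fin.zero ∷ u)  = ℕₚ.m≤n⇒m≤1+n (wt≤n u)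
wt≤n (Fin.suc _ ∷ u) = s≤s (wt≤n u)

dist-zero-word : ∀ {q n} (u z : Word q n) → wt z ≡ 0 → dist u z ≡ wt u
dist-zero-word []              []             e = refl
dist-zero-word (Fin.zero ∷ u)  (Fin.zero ∷ z) e = dist-zero-word u z e
dist-zero-word (Fin.suc a ∷ u) (Fin.zero ∷ z) e = cong suc (dist-zero-word u z e)

foldr-⊓≤ : ∀ {m k xs} → k ∈ xs → foldr ℕ._⊓_ m xs ℕ.≤ k
foldr-⊓≤ {xs = x ∷ xs} (here refl) = ℕₚ.m⊓n≤m x _
foldr-⊓≤ {xs = x ∷ xs} (there k∈)  = ℕₚ.≤-trans (ℕₚ.m⊓n≤n x _) (foldr-⊓≤ k∈)

-- Names the local function in the definition of pairDists.
pairDists-unfold : ∀ {q n} (us vs : List (Word q n)) →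
  ∃ λ (F : Word q n → Word q n → List ℕ) → pairDists us vs ≡ concatMap (λ u → concatMap (λ v → F u v) vs) us
pairDists-unfold us vs = _ , refl

dist∈pairDists : ∀ {q n} {u v : Word q n} us vs → u ∈ us → v ∈ vs → u ≢ v → dist u v ∈ pairDists us vs
dist∈pairDists {q} {n} {u} {v} us vs u∈ v∈ u≢v = ∈-concatMap⁺ _ (Any.map (λ { refl → ∈-concatMap⁺ _ (Any.map (λ { refl → inner }) v∈) }) u∈)
  where
  inner : dist u v ∈ proj₁ (pairDists-unfold us vs) u v
  inner with ≡-dec _≟_ u v
  ... | yes u≡v = ⊥-elim (u≢v u≡v)
  ... | no  _   = here refl

d≤wt : ∀ {q n} (C : Code q n) {u z} → z ∈ words C → wt z ≡ 0 → u ∈ words C → wt u ≢ 0 → d C ℕ.≤ wt u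
d≤wt C {u} {z} z∈ wt-z u∈ wt-u = ℕₚ.≤-trans
  (foldr-⊓≤ (dist∈pairDists (words C) (words C) u∈ z∈ (λ { refl → wt-u wt-z })))
  (ℕₚ.≤-reflexive (dist-zero-word u z wt-z))

sumOver : ∀ {A : Set} → (A → ℤ) → List A → ℤ
sumOver f []       = 0ℤ
sumOver f (x ∷ xs) = f x + sumOver f xs

sumOver-nonNeg : ∀ {A : Set} {f : A → ℤ} xs → (∀ {x} → x ∈ xs → 0ℤ ℤ.≤ f x) → 0ℤ ℤ.≤ sumOver f xs
sumOver-nonNeg []       h = ℤₚ.≤-refl
sumOver-nonNeg (x ∷ xs) h = ℤₚ.+-mono-≤ (h (here refl)) (sumOver-nonNeg xs (λ x∈ → h (there x∈)))

sumOver-pos : ∀ {A : Set} {f : A → ℤ} {z} xs → (∀ {x} → x ∈ xs → 0ℤ ℤ.≤ f x) → z ∈ xs → 0ℤ ℤ.< f z → 0ℤ ℤ.< sumOver f xs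
sumOver-pos (x ∷ xs) h (here refl) pos = ℤₚ.+-mono-<-≤ pos (sumOver-nonNeg xs (λ x∈ → h (there x∈)))
sumOver-pos (x ∷ xs) h (there z∈)  pos = ℤₚ.+-mono-≤-< (h (here refl)) (sumOver-pos xs (λ x∈ → h (there x∈)) z∈ pos)

sumOver-one : ∀ {A : Set} {f : A → ℤ} xs → (∀ x → f x ≡ 1ℤ) → sumOver f xs ≡ + length xs
sumOver-one []       h = refl
sumOver-one (x ∷ xs) h = cong₂ _+_ (h x) (sumOver-one xs h)

W-sum : ∀ {q n} (C : Code q n) x y → W C x y ≡ sumOver (λ u → x ^ (n ℕ.∸ wt u) * y ^ wt u) (words C)
W-sum {q} {n} C x y = go (words C)
  where
  go : ∀ us → foldr _+_ 0ℤ (map (λ u → x ^ (n ℕ.∸ wt u) * y ^ wt u) us) ≡ sumOver (λ u → x ^ (n ℕ.∸ wt u) * y ^ wt u) us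
  go []       = refl
  go (u ∷ us) = cong (_+_ (x ^ (n ℕ.∸ wt u) * y ^ wt u)) (go us)

monomial : ℕ → Poly
monomial zero    = 1ℤ ∷ []
monomial (suc j) = 0ℤ ∷ monomial j

dot-monomial : ∀ e j → dot e (monomial j) ≡ e j
dot-monomial e zero    = trans (ℤₚ.+-identityʳ (1ℤ * e 0)) (ℤₚ.*-identityˡ (e 0))
dot-monomial e (suc j) = trans (ℤₚ.+-identityˡ (dot (e ∘ suc) (monomial j))) (dot-monomial (e ∘ suc) j)

length-monomial : ∀ j → length (monomial j) ≡ suc j
length-monomial zero    = refl
length-monomial (suc j) = cong suc (length-monomial j)

module Enumerator {q n : ℕ} (c : ℕ) .{{c≢0 : ℕ.NonZero c}} (C : Code q n) where
  enumerate : List (Word q n) → Poly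
  enumerate []       = []
  enumerate (u ∷ us) = monomial (wt u DivMod./ c) ⊕ enumerate us

  dot-enumerate : ∀ e us → dot e (enumerate us) ≡ sumOver (λ u → e (wt u DivMod./ c)) us
  dot-enumerate e []       = refl
  dot-enumerate e (u ∷ us) = trans (dot-⊕ e (monomial (wt u DivMod./ c)) (enumerate us))
    (cong₂ _+_ (dot-monomial e (wt u DivMod./ c)) (dot-enumerate e us))

  length-enumerate : ∀ us → length (enumerate us) ℕ.≤ suc (n DivMod./ c)
  length-enumerate []       = z≤n
  length-enumerate (u ∷ us) = length-⊕ (monomial (wt u DivMod./ c)) (enumerate us)
    (ℕₚ.≤-trans (ℕₚ.≤-reflexive (length-monomial (wt u DivMod./ c))) (s≤s (DivMod./-monoˡ-≤ c (wt≤n u)))) (length-enumerate us)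

  f : Poly
  f = enumerate (words C)

  module _ (c∣wt : WeightsDivisibleBy c C) where
    hom-f : ∀ x y → hom c n x y f ≡ W C x y
    hom-f x y = trans (dot-enumerate (λ j → x ^ (n ℕ.∸ c ℕ.* j) * y ^ (c ℕ.* j)) (words C)) (trans (go (words C) c∣wt) (sym (W-sum C x y)))
      where
      go : ∀ us → All (λ u → c ∣ wt u) us →
        sumOver (λ u → x ^ (n ℕ.∸ c ℕ.* (wt u DivMod./ c)) * y ^ (c ℕ.* (wt u DivMod./ c))) us ≡ sumOver (λ u → x ^ (n ℕ.∸ wt u) * y ^ wt u) us
      go []       []       = refl
      go (u ∷ us) (h ∷ hs) = cong₂ _+_ (cong (λ w → x ^ (n ℕ.∸ w) * y ^ w) (trans (ℕₚ.*-comm c (wt u DivMod./ c)) (DivMod.m/n*n≡m h))) (go us hs)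

size-pos : ∀ {q n} (C : Code q n) → 2 ℕ.≤ q → FormallySelfDual C → 0 ℕ.< size C
size-pos {q} {n} C q≥2 (s² , _) with size C
... | zero  = ⊥-elim (ℕₚ.<-irrefl s² (ℕₚ.m^n>0 q {{ℕ.>-nonZero (ℕₚ.≤-trans (s≤s z≤n) q≥2)}} n))
... | suc _ = s≤s z≤n

W-1-1 : ∀ {q n} (C : Code q n) → W C 1ℤ 1ℤ ≡ + size C
W-1-1 {n = n} C = trans (W-sum C 1ℤ 1ℤ) (sumOver-one (words C) (λ u → cong₂ _*_ (ℤₚ.^-zeroˡ (n ℕ.∸ wt u)) (ℤₚ.^-zeroˡ (wt u))))

-- W_C(1,0) counts the words of weight 0, and the MacWilliams identity at (1,0) reads |C| W_C(1,0) =
-- W_C(1,1) = |C|.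
zero-word : ∀ {q n} (C : Code q n) → 2 ℕ.≤ q → FormallySelfDual C → ∃ λ z → z ∈ words C × wt z ≡ 0
zero-word {q} {n} C q≥2 fsd@(_ , mac) = find (words C) (λ e → 1≢0 (trans (sym W≡1) (trans (W-sum C 1ℤ 0ℤ) e)))
  where
  1≢0 : 1ℤ ≢ 0ℤ
  1≢0 ()
  W≡1 : W C 1ℤ 0ℤ ≡ 1ℤ
  W≡1 = ℤₚ.*-cancelˡ-≡ (+ size C) (W C 1ℤ 0ℤ) 1ℤ {{ℕ.>-nonZero (size-pos C q≥2 fsd)}}
    (trans (mac 1ℤ 0ℤ) (trans (cong (λ u → W C u 1ℤ) (eq (+ (q ℕ.∸ 1)))) (trans (W-1-1 C) (sym (ℤₚ.*-identityʳ (+ size C))))))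
    where
    eq : ∀ r → 1ℤ + r * 0ℤ ≡ 1ℤ
    eq = solve-∀
  find : ∀ us → sumOver (λ u → 1ℤ ^ (n ℕ.∸ wt u) * 0ℤ ^ wt u) us ≢ 0ℤ → ∃ λ z → z ∈ us × wt z ≡ 0
  find []       h = ⊥-elim (h refl)
  find (u ∷ us) h with wt u in eq
  ... | zero  = u , here refl , eq
  ... | suc k with find us (λ e → h (cong₂ _+_ (ℤₚ.*-zeroʳ (1ℤ ^ (n ℕ.∸ suc k))) e))
  ...   | z , z∈ , wt-z = z , there z∈ , wt-z

-- From strict inequality to a uniform gap, and the limsup bound

ℕ-^-distrib-* : ∀ a b k → (a ℕ.* b) ℕ.^ k ≡ a ℕ.^ k ℕ.* b ℕ.^ k
ℕ-^-distrib-* a b k = ℤₚ.+-injective (trans (pos-^ (a ℕ.* b) k) (trans (cong (_^ k) (ℤₚ.pos-* a b)) (trans (^-distrib-* (+ a) (+ b) k)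
  (sym (trans (ℤₚ.pos-* (a ℕ.^ k) (b ℕ.^ k)) (cong₂ _*_ (pos-^ a k) (pos-^ b k)))))))

-- (Xw + 1)^k exceeds (Xw)^k by O(X^(k-1)); both sides carry a factor X to avoid the exponent k - 1.
suc-^-bound : ∀ w k → ∃ λ S → ∀ X → 1 ℕ.≤ X → X ℕ.* (X ℕ.* w ℕ.+ 1) ℕ.^ k ℕ.≤ X ℕ.* (X ℕ.* w) ℕ.^ k ℕ.+ S ℕ.* X ℕ.^ k
suc-^-bound w zero    = 0 , λ X _ → ℕₚ.m≤m+n _ _
suc-^-bound w (suc k) with suc-^-bound w k
... | S , h = w ℕ.^ k ℕ.+ S ℕ.* (w ℕ.+ 1) , λ X X≥1 → begin
  X ℕ.* ((X ℕ.* w ℕ.+ 1) ℕ.* (X ℕ.* w ℕ.+ 1) ℕ.^ k)                        ≡⟨ eq₁ X (X ℕ.* w ℕ.+ 1) _ ⟩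
  (X ℕ.* w ℕ.+ 1) ℕ.* (X ℕ.* (X ℕ.* w ℕ.+ 1) ℕ.^ k)                        ≤⟨ ℕₚ.*-monoʳ-≤ (X ℕ.* w ℕ.+ 1) (h X X≥1) ⟩
  (X ℕ.* w ℕ.+ 1) ℕ.* (X ℕ.* (X ℕ.* w) ℕ.^ k ℕ.+ S ℕ.* X ℕ.^ k)            ≡⟨ eq₂ X w ((X ℕ.* w) ℕ.^ k) S (X ℕ.^ k) ⟩
  X ℕ.* (X ℕ.* w ℕ.* (X ℕ.* w) ℕ.^ k) ℕ.+ (X ℕ.* (X ℕ.* w) ℕ.^ k ℕ.+ S ℕ.* (X ℕ.* w ℕ.+ 1) ℕ.* X ℕ.^ k)
    ≤⟨ ℕₚ.+-monoʳ-≤ (X ℕ.* (X ℕ.* w ℕ.* (X ℕ.* w) ℕ.^ k)) (ℕₚ.+-mono-≤ (ℕₚ.≤-reflexive (cong (X ℕ.*_) (ℕ-^-distrib-* X w k)))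
         (ℕₚ.*-monoˡ-≤ (X ℕ.^ k) (ℕₚ.*-monoʳ-≤ S (ℕₚ.+-monoʳ-≤ (X ℕ.* w) X≥1)))) ⟩
  X ℕ.* (X ℕ.* w ℕ.* (X ℕ.* w) ℕ.^ k) ℕ.+ (X ℕ.* (X ℕ.^ k ℕ.* w ℕ.^ k) ℕ.+ S ℕ.* (X ℕ.* w ℕ.+ X) ℕ.* X ℕ.^ k)
    ≡⟨ eq₃ (X ℕ.* (X ℕ.* w ℕ.* (X ℕ.* w) ℕ.^ k)) X (X ℕ.^ k) (w ℕ.^ k) S w ⟩
  X ℕ.* (X ℕ.* w ℕ.* (X ℕ.* w) ℕ.^ k) ℕ.+ (w ℕ.^ k ℕ.+ S ℕ.* (w ℕ.+ 1)) ℕ.* (X ℕ.* X ℕ.^ k) ∎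
  where
  open ℕₚ.≤-Reasoning
  eq₁ : ∀ a b c → a ℕ.* (b ℕ.* c) ≡ b ℕ.* (a ℕ.* c)
  eq₁ = ℕSolver.solve-∀
  eq₂ : ∀ X w p S t → (X ℕ.* w ℕ.+ 1) ℕ.* (X ℕ.* p ℕ.+ S ℕ.* t) ≡ X ℕ.* (X ℕ.* w ℕ.* p) ℕ.+ (X ℕ.* p ℕ.+ S ℕ.* (X ℕ.* w ℕ.+ 1) ℕ.* t)
  eq₂ = ℕSolver.solve-∀
  eq₃ : ∀ u X t v S w → u ℕ.+ (X ℕ.* (t ℕ.* v) ℕ.+ S ℕ.* (X ℕ.* w ℕ.+ X) ℕ.* t) ≡ u ℕ.+ (v ℕ.+ S ℕ.* (w ℕ.+ 1)) ℕ.* (X ℕ.* t)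
  eq₃ = ℕSolver.solve-∀

-- Replaces w by w + 1/X. A strict inequality between integers leaves room 1, hence X^k after
-- scaling, and X = m S + 1 makes the error m S X^(k-1) smaller than that.
strict-slack : ∀ m w W k → m ℕ.* w ℕ.^ k ℕ.< W ℕ.^ k → ∃ λ X → 1 ℕ.≤ X × m ℕ.* (X ℕ.* w ℕ.+ 1) ℕ.^ k ℕ.< (X ℕ.* W) ℕ.^ k
strict-slack m w W k h with suc-^-bound w k
... | S , hS = X , s≤s z≤n , ℕₚ.*-cancelˡ-< X _ _ (begin-strict
  X ℕ.* (m ℕ.* (X ℕ.* w ℕ.+ 1) ℕ.^ k)                        ≡⟨ eq₁ X m _ ⟩
  m ℕ.* (X ℕ.* (X ℕ.* w ℕ.+ 1) ℕ.^ k)                        ≤⟨ ℕₚ.*-monoʳ-≤ m (hS X (s≤s z≤n)) ⟩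
  m ℕ.* (X ℕ.* (X ℕ.* w) ℕ.^ k ℕ.+ S ℕ.* X ℕ.^ k)            ≡⟨ cong (λ u → m ℕ.* (X ℕ.* u ℕ.+ S ℕ.* X ℕ.^ k)) (ℕ-^-distrib-* X w k) ⟩
  m ℕ.* (X ℕ.* (X ℕ.^ k ℕ.* w ℕ.^ k) ℕ.+ S ℕ.* X ℕ.^ k)      ≡⟨ eq₂ m X (X ℕ.^ k) (w ℕ.^ k) S ⟩
  X ℕ.* X ℕ.^ k ℕ.* (m ℕ.* w ℕ.^ k) ℕ.+ m ℕ.* S ℕ.* X ℕ.^ k  <⟨ ℕₚ.+-monoʳ-< (X ℕ.* X ℕ.^ k ℕ.* (m ℕ.* w ℕ.^ k)) (ℕₚ.*-monoˡ-< (X ℕ.^ k) {{ℕ.>-nonZero (ℕₚ.m^n>0 X k)}} (ℕₚ.n<1+n (m ℕ.* S))) ⟩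
  X ℕ.* X ℕ.^ k ℕ.* (m ℕ.* w ℕ.^ k) ℕ.+ X ℕ.* X ℕ.^ k        ≡⟨ eq₃ (X ℕ.* X ℕ.^ k) (m ℕ.* w ℕ.^ k) ⟩
  X ℕ.* X ℕ.^ k ℕ.* suc (m ℕ.* w ℕ.^ k)                      ≤⟨ ℕₚ.*-monoʳ-≤ (X ℕ.* X ℕ.^ k) h ⟩
  X ℕ.* X ℕ.^ k ℕ.* W ℕ.^ k                                  ≡⟨ trans (ℕₚ.*-assoc X (X ℕ.^ k) (W ℕ.^ k)) (cong (X ℕ.*_) (sym (ℕ-^-distrib-* X W k))) ⟩
  X ℕ.* (X ℕ.* W) ℕ.^ k                                      ∎)
  where
  open ℕₚ.≤-Reasoning
  X = suc (m ℕ.* S)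
  eq₁ : ∀ a b c → a ℕ.* (b ℕ.* c) ≡ b ℕ.* (a ℕ.* c)
  eq₁ = ℕSolver.solve-∀
  eq₂ : ∀ m X t w S → m ℕ.* (X ℕ.* (t ℕ.* w) ℕ.+ S ℕ.* t) ≡ X ℕ.* t ℕ.* (m ℕ.* w) ℕ.+ m ℕ.* S ℕ.* t
  eq₂ = ℕSolver.solve-∀
  eq₃ : ∀ t u → t ℕ.* u ℕ.+ t ≡ t ℕ.* suc u
  eq₃ = ℕSolver.solve-∀

sumBelow : (ℕ → ℕ) → ℕ → ℕ
sumBelow f zero    = 0
sumBelow f (suc b) = f b ℕ.+ sumBelow f b

≤sumBelow : ∀ f {s b} → s ℕ.< b → f s ℕ.≤ sumBelow f b
≤sumBelow f {s} {suc b} (s≤s s≤b) with ℕₚ.m≤n⇒m<n∨m≡n s≤b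
... | inj₁ s<b  = ℕₚ.≤-trans (≤sumBelow f s<b) (ℕₚ.m≤n+m _ (f b))
... | inj₂ refl = ℕₚ.m≤m+n (f s) _

-- Up to the shift 2aN that comes from rounding n to N c K, the weight cj has relative size at least
-- a/b₀, so numer/denom is at most Wa/Wb plus an error that 1/X absorbs for large K. In `slack` the
-- two sides are integers, so after division by δ they differ by at least 1/δ, which is the required
-- gap.
gap-in-range : ∀ q c N a b₀ X K j → 2 ℕ.≤ q → 2 ℕ.≤ N → 1 ℕ.≤ b₀ → 1 ℕ.≤ X →
  let Wa = b₀ ℕ.* (q ℕ.∸ 1) ℕ.∸ a ℕ.* q ; Wb = b₀ ℕ.* (q ℕ.∸ 1) ; δ = (X ℕ.* Wb) ℕ.^ c in
  suc c ℕ.* (X ℕ.* Wa ℕ.+ 1) ℕ.^ c ℕ.< δ →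
  j ℕ.≤ K → a ℕ.* N ℕ.* K ℕ.≤ b₀ ℕ.* j ℕ.+ 2 ℕ.* (a ℕ.* N) → 2 ℕ.* a ℕ.* q ℕ.* X ℕ.≤ K →
  δ ℕ.* (suc c ℕ.* numer q c N (c ℕ.* K) (K ℕ.∸ j) ℕ.^ c) ℕ.+ denom q c N (c ℕ.* K) (K ℕ.∸ j) ℕ.^ c
    ℕ.≤ δ ℕ.* denom q c N (c ℕ.* K) (K ℕ.∸ j) ℕ.^ c
gap-in-range q@(suc (suc q″)) c N@(suc (suc N″)) a b₀ X K j (s≤s (s≤s _)) N≥2@(s≤s (s≤s _)) b₀≥1 X≥1 slack j≤K far large =
  ℕₚ.*-cancelˡ-≤ (Y ℕ.^ c) {{ℕ.>-nonZero (ℕₚ.m^n>0 Y {{ℕ.>-nonZero (ℕₚ.*-mono-≤ X≥1 b₀≥1)}} c)}} (begin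
    Y ℕ.^ c ℕ.* (δ ℕ.* (suc c ℕ.* n₁ ℕ.^ c) ℕ.+ d₁ ℕ.^ c)                ≡⟨ eq₁ (Y ℕ.^ c) δ (suc c) (n₁ ℕ.^ c) (d₁ ℕ.^ c) ⟩
    δ ℕ.* (suc c ℕ.* (Y ℕ.^ c ℕ.* n₁ ℕ.^ c)) ℕ.+ Y ℕ.^ c ℕ.* d₁ ℕ.^ c    ≡⟨ cong₂ (λ u v → δ ℕ.* (suc c ℕ.* u) ℕ.+ v) (sym (ℕ-^-distrib-* Y n₁ c)) Yd₁ ⟩
    δ ℕ.* (suc c ℕ.* (Y ℕ.* n₁) ℕ.^ c) ℕ.+ δ ℕ.* G                        ≤⟨ ℕₚ.+-monoˡ-≤ (δ ℕ.* G) (ℕₚ.*-monoʳ-≤ δ (ℕₚ.*-monoʳ-≤ (suc c) Yn₁^)) ⟩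
    δ ℕ.* (suc c ℕ.* (w ℕ.^ c ℕ.* G)) ℕ.+ δ ℕ.* G                         ≡⟨ eq₂ δ (suc c) (w ℕ.^ c) G ⟩
    δ ℕ.* (suc (suc c ℕ.* w ℕ.^ c) ℕ.* G)                                 ≤⟨ ℕₚ.*-monoʳ-≤ δ (ℕₚ.*-monoˡ-≤ G slack) ⟩
    δ ℕ.* (δ ℕ.* G)                                                       ≡⟨ cong (δ ℕ.*_) (sym Yd₁) ⟩
    δ ℕ.* (Y ℕ.^ c ℕ.* d₁ ℕ.^ c)                                          ≡⟨ eq₃ δ (Y ℕ.^ c) (d₁ ℕ.^ c) ⟩
    Y ℕ.^ c ℕ.* (δ ℕ.* d₁ ℕ.^ c)                                          ∎)
  where
  open ℕₚ.≤-Reasoning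
  Wa = b₀ ℕ.* (q ℕ.∸ 1) ℕ.∸ a ℕ.* q
  Wb = b₀ ℕ.* (q ℕ.∸ 1)
  δ = (X ℕ.* Wb) ℕ.^ c
  Y = X ℕ.* b₀
  w = X ℕ.* Wa ℕ.+ 1
  G = (c ℕ.* N ℕ.* K) ℕ.^ c
  M = K ℕ.∸ j
  n₁ = numer q c N (c ℕ.* K) M
  d₁ = denom q c N (c ℕ.* K) M
  eq₁ : ∀ y δ s n d → y ℕ.* (δ ℕ.* (s ℕ.* n) ℕ.+ d) ≡ δ ℕ.* (s ℕ.* (y ℕ.* n)) ℕ.+ y ℕ.* d
  eq₁ = ℕSolver.solve-∀
  eq₂ : ∀ δ s w g → δ ℕ.* (s ℕ.* (w ℕ.* g)) ℕ.+ δ ℕ.* g ≡ δ ℕ.* (suc (s ℕ.* w) ℕ.* g)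
  eq₂ = ℕSolver.solve-∀
  eq₃ : ∀ a b c → a ℕ.* (b ℕ.* c) ≡ b ℕ.* (a ℕ.* c)
  eq₃ = ℕSolver.solve-∀
  Yd₁ : Y ℕ.^ c ℕ.* d₁ ℕ.^ c ≡ δ ℕ.* G
  Yd₁ = trans (sym (ℕ-^-distrib-* Y d₁ c)) (trans (cong (ℕ._^ c) (eq X b₀ (suc q″) N c K)) (ℕ-^-distrib-* (X ℕ.* Wb) (c ℕ.* N ℕ.* K) c))
    where
    eq : ∀ X b q N c K → X ℕ.* b ℕ.* (q ℕ.* N ℕ.* (c ℕ.* K)) ≡ X ℕ.* (b ℕ.* q) ℕ.* (c ℕ.* N ℕ.* K)
    eq = ℕSolver.solve-∀
  q≤ : q ℕ.≤ suc q″ ℕ.* N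
  q≤ = ℕₚ.≤-trans (ℕₚ.≤-reflexive (ℕₚ.+-comm 1 (suc q″))) (ℕₚ.≤-trans (ℕₚ.+-monoʳ-≤ (suc q″) (s≤s (z≤n {q″})))
    (ℕₚ.≤-trans (ℕₚ.≤-reflexive (eq (suc q″))) (ℕₚ.*-monoʳ-≤ (suc q″) N≥2)))
    where
    eq : ∀ q → q ℕ.+ q ≡ q ℕ.* 2
    eq = ℕSolver.solve-∀
  n₁+ : n₁ ℕ.+ c ℕ.* q ℕ.* j ≡ suc q″ ℕ.* N ℕ.* (c ℕ.* K)
  n₁+ = trans (eq r (c ℕ.* K) c q M j) (trans (cong (λ k → r ℕ.* (c ℕ.* K) ℕ.+ c ℕ.* q ℕ.* k) (ℕₚ.m∸n+n≡m j≤K))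
    (trans (eq′ r c K q) (cong (ℕ._* (c ℕ.* K)) (ℕₚ.m∸n+n≡m q≤))))
    where
    r = suc q″ ℕ.* N ℕ.∸ q
    eq : ∀ r R c q M j → r ℕ.* R ℕ.+ c ℕ.* q ℕ.* M ℕ.+ c ℕ.* q ℕ.* j ≡ r ℕ.* R ℕ.+ c ℕ.* q ℕ.* (M ℕ.+ j)
    eq = ℕSolver.solve-∀
    eq′ : ∀ r c K q → r ℕ.* (c ℕ.* K) ℕ.+ c ℕ.* q ℕ.* K ≡ (r ℕ.+ q) ℕ.* (c ℕ.* K)
    eq′ = ℕSolver.solve-∀
  Yn₁ : Y ℕ.* n₁ ℕ.≤ w ℕ.* (c ℕ.* N ℕ.* K)
  Yn₁ = ℕₚ.+-cancelʳ-≤ (X ℕ.* b₀ ℕ.* (c ℕ.* q ℕ.* j)) _ _ (begin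
    Y ℕ.* n₁ ℕ.+ X ℕ.* b₀ ℕ.* (c ℕ.* q ℕ.* j)               ≡⟨ trans (sym (ℕₚ.*-distribˡ-+ Y n₁ (c ℕ.* q ℕ.* j))) (cong (Y ℕ.*_) n₁+) ⟩
    Y ℕ.* (suc q″ ℕ.* N ℕ.* (c ℕ.* K))                      ≡⟨ e₁ X b₀ (suc q″) N c K ⟩
    -- This direction survives truncation: if aq exceeds Wb, then Wa = 0.
    X ℕ.* (c ℕ.* N ℕ.* K) ℕ.* Wb                            ≤⟨ ℕₚ.*-monoʳ-≤ (X ℕ.* (c ℕ.* N ℕ.* K)) (ℕₚ.m≤n+m∸n Wb (a ℕ.* q)) ⟩
    X ℕ.* (c ℕ.* N ℕ.* K) ℕ.* (a ℕ.* q ℕ.+ Wa)              ≡⟨ e₂ X c N K a q Wa ⟩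
    X ℕ.* Wa ℕ.* (c ℕ.* N ℕ.* K) ℕ.+ X ℕ.* c ℕ.* q ℕ.* (a ℕ.* N ℕ.* K)
      ≤⟨ ℕₚ.+-monoʳ-≤ (X ℕ.* Wa ℕ.* (c ℕ.* N ℕ.* K)) (ℕₚ.*-monoʳ-≤ (X ℕ.* c ℕ.* q) far) ⟩
    X ℕ.* Wa ℕ.* (c ℕ.* N ℕ.* K) ℕ.+ X ℕ.* c ℕ.* q ℕ.* (b₀ ℕ.* j ℕ.+ 2 ℕ.* (a ℕ.* N))
      ≡⟨ e₃ X Wa (c ℕ.* N ℕ.* K) c q b₀ j a N ⟩
    X ℕ.* Wa ℕ.* (c ℕ.* N ℕ.* K) ℕ.+ c ℕ.* N ℕ.* (2 ℕ.* a ℕ.* q ℕ.* X) ℕ.+ X ℕ.* b₀ ℕ.* (c ℕ.* q ℕ.* j)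
      ≤⟨ ℕₚ.+-monoˡ-≤ (X ℕ.* b₀ ℕ.* (c ℕ.* q ℕ.* j)) (ℕₚ.+-monoʳ-≤ (X ℕ.* Wa ℕ.* (c ℕ.* N ℕ.* K)) (ℕₚ.*-monoʳ-≤ (c ℕ.* N) large)) ⟩
    X ℕ.* Wa ℕ.* (c ℕ.* N ℕ.* K) ℕ.+ c ℕ.* N ℕ.* K ℕ.+ X ℕ.* b₀ ℕ.* (c ℕ.* q ℕ.* j)
      ≡⟨ cong (ℕ._+ X ℕ.* b₀ ℕ.* (c ℕ.* q ℕ.* j)) (e₄ (X ℕ.* Wa) (c ℕ.* N ℕ.* K)) ⟩
    w ℕ.* (c ℕ.* N ℕ.* K) ℕ.+ X ℕ.* b₀ ℕ.* (c ℕ.* q ℕ.* j)  ∎)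
    where
    e₁ : ∀ X b q N c K → X ℕ.* b ℕ.* (q ℕ.* N ℕ.* (c ℕ.* K)) ≡ X ℕ.* (c ℕ.* N ℕ.* K) ℕ.* (b ℕ.* q)
    e₁ = ℕSolver.solve-∀
    e₂ : ∀ X c N K a q W → X ℕ.* (c ℕ.* N ℕ.* K) ℕ.* (a ℕ.* q ℕ.+ W) ≡ X ℕ.* W ℕ.* (c ℕ.* N ℕ.* K) ℕ.+ X ℕ.* c ℕ.* q ℕ.* (a ℕ.* N ℕ.* K)
    e₂ = ℕSolver.solve-∀
    e₃ : ∀ X W t c q b j a N → X ℕ.* W ℕ.* t ℕ.+ X ℕ.* c ℕ.* q ℕ.* (b ℕ.* j ℕ.+ 2 ℕ.* (a ℕ.* N)) ≡
      X ℕ.* W ℕ.* t ℕ.+ c ℕ.* N ℕ.* (2 ℕ.* a ℕ.* q ℕ.* X) ℕ.+ X ℕ.* b ℕ.* (c ℕ.* q ℕ.* j)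
    e₃ = ℕSolver.solve-∀
    e₄ : ∀ u t → u ℕ.* t ℕ.+ t ≡ (u ℕ.+ 1) ℕ.* t
    e₄ = ℕSolver.solve-∀
  Yn₁^ : (Y ℕ.* n₁) ℕ.^ c ℕ.≤ w ℕ.^ c ℕ.* G
  Yn₁^ = ℕₚ.≤-trans (ℕₚ.^-monoˡ-≤ c Yn₁) (ℕₚ.≤-reflexive (ℕ-^-distrib-* w (c ℕ.* N ℕ.* K) c))

module Bound {q c : ℕ} .{{c≢0 : ℕ.NonZero c}} (inv : Invariants q c) (est : Estimates inv) (q≥2 : 2 ℕ.≤ q) where
  open Invariants inv
  open KernelPositivity inv est
  open KernelVanishing inv using (functional; kernel-annihilates)

  N = suc N′

  instance
    b≢0 : ℕ.NonZero b
    b≢0 = ℕ.>-nonZero b>0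

  N≥2 : 2 ℕ.≤ N
  N≥2 = s≤s (ℕₚ.≤-trans (ℕ.>-nonZero⁻¹ c) c≤N′)

  module _ (a b₀ : ℕ) (b₀≥1 : 1 ℕ.≤ b₀) (exceeds : ExceedsBound q c a b₀) where
    Wa = b₀ ℕ.* (q ℕ.∸ 1) ℕ.∸ a ℕ.* q
    Wb = b₀ ℕ.* (q ℕ.∸ 1)

    slack : ∃ λ X → 1 ℕ.≤ X × suc c ℕ.* (X ℕ.* Wa ℕ.+ 1) ℕ.^ c ℕ.< (X ℕ.* Wb) ℕ.^ c
    slack = strict-slack (suc c) Wa Wb c (subst (λ u → u ℕ.* Wa ℕ.^ c ℕ.< Wb ℕ.^ c) (ℕₚ.+-comm c 1) exceeds)

    X δ K₀ n₀ : ℕ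
    X = proj₁ slack
    δ = (X ℕ.* Wb) ℕ.^ c
    -- The kernel, and with it the threshold, depends on n through s < b; the sum dominates all b
    -- thresholds at once. The second summand absorbs the rounding error in `gap-in-range`.
    K₀ = sumBelow (threshold δ) b ℕ.+ 2 ℕ.* a ℕ.* q ℕ.* X
    n₀ = N ℕ.* c ℕ.* K₀

    module _ (n′ : ℕ) (C : Code q (l ℕ.* n′)) (fsd : FormallySelfDual C) (c∣wt : WeightsDivisibleBy c C) where
      n = l ℕ.* n′
      t = n′ DivMod./ b
      -- Makes n′ + s + 1 = b (t + 1), the next multiple of b above n′, as exactness demands. K is
      -- one more than t + 1 because the kernel uses two consecutive levels.
      s = b ℕ.∸ suc (n′ DivMod.% b)
      K = suc (suc t)

      suc-s : suc (n′ DivMod.% b) ℕ.+ s ≡ b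
      suc-s = ℕₚ.m+[n∸m]≡n (DivMod.m%n<n n′ b)

      s<b : s ℕ.< b
      s<b = ℕₚ.≤-trans (s≤s (ℕₚ.m≤n+m s (n′ DivMod.% b))) (ℕₚ.≤-reflexive suc-s)

      K-degree : n′ ℕ.+ suc s ≡ b ℕ.* suc t
      K-degree = trans (cong (ℕ._+ suc s) (DivMod.m≡m%n+[m/n]*n n′ b)) (trans (eq (n′ DivMod.% b) (t ℕ.* b) s)
        (trans (cong (ℕ._+ t ℕ.* b) suc-s) (ℕₚ.*-comm (suc t) b)))
        where
        eq : ∀ r u s → r ℕ.+ u ℕ.+ suc s ≡ suc r ℕ.+ s ℕ.+ u
        eq = ℕSolver.solve-∀

      K>K₀ : n₀ ℕ.≤ n → K₀ ℕ.< K
      K>K₀ n₀≤n = ℕₚ.<-trans (ℕₚ.*-cancelˡ-< (N ℕ.* c) K₀ (suc t) (begin-strict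
          N ℕ.* c ℕ.* K₀            ≤⟨ n₀≤n ⟩
          l ℕ.* n′                  <⟨ ℕₚ.*-monoʳ-< l {{ℕ.>-nonZero l>0}} (ℕₚ.≤-trans (ℕₚ.≤-trans (ℕₚ.m≤m+n (suc n′) s) (ℕₚ.≤-reflexive (sym (ℕₚ.+-suc n′ s)))) (ℕₚ.≤-reflexive K-degree)) ⟩
          l ℕ.* (b ℕ.* suc t)       ≡⟨ trans (sym (ℕₚ.*-assoc l b (suc t))) (cong (ℕ._* suc t) l*b) ⟩
          N ℕ.* c ℕ.* suc t         ∎)) (ℕₚ.n<1+n (suc t))
        where open ℕₚ.≤-Reasoning

      n-lower : N ℕ.* c ℕ.* K ℕ.≤ n ℕ.+ 2 ℕ.* (N ℕ.* c)
      n-lower = begin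
        N ℕ.* c ℕ.* K                               ≡⟨ eq₁ (N ℕ.* c) t ⟩
        N ℕ.* c ℕ.* t ℕ.+ 2 ℕ.* (N ℕ.* c)           ≡⟨ cong (λ u → u ℕ.* t ℕ.+ 2 ℕ.* (N ℕ.* c)) (sym l*b) ⟩
        l ℕ.* b ℕ.* t ℕ.+ 2 ℕ.* (N ℕ.* c)           ≡⟨ cong (ℕ._+ 2 ℕ.* (N ℕ.* c)) (eq₂ l b t) ⟩
        l ℕ.* (t ℕ.* b) ℕ.+ 2 ℕ.* (N ℕ.* c)         ≤⟨ ℕₚ.+-monoˡ-≤ (2 ℕ.* (N ℕ.* c)) (ℕₚ.*-monoʳ-≤ l (DivMod.m/n*n≤m n′ b)) ⟩
        l ℕ.* n′ ℕ.+ 2 ℕ.* (N ℕ.* c)                ∎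
        where
        open ℕₚ.≤-Reasoning
        eq₁ : ∀ u t → u ℕ.* suc (suc t) ≡ u ℕ.* t ℕ.+ 2 ℕ.* u
        eq₁ = ℕSolver.solve-∀
        eq₂ : ∀ l b t → l ℕ.* b ℕ.* t ≡ l ℕ.* (t ℕ.* b)
        eq₂ = ℕSolver.solve-∀

      open Enumerator {q} {n} c C

      φ : ℕ → ℤ
      φ = functional s (A δ) (B δ) K

      size² : size C ℕ.* size C ≡ q ℕ.^ n
      size² = trans (cong (size C ℕ.*_) (sym (ℕₚ.*-identityʳ (size C)))) (proj₁ fsd)

      φ-sum : sumOver (λ u → φ (wt u DivMod./ c)) (words C) ≡ 0ℤ
      φ-sum = trans (sym (dot-enumerate φ (words C))) (kernel-annihilates s (A δ) (B δ) n′ (size C) (size-pos C q≥2 fsd) size²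
        f (length-enumerate (words C))
        (λ x y → trans (cong (+ size C *_) (hom-f c∣wt x y)) (trans (proj₂ fsd x y) (sym (hom-f c∣wt (σ₁ q x y) (σ₂ q x y)))))
        (suc t) K-degree)

      not-far : n₀ ℕ.≤ n → ¬ (a ℕ.* n ℕ.< b₀ ℕ.* d C)
      not-far n₀≤n far with zero-word C q≥2 fsd
      ... | z , z∈ , wt-z = ℤₚ.<-irrefl (sym φ-sum) (sumOver-pos (words C) nonneg z∈ (subst (λ w → 0ℤ ℤ.< φ w) (sym (trans (cong (DivMod._/ c) wt-z) (DivMod.0/n≡0 c))) φ0>0))
        where
        thr<K : threshold δ s ℕ.< K
        thr<K = ℕₚ.≤-trans (s≤s (ℕₚ.≤-trans (≤sumBelow (threshold δ) s<b) (ℕₚ.m≤m+n (sumBelow (threshold δ) b) (2 ℕ.* a ℕ.* q ℕ.* X)))) (K>K₀ n₀≤n)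
        large : 2 ℕ.* a ℕ.* q ℕ.* X ℕ.≤ K
        large = ℕₚ.≤-trans (ℕₚ.m≤n+m (2 ℕ.* a ℕ.* q ℕ.* X) (sumBelow (threshold δ) b)) (ℕₚ.<⇒≤ (K>K₀ n₀≤n))
        φ0>0 : 0ℤ ℤ.< φ 0
        φ0>0 = ℤₚ.<-≤-trans (extract-peak δ s K thr<K) (ℤₚ.≤-reflexive (sym (functional-extract δ s K 0 z≤n)))
        far-j : ∀ j → d C ℕ.≤ c ℕ.* j → a ℕ.* N ℕ.* K ℕ.≤ b₀ ℕ.* j ℕ.+ 2 ℕ.* (a ℕ.* N)
        far-j j d≤ = ℕₚ.*-cancelˡ-≤ c (begin
          c ℕ.* (a ℕ.* N ℕ.* K)                               ≡⟨ eq₁ c a N K ⟩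
          a ℕ.* (N ℕ.* c ℕ.* K)                               ≤⟨ ℕₚ.*-monoʳ-≤ a n-lower ⟩
          a ℕ.* (n ℕ.+ 2 ℕ.* (N ℕ.* c))                       ≡⟨ ℕₚ.*-distribˡ-+ a n (2 ℕ.* (N ℕ.* c)) ⟩
          a ℕ.* n ℕ.+ a ℕ.* (2 ℕ.* (N ℕ.* c))                 ≤⟨ ℕₚ.+-monoˡ-≤ (a ℕ.* (2 ℕ.* (N ℕ.* c))) (ℕₚ.≤-trans (ℕₚ.<⇒≤ far) (ℕₚ.*-monoʳ-≤ b₀ d≤)) ⟩
          b₀ ℕ.* (c ℕ.* j) ℕ.+ a ℕ.* (2 ℕ.* (N ℕ.* c))        ≡⟨ eq₂ b₀ c j a N ⟩
          c ℕ.* (b₀ ℕ.* j ℕ.+ 2 ℕ.* (a ℕ.* N))                ∎)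
          where
          open ℕₚ.≤-Reasoning
          eq₁ : ∀ c a N K → c ℕ.* (a ℕ.* N ℕ.* K) ≡ a ℕ.* (N ℕ.* c ℕ.* K)
          eq₁ = ℕSolver.solve-∀
          eq₂ : ∀ b c j a N → b ℕ.* (c ℕ.* j) ℕ.+ a ℕ.* (2 ℕ.* (N ℕ.* c)) ≡ c ℕ.* (b ℕ.* j ℕ.+ 2 ℕ.* (a ℕ.* N))
          eq₂ = ℕSolver.solve-∀
        φ≥0 : ∀ j → d C ℕ.≤ c ℕ.* j → 0ℤ ℤ.≤ φ j
        φ≥0 j d≤ with j ℕₚ.≤? K
        ... | no  j≰K = ℤₚ.≤-reflexive (sym (functional-beyond δ s K j (ℕₚ.≰⇒> j≰K)))
        ... | yes j≤K = ℤₚ.<⇒≤ (ℤₚ.<-≤-trans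
          (extract-range δ s (c ℕ.* K) (K ℕ.∸ j) (ℕₚ.≤-trans thr<K (ℕₚ.m≤n*m K c))
            (gap-in-range q c N a b₀ X K j q≥2 N≥2 b₀≥1 (proj₁ (proj₂ slack)) (proj₂ (proj₂ slack)) j≤K (far-j j d≤) large))
          (ℤₚ.≤-reflexive (sym (functional-extract δ s K j j≤K))))
        nonneg : ∀ {u} → u ∈ words C → 0ℤ ℤ.≤ φ (wt u DivMod./ c)
        nonneg {u} u∈ with wt u ℕₚ.≟ 0
        ... | yes wt0 = ℤₚ.<⇒≤ (subst (λ w → 0ℤ ℤ.< φ w) (sym (trans (cong (DivMod._/ c) wt0) (DivMod.0/n≡0 c))) φ0>0)
        ... | no  wt≢0 = φ≥0 (wt u DivMod./ c) (ℕₚ.≤-trans (d≤wt C z∈ wt-z u∈ wt≢0)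
          (ℕₚ.≤-reflexive (sym (trans (ℕₚ.*-comm c (wt u DivMod./ c)) (DivMod.m/n*n≡m (All.lookup c∣wt u∈))))))

  limsup-bound : (n : ℕ → ℕ) (C : ∀ i → Code q (n i)) → (∀ i → FormallySelfDual (C i)) → (∀ i → WeightsDivisibleBy c (C i)) →
    (∀ i → ∃ λ n′ → n i ≡ l ℕ.* n′) → TendsToInfinity n → LimsupRatioLeBound q c (λ i → d (C i)) n
  limsup-bound n C fsd c∣wt l∣n n→∞ a b₀ b₀≥1 exceeds with n→∞ (n₀ a b₀ b₀≥1 exceeds)
  ... | I , large = I , λ i I≤i → ℕₚ.≮⇒≥ (step (n i) (C i) (fsd i) (c∣wt i) (l∣n i) (large i I≤i))
    where
    step : ∀ m (D : Code q m) → FormallySelfDual D → WeightsDivisibleBy c D → (∃ λ n′ → m ≡ l ℕ.* n′) →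
      n₀ a b₀ b₀≥1 exceeds ℕ.≤ m → ¬ (a ℕ.* m ℕ.< b₀ ℕ.* d D)
    step m D h₁ h₂ (n′ , refl) = not-far a b₀ b₀≥1 exceeds n′ D h₁ h₂

-- Certificates for the estimates

-- A polynomial with nonnegative coefficients, named so that an inequality reduces to a ring identity.
data PosExp : Set where
  con      : ℕ → PosExp
  var₁ var₂ : PosExp
  _⊞_ _⊠_  : PosExp → PosExp → PosExp

infixl 6 _⊞_
infixl 7 _⊠_

⟦_⟧ : PosExp → ℤ → ℤ → ℤ
⟦ con k ⟧ x y = + k
⟦ var₁ ⟧  x y = x
⟦ var₂ ⟧  x y = y
⟦ e ⊞ f ⟧ x y = ⟦ e ⟧ x y + ⟦ f ⟧ x y
⟦ e ⊠ f ⟧ x y = ⟦ e ⟧ x y * ⟦ f ⟧ x y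

⟦⟧-nonNeg : ∀ e {x y} → 0ℤ ℤ.≤ x → 0ℤ ℤ.≤ y → 0ℤ ℤ.≤ ⟦ e ⟧ x y
⟦⟧-nonNeg (con k) hx hy = ℤ.+≤+ z≤n
⟦⟧-nonNeg var₁    hx hy = hx
⟦⟧-nonNeg var₂    hx hy = hy
⟦⟧-nonNeg (e ⊞ f) hx hy = ℤₚ.+-mono-≤ (⟦⟧-nonNeg e hx hy) (⟦⟧-nonNeg f hx hy)
⟦⟧-nonNeg (e ⊠ f) {x} {y} hx hy = *-mono-≤-nonNeg {0ℤ} {⟦ e ⟧ x y} {0ℤ} {⟦ f ⟧ x y} ℤₚ.≤-refl (⟦⟧-nonNeg e hx hy) ℤₚ.≤-refl (⟦⟧-nonNeg f hx hy)

≤-by : ∀ {u v} e {x y} → 0ℤ ℤ.≤ x → 0ℤ ℤ.≤ y → v ≡ u + ⟦ e ⟧ x y → u ℤ.≤ v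
≤-by {u} {v} e {x} {y} hx hy eq = ℤₚ.≤-trans (ℤₚ.≤-reflexive (sym (ℤₚ.+-identityʳ u)))
  (ℤₚ.≤-trans (ℤₚ.+-monoʳ-≤ u (⟦⟧-nonNeg e hx hy)) (ℤₚ.≤-reflexive (sym eq)))

≤-scale : ∀ k {t u} → 0ℤ ℤ.≤ t → t ℤ.≤ u → t ℤ.≤ + suc k * u
≤-scale k {t} {u} t≥0 t≤u = ℤₚ.≤-trans (ℤₚ.≤-reflexive (sym (ℤₚ.*-identityˡ t)))
  (*-mono-≤-nonNeg {1ℤ} {+ suc k} {t} {u} (ℤ.+≤+ z≤n) (ℤ.+≤+ (s≤s z≤n)) t≥0 t≤u)

diff-nonNeg : ∀ k {M R} → k ℕ.* M ℕ.≤ R → 0ℤ ℤ.≤ + R - + k * + M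
diff-nonNeg k {M} {R} h = ℤₚ.i≤j⇒0≤j-i (ℤₚ.≤-trans (ℤₚ.≤-reflexive (sym (ℤₚ.pos-* k M))) (ℤ.+≤+ h))

gap-strict : ∀ δ x d → 0 ℕ.< d → δ ℕ.* x ℕ.+ d ℕ.≤ δ ℕ.* d → x ℕ.< d
gap-strict δ x d d>0 h = ℕₚ.*-cancelˡ-< δ x d (ℕₚ.≤-trans (ℕₚ.≤-trans (ℕₚ.≤-reflexive (ℕₚ.+-comm 1 (δ ℕ.* x))) (ℕₚ.+-monoʳ-≤ (δ ℕ.* x) d>0)) h)

-- If n/d < m^(-1/c) and m^(-1/c) < p/r, then n/d < p/r: an irrational bound is traded for a
-- rational one.
root-bound : ∀ m c n d p r → 0 ℕ.< d → m ℕ.* n ℕ.^ c ℕ.< d ℕ.^ c → r ℕ.^ c ℕ.< m ℕ.* p ℕ.^ c → r ℕ.* n ℕ.< p ℕ.* d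
root-bound m c n d p r d>0 h₁ h₂ = ℕₚ.≰⇒> (λ pd≤rn → ℕₚ.<-irrefl refl (begin-strict
  r ℕ.^ c ℕ.* d ℕ.^ c             <⟨ ℕₚ.*-monoˡ-< (d ℕ.^ c) {{ℕ.>-nonZero (ℕₚ.m^n>0 d {{ℕ.>-nonZero d>0}} c)}} h₂ ⟩
  m ℕ.* p ℕ.^ c ℕ.* d ℕ.^ c       ≡⟨ trans (ℕₚ.*-assoc m (p ℕ.^ c) (d ℕ.^ c)) (cong (m ℕ.*_) (sym (ℕ-^-distrib-* p d c))) ⟩
  m ℕ.* (p ℕ.* d) ℕ.^ c           ≤⟨ ℕₚ.*-monoʳ-≤ m (ℕₚ.^-monoˡ-≤ c pd≤rn) ⟩
  m ℕ.* (r ℕ.* n) ℕ.^ c           ≡⟨ trans (cong (m ℕ.*_) (ℕ-^-distrib-* r n c)) (eq m (r ℕ.^ c) (n ℕ.^ c)) ⟩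
  r ℕ.^ c ℕ.* (m ℕ.* n ℕ.^ c)     ≤⟨ ℕₚ.*-monoʳ-≤ (r ℕ.^ c) (ℕₚ.<⇒≤ h₁) ⟩
  r ℕ.^ c ℕ.* d ℕ.^ c             ∎))
  where
  open ℕₚ.≤-Reasoning
  eq : ∀ a b c → a ℕ.* (b ℕ.* c) ≡ b ℕ.* (a ℕ.* c)
  eq = ℕSolver.solve-∀

-- The zeros of Z include the boundary d^c = m n^c of the range, so Z splits off this difference.
-- The gap makes the difference at least d^c / δ, and the cofactor f is bounded below by t₁ / κ′.
Z-bound : ∀ m c n d δ (κ κ′ : ℕ) {Z f t₁ t} → 0ℤ ℤ.≤ f → t₁ ℤ.≤ + κ′ * f → 0ℤ ℤ.≤ t → t ℤ.≤ + d →
  δ ℕ.* (m ℕ.* n ℕ.^ c) ℕ.+ d ℕ.^ c ℕ.≤ δ ℕ.* d ℕ.^ c →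
  + κ * Z ≡ f * ((+ d) ^ c - + m * (+ n) ^ c) → t₁ * t ^ c ℤ.≤ + (κ ℕ.* κ′ ℕ.* δ) * Z
Z-bound m c n d δ κ κ′ {Z} {f} {t₁} {t} f≥0 h₁ t≥0 t≤d gap eqZ = begin
  t₁ * t ^ c                                        ≤⟨ ℤₚ.*-monoʳ-≤-nonNeg (t ^ c) {{ℤ.nonNegative (^-nonNeg c t≥0)}} h₁ ⟩
  + κ′ * f * t ^ c                                  ≤⟨ mono (ℤₚ.≤-trans (^-mono-≤ c t≥0 t≤d) gapℤ) ⟩
  + κ′ * f * (+ δ * ((+ d) ^ c - + m * (+ n) ^ c))  ≡⟨ eq₁ (+ κ′) f (+ δ) ((+ d) ^ c - + m * (+ n) ^ c) ⟩
  + κ′ * + δ * (f * ((+ d) ^ c - + m * (+ n) ^ c))  ≡⟨ cong (+ κ′ * + δ *_) eqZ ⟨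
  + κ′ * + δ * (+ κ * Z)                            ≡⟨ eq₂ (+ κ′) (+ δ) (+ κ) Z ⟩
  + κ * + κ′ * + δ * Z                              ≡⟨ cong (_* Z) (trans (ℤₚ.pos-* (κ ℕ.* κ′) δ) (cong (_* + δ) (ℤₚ.pos-* κ κ′))) ⟨
  + (κ ℕ.* κ′ ℕ.* δ) * Z                            ∎
  where
  open ℤₚ.≤-Reasoning
  eq₁ : ∀ k f δ x → k * f * (δ * x) ≡ k * δ * (f * x)
  eq₁ = solve-∀
  eq₂ : ∀ k δ l Z → k * δ * (l * Z) ≡ l * k * δ * Z
  eq₂ = solve-∀
  eq₃ : ∀ δ d x → δ * (d - x) ≡ δ * d - δ * x
  eq₃ = solve-∀
  mono : ∀ {u v} → u ℤ.≤ v → + κ′ * f * u ℤ.≤ + κ′ * f * v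
  mono = ℤₚ.*-monoˡ-≤-nonNeg (+ κ′ * f) {{ℤ.nonNegative (*-mono-≤-nonNeg {0ℤ} {+ κ′} {0ℤ} {f} ℤₚ.≤-refl (ℤ.+≤+ z≤n) ℤₚ.≤-refl f≥0)}}
  gapℤ : (+ d) ^ c ℤ.≤ + δ * ((+ d) ^ c - + m * (+ n) ^ c)
  gapℤ = begin
    (+ d) ^ c                                                   ≡⟨ eq₄ ((+ d) ^ c) (+ δ * (+ m * (+ n) ^ c)) ⟩
    (+ δ * (+ m * (+ n) ^ c) + (+ d) ^ c) - + δ * (+ m * (+ n) ^ c)
      ≡⟨ cong (_- + δ * (+ m * (+ n) ^ c)) (trans (ℤₚ.pos-+ (δ ℕ.* (m ℕ.* n ℕ.^ c)) (d ℕ.^ c)) (cong₂ _+_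
           (trans (ℤₚ.pos-* δ (m ℕ.* n ℕ.^ c)) (cong (+ δ *_) (trans (ℤₚ.pos-* m (n ℕ.^ c)) (cong (+ m *_) (pos-^ n c))))) (pos-^ d c))) ⟨
    + (δ ℕ.* (m ℕ.* n ℕ.^ c) ℕ.+ d ℕ.^ c) - + δ * (+ m * (+ n) ^ c)
      ≤⟨ ℤₚ.+-monoˡ-≤ (- (+ δ * (+ m * (+ n) ^ c))) (ℤ.+≤+ gap) ⟩
    + (δ ℕ.* d ℕ.^ c) - + δ * (+ m * (+ n) ^ c)
      ≡⟨ cong (_- + δ * (+ m * (+ n) ^ c)) (trans (ℤₚ.pos-* δ (d ℕ.^ c)) (cong (+ δ *_) (pos-^ d c))) ⟩
    + δ * (+ d) ^ c - + δ * (+ m * (+ n) ^ c)                   ≡⟨ eq₃ (+ δ) ((+ d) ^ c) (+ m * (+ n) ^ c) ⟨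
    + δ * ((+ d) ^ c - + m * (+ n) ^ c)                         ∎
    where
    eq₄ : ∀ d x → d ≡ (x + d) - x
    eq₄ = solve-∀

cube : ∀ x → x ^ 3 ≡ x * x * x
cube = solve-eq
  where
  solve-eq : ∀ x → x * (x * (x * 1ℤ)) ≡ x * x * x
  solve-eq = solve-∀

fourth-power : ∀ x → x ^ 4 ≡ x * x * (x * x)
fourth-power = solve-eq
  where
  solve-eq : ∀ x → x * (x * (x * (x * 1ℤ))) ≡ x * x * (x * x)
  solve-eq = solve-∀

linear : ∀ a R b M → + (a ℕ.* R ℕ.+ b ℕ.* M) ≡ + a * + R + + b * + M
linear a R b M = trans (ℤₚ.pos-+ (a ℕ.* R) (b ℕ.* M)) (cong₂ _+_ (ℤₚ.pos-* a R) (ℤₚ.pos-* b M))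

-- A rational r/p below (c+1)^(1/c) turns the range condition into r n₁ < p d₁. Both sides are
-- linear in R and M with the same part u R, and cancelling it leaves k M ≤ R, well away from the
-- peak R = c M.
far-from-peak : ∀ c nR nM dR k p r u e → r ℕ.^ c ℕ.< suc c ℕ.* p ℕ.^ c →
  (∀ R M → r ℕ.* (nR ℕ.* R ℕ.+ nM ℕ.* M) ≡ u ℕ.* R ℕ.+ suc e ℕ.* (k ℕ.* M)) →
  (∀ R → p ℕ.* (dR ℕ.* R) ≡ u ℕ.* R ℕ.+ suc e ℕ.* R) →
  ∀ R M n₁ d₁ → n₁ ≡ nR ℕ.* R ℕ.+ nM ℕ.* M → d₁ ≡ dR ℕ.* R → 0 ℕ.< d₁ → suc c ℕ.* n₁ ℕ.^ c ℕ.< d₁ ℕ.^ c → k ℕ.* M ℕ.≤ R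
far-from-peak c nR nM dR k p r u e r^c< r*n p*d R M n₁ d₁ n₁≡ d₁≡ d₁>0 strict =
  ℕₚ.<⇒≤ (ℕₚ.*-cancelˡ-< (suc e) (k ℕ.* M) R (ℕₚ.+-cancelˡ-< (u ℕ.* R) (suc e ℕ.* (k ℕ.* M)) (suc e ℕ.* R)
    (subst₂ ℕ._<_ (trans (cong (r ℕ.*_) n₁≡) (r*n R M)) (trans (cong (p ℕ.*_) d₁≡) (p*d R)) (root-bound (suc c) c n₁ d₁ p r d₁>0 strict r^c<))))

-- `F` collects the zeros of Z outside the boundary of the range, among them the peak. J and F need
-- only the crude cutoff of `far`, while the sharp boundary enters through the factor in `Z≡`. The
-- constant Δ of the estimates is κ times `suc κ′`.
module Range (c nR nM dR k κ κ′ jd pP : ℕ) (Jf F Zf : ℤ → ℤ → ℤ)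
  (far   : ∀ R M n₁ d₁ → n₁ ≡ nR ℕ.* R ℕ.+ nM ℕ.* M → d₁ ≡ suc (suc dR) ℕ.* R → 0 ℕ.< d₁ → suc c ℕ.* n₁ ℕ.^ c ℕ.< d₁ ℕ.^ c → suc k ℕ.* M ℕ.≤ R)
  (J≥    : ∀ x m t → t ≡ x + m → 0ℤ ℤ.≤ x - + suc k * m → 0ℤ ℤ.≤ m → 0ℤ ℤ.≤ t → t ^ jd ℤ.≤ + (κ ℕ.* suc κ′) * Jf t m)
  (F≥    : ∀ x m t → t ≡ x + m → 0ℤ ℤ.≤ x - + suc k * m → 0ℤ ℤ.≤ m → t ^ suc pP ℤ.≤ + suc κ′ * F t m)
  (Z≡    : ∀ x m t → t ≡ x + m → + κ * Zf t m ≡ F t m * ((+ suc (suc dR) * x) ^ c - + suc c * (+ nR * x + + nM * m) ^ c))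
  where

  in-range : ∀ (R M δ n₁ d₁ : ℕ) → n₁ ≡ nR ℕ.* R ℕ.+ nM ℕ.* M → d₁ ≡ suc (suc dR) ℕ.* R → 0 ℕ.< R →
    δ ℕ.* (suc c ℕ.* n₁ ℕ.^ c) ℕ.+ d₁ ℕ.^ c ℕ.≤ δ ℕ.* d₁ ℕ.^ c →
    (+ (R ℕ.+ M)) ^ jd ℤ.≤ + (κ ℕ.* suc κ′) * Jf (+ (R ℕ.+ M)) (+ M) ×
    (+ (R ℕ.+ M)) ^ (pP ℕ.+ suc c) ℤ.≤ + (κ ℕ.* suc κ′ ℕ.* δ) * Zf (+ (R ℕ.+ M)) (+ M)
  in-range R M δ n₁ d₁ n₁≡ d₁≡ R>0 gap =
      J≥ (+ R) (+ M) t refl ρ≥0 (ℤ.+≤+ z≤n) (ℤ.+≤+ z≤n)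
    , ℤₚ.≤-trans (ℤₚ.≤-reflexive (trans (cong (t ^_) (ℕₚ.+-suc pP c)) (ℤₚ.^-distribˡ-+-* t (suc pP) c)))
        (Z-bound (suc c) c n₁ d₁ δ κ (suc κ′) {Zf t (+ M)} {F t (+ M)} {t ^ suc pP} {t} F≥0 F≥′ (ℤ.+≤+ z≤n) (ℤ.+≤+ T≤d₁) gap
          (trans (Z≡ (+ R) (+ M) t refl) (cong₂ (λ x y → F t (+ M) * (x ^ c - + suc c * y ^ c)) +d₁≡ +n₁≡)))
    where
    t = + (R ℕ.+ M)
    +n₁≡ : + nR * + R + + nM * + M ≡ + n₁
    +n₁≡ = trans (sym (linear nR R nM M)) (cong +_ (sym n₁≡))
    +d₁≡ : + suc (suc dR) * + R ≡ + d₁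
    +d₁≡ = trans (sym (ℤₚ.pos-* (suc (suc dR)) R)) (cong +_ (sym d₁≡))
    d₁>0 : 0 ℕ.< d₁
    d₁>0 = ℕₚ.≤-trans R>0 (ℕₚ.≤-trans (ℕₚ.m≤m+n R (suc dR ℕ.* R)) (ℕₚ.≤-reflexive (sym d₁≡)))
    strict : suc c ℕ.* n₁ ℕ.^ c ℕ.< d₁ ℕ.^ c
    strict = gap-strict δ (suc c ℕ.* n₁ ℕ.^ c) (d₁ ℕ.^ c) (ℕₚ.m^n>0 d₁ {{ℕ.>-nonZero d₁>0}} c) gap
    kM≤R : suc k ℕ.* M ℕ.≤ R
    kM≤R = far R M n₁ d₁ n₁≡ d₁≡ d₁>0 strict
    ρ≥0 : 0ℤ ℤ.≤ + R - + suc k * + M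
    ρ≥0 = diff-nonNeg (suc k) {M} {R} kM≤R
    F≥′ : t ^ suc pP ℤ.≤ + suc κ′ * F t (+ M)
    F≥′ = F≥ (+ R) (+ M) t refl ρ≥0 (ℤ.+≤+ z≤n)
    F≥0 : 0ℤ ℤ.≤ F t (+ M)
    F≥0 = ℤₚ.*-cancelˡ-≤-pos 0ℤ (F t (+ M)) (+ suc κ′) (ℤₚ.≤-trans (ℤₚ.≤-reflexive (ℤₚ.*-zeroʳ (+ suc κ′))) (ℤₚ.≤-trans (^-nonNeg {t} (suc pP) (ℤ.+≤+ z≤n)) F≥′))
    T≤d₁ : R ℕ.+ M ℕ.≤ d₁
    T≤d₁ = ℕₚ.≤-trans (ℕₚ.+-monoʳ-≤ R (ℕₚ.≤-trans (ℕₚ.≤-trans (ℕₚ.m≤n*m M (suc k)) kM≤R) (ℕₚ.m≤m+n R (dR ℕ.* R)))) (ℕₚ.≤-reflexive (sym d₁≡))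

-- The identities are written unfolded because the ring solver does not see through hom, eval and _^_.

-- E = x² + 3y², the enumerator of the Hermitian self-dual code of length 2.
inv-42 : Invariants 4 2
inv-42 = record
  { N′ = 2 ; l = 2 ; b = 3 ; dE = 1 ; μ = 4 ; ν = 8
  ; E′ = + 3 ∷ []
  ; J = + 2 ∷ -[1+ 17 ] ∷ []
  ; c≤N′ = ℕₚ.m≤m+n 2 0 ; len-E = ℕₚ.≤-refl ; c*dE≤l = ℕₚ.m≤m+n 2 0 ; l>0 = s≤s z≤n ; b>0 = s≤s z≤n
  ; l*b = refl ; μ² = refl ; ν² = refl
  ; P-inv = P-inv ; E-inv = E-inv ; J-def = J-def
  ; infinity = inj₁ refl }
  where
  P-inv : ∀ x y → (x - y) * (1ℤ * (((x + + 3 * y) * ((x + + 3 * y) * 1ℤ)) * 1ℤ) + (-1ℤ * (1ℤ * ((x - y) * ((x - y) * 1ℤ))) + 0ℤ)) ≡ + 8 * (y * (1ℤ * ((x * (x * 1ℤ)) * 1ℤ) + (-1ℤ * (1ℤ * (y * (y * 1ℤ))) + 0ℤ)))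
  P-inv = solve-∀
  E-inv : ∀ x y → (1ℤ * (((x + + 3 * y) * ((x + + 3 * y) * 1ℤ)) * 1ℤ) + (+ 3 * (1ℤ * ((x - y) * ((x - y) * 1ℤ))) + 0ℤ)) ≡ + 4 * (1ℤ * ((x * (x * 1ℤ)) * 1ℤ) + (+ 3 * (1ℤ * (y * (y * 1ℤ))) + 0ℤ))
  E-inv = solve-∀
  J-def : ∀ X → (+ 2 * 1ℤ + (-[1+ 17 ] * (X * 1ℤ) + 0ℤ)) ≡
    + 2 * (1ℤ * 1ℤ + (+ 3 * (X * 1ℤ) + 0ℤ)) * (1ℤ - + 3 * X) - + 6 * (1ℤ - X) * (0ℤ * 1ℤ + (+ 3 * (X * 1ℤ) + 0ℤ))
  J-def = solve-∀

est-42 : Estimates inv-42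
est-42 = record
  -- At the peak (T, M) = (3, 1), E^3 = 6^3 and v (1-v)^2 homogenises to 4, whence β = 54; Δ is 6
  -- times 2.
  { jd = 1 ; pE = 0 ; pP = 0 ; α = 1 ; β = 54 ; Δ = 12
  ; len-J = ℕₚ.≤-refl ; hd-eq = refl
  ; E-nonNeg = ℤ.+≤+ z≤n ∷ []
  ; J-peak = ℤ.-<+ ; Z-peak = refl ; in-range = in-range }
  where
  rem-J rem-F : PosExp
  -- What remains of 12 J - t after substituting r = var₁ + 20 m: the cutoff is strong enough to
  -- make all coefficients nonnegative. The other remainders arise in the same way.
  rem-J = con 23 ⊠ var₁ ⊞ con 267 ⊠ var₂
  rem-F = con 1 ⊠ var₁ ⊞ con 15 ⊠ var₂
  F : ℤ → ℤ → ℤ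
  F t m = (t - + 3 * m)
  J-eq : ∀ r m → + 12 * (+ 2 * (((r + m) * 1ℤ) * 1ℤ) + (-[1+ 17 ] * (1ℤ * (m * 1ℤ)) + 0ℤ)) ≡ ((r + m) * 1ℤ) + (+ 23 * (r - + 20 * m) + + 267 * m)
  J-eq = solve-∀
  f-eq : ∀ r m → + 2 * ((r + m) - + 3 * m) ≡ ((r + m) * 1ℤ) + (+ 1 * (r - + 20 * m) + + 15 * m)
  f-eq = solve-∀
  Z-eq : ∀ r m → + 6 * (+ 1 * (1ℤ * ((1ℤ * (((r + m) * 1ℤ) * 1ℤ) + (+ 3 * (1ℤ * (m * 1ℤ)) + 0ℤ)) * ((1ℤ * (((r + m) * 1ℤ) * 1ℤ) + (+ 3 * (1ℤ * (m * 1ℤ)) + 0ℤ)) * ((1ℤ * (((r + m) * 1ℤ) * 1ℤ) + (+ 3 * (1ℤ * (m * 1ℤ)) + 0ℤ)) * 1ℤ)))) - + 54 * (1ℤ * (m * ((r + m - m) * ((r + m - m) * 1ℤ))))) ≡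
    ((r + m) - + 3 * m) * (((+ 9 * r) * ((+ 9 * r) * 1ℤ)) - + 3 * ((+ 5 * r + + 8 * m) * ((+ 5 * r + + 8 * m) * 1ℤ)))
  Z-eq = solve-∀
  J≡ : ∀ r m t → t ≡ r + m → + 12 * hom 1 1 t m (+ 2 ∷ -[1+ 17 ] ∷ []) ≡ t ^ 1 + ⟦ rem-J ⟧ (r - + 20 * m) m
  J≡ r m _ refl = J-eq r m
  F≡ : ∀ r m t → t ≡ r + m → + 2 * F t m ≡ t ^ 1 + ⟦ rem-F ⟧ (r - + 20 * m) m
  F≡ r m _ refl = f-eq r m
  Z≡ : ∀ r m t → t ≡ r + m → + 6 * (+ 1 * (t ^ 0 * hom 1 1 t m (1ℤ ∷ + 3 ∷ []) ^ 3) - + 54 * (t ^ 0 * (m * (t - m) ^ 2))) ≡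
    F t m * ((+ 9 * r) ^ 2 - + 3 * (+ 5 * r + + 8 * m) ^ 2)
  Z≡ r m _ refl = Z-eq r m
  module R = Range 2 5 8 7 19 6 1 1 0
    (λ t m → hom 1 1 t m (+ 2 ∷ -[1+ 17 ] ∷ [])) F
    (λ t m → + 1 * (t ^ 0 * hom 1 1 t m (1ℤ ∷ + 3 ∷ []) ^ 3) - + 54 * (t ^ 0 * (m * (t - m) ^ 2)))
    -- 5/3 lies below the square root of 3, and 5 (5R + 8M) < 3 (9R) gives 20 M < R.
    (far-from-peak 2 5 8 9 20 3 5 25 1 (ℕₚ.m≤m+n 26 1) ℕSolver.solve-∀ ℕSolver.solve-∀)
    (λ x m t t≡ ρ≥0 m≥0 t≥0 → ≤-by rem-J {x - + 20 * m} {m} ρ≥0 m≥0 (J≡ x m t t≡))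
    (λ x m t t≡ ρ≥0 m≥0 → ≤-by rem-F {x - + 20 * m} {m} ρ≥0 m≥0 (F≡ x m t t≡))
    Z≡
  in-range : ∀ (R M δ : ℕ) → 0 ℕ.< R →
    δ ℕ.* (3 ℕ.* numer 4 2 3 R M ℕ.^ 2) ℕ.+ denom 4 2 3 R M ℕ.^ 2 ℕ.≤ δ ℕ.* denom 4 2 3 R M ℕ.^ 2 → _
  in-range R M δ R>0 gap = R.in-range R M δ (numer 4 2 3 R M) (denom 4 2 3 R M) refl refl R>0 gap

-- E = x² + y², the enumerator of the repetition code of length 2.
inv-22 : Invariants 2 2
inv-22 = record
  { N′ = 3 ; l = 2 ; b = 4 ; dE = 1 ; μ = 2 ; ν = 4
  ; E′ = 1ℤ ∷ []
  ; J = + 2 ∷ -[1+ 11 ] ∷ + 2 ∷ []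
  ; c≤N′ = ℕₚ.m≤m+n 2 1 ; len-E = ℕₚ.≤-refl ; c*dE≤l = ℕₚ.m≤m+n 2 0 ; l>0 = s≤s z≤n ; b>0 = s≤s z≤n
  ; l*b = refl ; μ² = refl ; ν² = refl
  ; P-inv = P-inv ; E-inv = E-inv ; J-def = J-def
  ; infinity = inj₂ (refl , refl , (1 , refl) , (1 , refl)) }
  where
  P-inv : ∀ x y → (x - y) * (1ℤ * (((x + 1ℤ * y) * ((x + 1ℤ * y) * ((x + 1ℤ * y) * 1ℤ))) * 1ℤ) + (-1ℤ * (((x + 1ℤ * y) * 1ℤ) * ((x - y) * ((x - y) * 1ℤ))) + 0ℤ)) ≡ + 4 * (y * (1ℤ * ((x * (x * (x * 1ℤ))) * 1ℤ) + (-1ℤ * ((x * 1ℤ) * (y * (y * 1ℤ))) + 0ℤ)))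
  P-inv = solve-∀
  E-inv : ∀ x y → (1ℤ * (((x + 1ℤ * y) * ((x + 1ℤ * y) * 1ℤ)) * 1ℤ) + (1ℤ * (1ℤ * ((x - y) * ((x - y) * 1ℤ))) + 0ℤ)) ≡ + 2 * (1ℤ * ((x * (x * 1ℤ)) * 1ℤ) + (1ℤ * (1ℤ * (y * (y * 1ℤ))) + 0ℤ))
  E-inv = solve-∀
  J-def : ∀ X → (+ 2 * 1ℤ + (-[1+ 11 ] * (X * 1ℤ) + (+ 2 * (X * (X * 1ℤ)) + 0ℤ))) ≡
    + 2 * (1ℤ * 1ℤ + (1ℤ * (X * 1ℤ) + 0ℤ)) * (1ℤ - + 3 * X) - + 8 * (1ℤ - X) * (0ℤ * 1ℤ + (1ℤ * (X * 1ℤ) + 0ℤ))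
  J-def = solve-∀

est-22 : Estimates inv-22
est-22 = record
  { jd = 2 ; pE = 0 ; pP = 1 ; α = 3 ; β = 64 ; Δ = 4
  ; len-J = ℕₚ.≤-refl ; hd-eq = refl
  ; E-nonNeg = ℤ.+≤+ z≤n ∷ []
  ; J-peak = ℤ.-<+ ; Z-peak = refl ; in-range = in-range }
  where
  rem-J rem-F : PosExp
  rem-J = con 7 ⊠ var₁ ⊠ var₁ ⊞ con 106 ⊠ var₁ ⊠ var₂ ⊞ con 327 ⊠ var₂ ⊠ var₂
  rem-F = con 2 ⊠ var₁ ⊠ var₁ ⊞ con 34 ⊠ var₁ ⊠ var₂ ⊞ con 135 ⊠ var₂ ⊠ var₂
  F : ℤ → ℤ → ℤ
  -- Z is symmetric under v ↦ 1/v, so with the peak 1/3 it has the zero v = 3.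
  F t m = ((t - + 3 * m) * (+ 3 * t - m))
  J-eq : ∀ r m → + 4 * (+ 2 * (((r + m) * ((r + m) * 1ℤ)) * 1ℤ) + (-[1+ 11 ] * (((r + m) * 1ℤ) * (m * 1ℤ)) + (+ 2 * (1ℤ * (m * (m * 1ℤ))) + 0ℤ))) ≡ ((r + m) * ((r + m) * 1ℤ)) + (+ 7 * (r - + 10 * m) * (r - + 10 * m) + + 106 * (r - + 10 * m) * m + + 327 * m * m)
  J-eq = solve-∀
  f-eq : ∀ r m → + 1 * (((r + m) - + 3 * m) * (+ 3 * (r + m) - m)) ≡ ((r + m) * ((r + m) * 1ℤ)) + (+ 2 * (r - + 10 * m) * (r - + 10 * m) + + 34 * (r - + 10 * m) * m + + 135 * m * m)
  f-eq = solve-∀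
  Z-eq : ∀ r m → + 4 * (+ 3 * (1ℤ * ((1ℤ * (((r + m) * 1ℤ) * 1ℤ) + (1ℤ * (1ℤ * (m * 1ℤ)) + 0ℤ)) * ((1ℤ * (((r + m) * 1ℤ) * 1ℤ) + (1ℤ * (1ℤ * (m * 1ℤ)) + 0ℤ)) * ((1ℤ * (((r + m) * 1ℤ) * 1ℤ) + (1ℤ * (1ℤ * (m * 1ℤ)) + 0ℤ)) * ((1ℤ * (((r + m) * 1ℤ) * 1ℤ) + (1ℤ * (1ℤ * (m * 1ℤ)) + 0ℤ)) * 1ℤ))))) - + 64 * (((r + m) * 1ℤ) * (m * ((r + m - m) * ((r + m - m) * 1ℤ))))) ≡
    (((r + m) - + 3 * m) * (+ 3 * (r + m) - m)) * (((+ 4 * r) * ((+ 4 * r) * 1ℤ)) - + 3 * ((+ 2 * r + + 4 * m) * ((+ 2 * r + + 4 * m) * 1ℤ)))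
  Z-eq = solve-∀
  J≡ : ∀ r m t → t ≡ r + m → + 4 * hom 1 2 t m (+ 2 ∷ -[1+ 11 ] ∷ + 2 ∷ []) ≡ t ^ 2 + ⟦ rem-J ⟧ (r - + 10 * m) m
  J≡ r m _ refl = J-eq r m
  F≡ : ∀ r m t → t ≡ r + m → + 1 * F t m ≡ t ^ 2 + ⟦ rem-F ⟧ (r - + 10 * m) m
  F≡ r m _ refl = f-eq r m
  Z≡ : ∀ r m t → t ≡ r + m → + 4 * (+ 3 * (t ^ 0 * hom 1 1 t m (1ℤ ∷ 1ℤ ∷ []) ^ 4) - + 64 * (t ^ 1 * (m * (t - m) ^ 2))) ≡
    F t m * ((+ 4 * r) ^ 2 - + 3 * (+ 2 * r + + 4 * m) ^ 2)
  Z≡ r m _ refl = Z-eq r m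
  module R = Range 2 2 4 2 9 4 0 2 1
    (λ t m → hom 1 2 t m (+ 2 ∷ -[1+ 11 ] ∷ + 2 ∷ [])) F
    (λ t m → + 3 * (t ^ 0 * hom 1 1 t m (1ℤ ∷ 1ℤ ∷ []) ^ 4) - + 64 * (t ^ 1 * (m * (t - m) ^ 2)))
    (far-from-peak 2 2 4 4 10 3 5 10 1 (ℕₚ.m≤m+n 26 1) ℕSolver.solve-∀ ℕSolver.solve-∀)
    (λ x m t t≡ ρ≥0 m≥0 t≥0 → ≤-by rem-J {x - + 10 * m} {m} ρ≥0 m≥0 (J≡ x m t t≡))
    (λ x m t t≡ ρ≥0 m≥0 → ≤-by rem-F {x - + 10 * m} {m} ρ≥0 m≥0 (F≡ x m t t≡))
    Z≡
  in-range : ∀ (R M δ : ℕ) → 0 ℕ.< R →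
    δ ℕ.* (3 ℕ.* numer 2 2 4 R M ℕ.^ 2) ℕ.+ denom 2 2 4 R M ℕ.^ 2 ℕ.≤ δ ℕ.* denom 2 2 4 R M ℕ.^ 2 → _
  in-range R M δ R>0 gap = R.in-range R M δ (numer 2 2 4 R M) (denom 2 2 4 R M) refl refl R>0 gap

-- E = x⁴ + 8xy³, the enumerator of the tetracode.
inv-33 : Invariants 3 3
inv-33 = record
  { N′ = 3 ; l = 4 ; b = 3 ; dE = 1 ; μ = 9 ; ν = 9
  ; E′ = + 8 ∷ []
  ; J = + 4 ∷ -[1+ 79 ] ∷ -[1+ 31 ] ∷ []
  ; c≤N′ = ℕₚ.m≤m+n 3 0 ; len-E = ℕₚ.≤-refl ; c*dE≤l = ℕₚ.m≤m+n 3 1 ; l>0 = s≤s z≤n ; b>0 = s≤s z≤n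
  ; l*b = refl ; μ² = refl ; ν² = refl
  ; P-inv = P-inv ; E-inv = E-inv ; J-def = J-def
  ; infinity = inj₁ refl }
  where
  P-inv : ∀ x y → (x - y) * (1ℤ * (((x + + 2 * y) * ((x + + 2 * y) * ((x + + 2 * y) * 1ℤ))) * 1ℤ) + (-1ℤ * (1ℤ * ((x - y) * ((x - y) * ((x - y) * 1ℤ)))) + 0ℤ)) ≡ + 9 * (y * (1ℤ * ((x * (x * (x * 1ℤ))) * 1ℤ) + (-1ℤ * (1ℤ * (y * (y * (y * 1ℤ)))) + 0ℤ)))
  P-inv = solve-∀
  E-inv : ∀ x y → (1ℤ * (((x + + 2 * y) * ((x + + 2 * y) * ((x + + 2 * y) * ((x + + 2 * y) * 1ℤ)))) * 1ℤ) + (+ 8 * (((x + + 2 * y) * 1ℤ) * ((x - y) * ((x - y) * ((x - y) * 1ℤ)))) + 0ℤ)) ≡ + 9 * (1ℤ * ((x * (x * (x * (x * 1ℤ)))) * 1ℤ) + (+ 8 * ((x * 1ℤ) * (y * (y * (y * 1ℤ)))) + 0ℤ))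
  E-inv = solve-∀
  J-def : ∀ X → (+ 4 * 1ℤ + (-[1+ 79 ] * (X * 1ℤ) + (-[1+ 31 ] * (X * (X * 1ℤ)) + 0ℤ))) ≡
    + 4 * (1ℤ * 1ℤ + (+ 8 * (X * 1ℤ) + 0ℤ)) * (1ℤ - + 4 * X) - + 12 * (1ℤ - X) * (0ℤ * 1ℤ + (+ 8 * (X * 1ℤ) + 0ℤ))
  J-def = solve-∀

est-33 : Estimates inv-33
est-33 = record
  { jd = 2 ; pE = 1 ; pP = 0 ; α = 1 ; β = 256 ; Δ = 24
  ; len-J = ℕₚ.≤-refl ; hd-eq = refl
  ; E-nonNeg = ℤ.+≤+ z≤n ∷ []
  ; J-peak = ℤ.-<+ ; Z-peak = refl ; in-range = in-range }
  where
  rem-J rem-F : PosExp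
  rem-J = con 95 ⊠ var₁ ⊠ var₁ ⊞ con 3400 ⊠ var₁ ⊠ var₂ ⊞ con 19952 ⊠ var₂ ⊠ var₂
  rem-F = con 1 ⊠ var₁ ⊞ con 20 ⊠ var₂
  F : ℤ → ℤ → ℤ
  F t m = (t - + 4 * m)
  J-eq : ∀ r m → + 24 * (+ 4 * (((r + m) * ((r + m) * 1ℤ)) * 1ℤ) + (-[1+ 79 ] * (((r + m) * 1ℤ) * (m * 1ℤ)) + (-[1+ 31 ] * (1ℤ * (m * (m * 1ℤ))) + 0ℤ))) ≡ ((r + m) * ((r + m) * 1ℤ)) + (+ 95 * (r - + 27 * m) * (r - + 27 * m) + + 3400 * (r - + 27 * m) * m + + 19952 * m * m)
  J-eq = solve-∀
  f-eq : ∀ r m → + 2 * ((r + m) - + 4 * m) ≡ ((r + m) * 1ℤ) + (+ 1 * (r - + 27 * m) + + 20 * m)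
  f-eq = solve-∀
  ε-eq : ∀ r m → hom 1 1 (r + m) m (1ℤ ∷ + 8 ∷ []) ≡ r + + 9 * m
  ε-eq = expanded
    where
    expanded : ∀ r m → (1ℤ * (((r + m) * 1ℤ) * 1ℤ) + (+ 8 * (1ℤ * (m * 1ℤ)) + 0ℤ)) ≡ r + + 9 * m
    expanded = solve-∀
  R-eq : ∀ r m → r + m - m ≡ r
  R-eq = solve-∀
  tidy : ∀ k₁ k₂ β t u m v → k₁ * k₂ * (1ℤ * (t * u) - β * (1ℤ * (m * v))) ≡ k₁ * (k₂ * (t * u - β * (m * v)))
  tidy = solve-∀
  quartic : ∀ r m → + 3 * ((r + m) * ((r + + 9 * m) * (r + + 9 * m) * (r + + 9 * m)) - + 256 * (m * (r * r * r))) ≡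
    (r - + 3 * m) * (+ 128 * (r * r * r) - (+ 5 * r + + 9 * m) * (+ 5 * r + + 9 * m) * (+ 5 * r + + 9 * m))
  quartic = solve-∀
  absorb : ∀ r m n → + 4 * ((r - + 3 * m) * (+ 128 * (r * r * r) - n)) ≡ ((r + m) - + 4 * m) * ((+ 8 * r) * (+ 8 * r) * (+ 8 * r) - + 4 * n)
  absorb = solve-∀
  Z-eq : ∀ r m → + 12 * (1ℤ * ((r + m) ^ 1 * hom 1 1 (r + m) m (1ℤ ∷ + 8 ∷ []) ^ 3) - + 256 * (1ℤ * (m * (r + m - m) ^ 3))) ≡
    ((r + m) - + 4 * m) * ((+ 8 * r) ^ 3 - + 4 * (+ 5 * r + + 9 * m) ^ 3)
  Z-eq r m = begin
    + 12 * (1ℤ * ((r + m) ^ 1 * hom 1 1 (r + m) m (1ℤ ∷ + 8 ∷ []) ^ 3) - + 256 * (1ℤ * (m * (r + m - m) ^ 3)))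
      ≡⟨ cong₂ (λ u v → + 12 * (1ℤ * u - + 256 * (1ℤ * (m * v))))
           (cong₂ _*_ (ℤₚ.*-identityʳ (r + m)) (trans (cong (_^ 3) (ε-eq r m)) (cube ε))) (trans (cong (_^ 3) (R-eq r m)) (cube r)) ⟩
    + 12 * (1ℤ * ((r + m) * (ε * ε * ε)) - + 256 * (1ℤ * (m * (r * r * r))))
      ≡⟨ tidy (+ 4) (+ 3) (+ 256) (r + m) (ε * ε * ε) m (r * r * r) ⟩
    + 4 * (+ 3 * ((r + m) * (ε * ε * ε) - + 256 * (m * (r * r * r))))
      ≡⟨ cong (+ 4 *_) (quartic r m) ⟩
    + 4 * ((r - + 3 * m) * (+ 128 * (r * r * r) - ν * ν * ν))
      ≡⟨ absorb r m (ν * ν * ν) ⟩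
    ((r + m) - + 4 * m) * ((+ 8 * r) * (+ 8 * r) * (+ 8 * r) - + 4 * (ν * ν * ν))
      ≡⟨ cong₂ (λ u v → ((r + m) - + 4 * m) * (u - + 4 * v)) (cube (+ 8 * r)) (cube ν) ⟨
    ((r + m) - + 4 * m) * ((+ 8 * r) ^ 3 - + 4 * ν ^ 3) ∎
    where
    open ≡-Reasoning
    ε = r + + 9 * m
    ν = + 5 * r + + 9 * m
  J≡ : ∀ r m t → t ≡ r + m → + 24 * hom 1 2 t m (+ 4 ∷ -[1+ 79 ] ∷ -[1+ 31 ] ∷ []) ≡ t ^ 2 + ⟦ rem-J ⟧ (r - + 27 * m) m
  J≡ r m _ refl = J-eq r m
  F≡ : ∀ r m t → t ≡ r + m → + 2 * F t m ≡ t ^ 1 + ⟦ rem-F ⟧ (r - + 27 * m) m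
  F≡ r m _ refl = f-eq r m
  Z≡ : ∀ r m t → t ≡ r + m → + 12 * (+ 1 * (t ^ 1 * hom 1 1 t m (1ℤ ∷ + 8 ∷ []) ^ 3) - + 256 * (t ^ 0 * (m * (t - m) ^ 3))) ≡
    F t m * ((+ 8 * r) ^ 3 - + 4 * (+ 5 * r + + 9 * m) ^ 3)
  Z≡ r m _ refl = Z-eq r m
  module R = Range 3 5 9 6 26 12 1 2 0
    (λ t m → hom 1 2 t m (+ 4 ∷ -[1+ 79 ] ∷ -[1+ 31 ] ∷ [])) F
    (λ t m → + 1 * (t ^ 1 * hom 1 1 t m (1ℤ ∷ + 8 ∷ []) ^ 3) - + 256 * (t ^ 0 * (m * (t - m) ^ 3)))
    -- 3/2 lies below the cube root of 4.
    (far-from-peak 3 5 9 8 27 2 3 15 0 (ℕₚ.m≤m+n 28 4) ℕSolver.solve-∀ ℕSolver.solve-∀)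
    (λ x m t t≡ ρ≥0 m≥0 t≥0 → ≤-by rem-J {x - + 27 * m} {m} ρ≥0 m≥0 (J≡ x m t t≡))
    (λ x m t t≡ ρ≥0 m≥0 → ≤-by rem-F {x - + 27 * m} {m} ρ≥0 m≥0 (F≡ x m t t≡))
    Z≡
  in-range : ∀ (R M δ : ℕ) → 0 ℕ.< R →
    δ ℕ.* (4 ℕ.* numer 3 3 4 R M ℕ.^ 3) ℕ.+ denom 3 3 4 R M ℕ.^ 3 ℕ.≤ δ ℕ.* denom 3 3 4 R M ℕ.^ 3 → _
  in-range R M δ R>0 gap = R.in-range R M δ (numer 3 3 4 R M) (denom 3 3 4 R M) refl refl R>0 gap

-- E = x⁸ + 14x⁴y⁴ + y⁸, the enumerator of the extended Hamming code.
inv-24 : Invariants 2 4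
inv-24 = record
  { N′ = 5 ; l = 8 ; b = 3 ; dE = 2 ; μ = 16 ; ν = 8
  ; E′ = + 14 ∷ 1ℤ ∷ []
  ; J = + 8 ∷ -[1+ 263 ] ∷ -[1+ 263 ] ∷ + 8 ∷ []
  ; c≤N′ = ℕₚ.m≤m+n 4 1 ; len-E = ℕₚ.≤-refl ; c*dE≤l = ℕₚ.m≤m+n 8 0 ; l>0 = s≤s z≤n ; b>0 = s≤s z≤n
  ; l*b = refl ; μ² = refl ; ν² = refl
  ; P-inv = P-inv ; E-inv = E-inv ; J-def = J-def
  ; infinity = inj₂ (refl , refl , (2 , refl) , (2 , refl)) }
  where
  P-form : ∀ x y → y * (1ℤ * ((x * (x * (x * (x * (x * 1ℤ))))) * 1ℤ) + (-1ℤ * ((x * 1ℤ) * (y * (y * (y * (y * 1ℤ))))) + 0ℤ)) ≡ (x * y) * ((x * x - y * y) * (x * x + y * y))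
  P-form = solve-∀
  P-form-inv : ∀ x y → ((x + 1ℤ * y) * (x - y)) * (((x + 1ℤ * y) * (x + 1ℤ * y) - (x - y) * (x - y)) * ((x + 1ℤ * y) * (x + 1ℤ * y) + (x - y) * (x - y))) ≡
    + 8 * ((x * y) * ((x * x - y * y) * (x * x + y * y)))
  P-form-inv = solve-∀
  P-inv : ∀ x y → (x - y) * hom 4 5 (x + 1ℤ * y) (x - y) 1-v ≡ + 8 * (y * hom 4 5 x y 1-v)
  P-inv x y = trans (P-form (x + 1ℤ * y) (x - y)) (trans (P-form-inv x y) (cong (+ 8 *_) (sym (P-form x y))))
  -- E in the coordinates u = (x² + y²)² and v = (xy)², on which σ acts linearly by u ↦ 4u and v ↦ u
  -- - 4v. The identity of degree eight thus splits into small ones.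
  E-form : ℤ → ℤ → ℤ
  E-form u v = (u - + 2 * v) * (u - + 2 * v) + + 12 * (v * v)
  sq₁ sq₂ : ℤ → ℤ → ℤ
  sq₁ x y = (x * x + y * y) * (x * x + y * y)
  sq₂ x y = (x * y) * (x * y)
  E-form-eq : ∀ x y → (1ℤ * ((x * (x * (x * (x * (x * (x * (x * (x * 1ℤ)))))))) * 1ℤ) + (+ 14 * ((x * (x * (x * (x * 1ℤ)))) * (y * (y * (y * (y * 1ℤ))))) + (1ℤ * (1ℤ * (y * (y * (y * (y * (y * (y * (y * (y * 1ℤ))))))))) + 0ℤ))) ≡
    ((x * x + y * y) * (x * x + y * y) - + 2 * ((x * y) * (x * y))) * ((x * x + y * y) * (x * x + y * y) - + 2 * ((x * y) * (x * y))) + + 12 * ((x * y) * (x * y) * ((x * y) * (x * y)))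
  E-form-eq = solve-∀
  sq₁-inv : ∀ x y → ((x + 1ℤ * y) * (x + 1ℤ * y) + (x - y) * (x - y)) * ((x + 1ℤ * y) * (x + 1ℤ * y) + (x - y) * (x - y)) ≡ + 4 * ((x * x + y * y) * (x * x + y * y))
  sq₁-inv = solve-∀
  sq₂-inv : ∀ x y → ((x + 1ℤ * y) * (x - y)) * ((x + 1ℤ * y) * (x - y)) ≡ (x * x + y * y) * (x * x + y * y) - + 4 * ((x * y) * (x * y))
  sq₂-inv = solve-∀
  E-form-inv : ∀ u v → (+ 4 * u - + 2 * (u - + 4 * v)) * (+ 4 * u - + 2 * (u - + 4 * v)) + + 12 * ((u - + 4 * v) * (u - + 4 * v)) ≡
    + 16 * ((u - + 2 * v) * (u - + 2 * v) + + 12 * (v * v))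
  E-form-inv = solve-∀
  E-inv : ∀ x y → hom 4 8 (x + 1ℤ * y) (x - y) (1ℤ ∷ + 14 ∷ 1ℤ ∷ []) ≡ + 16 * hom 4 8 x y (1ℤ ∷ + 14 ∷ 1ℤ ∷ [])
  E-inv x y = trans (E-form-eq (x + 1ℤ * y) (x - y)) (trans (cong₂ E-form (sq₁-inv x y) (sq₂-inv x y))
    (trans (E-form-inv (sq₁ x y) (sq₂ x y)) (cong (+ 16 *_) (sym (E-form-eq x y)))))
  J-def : ∀ X → (+ 8 * 1ℤ + (-[1+ 263 ] * (X * 1ℤ) + (-[1+ 263 ] * (X * (X * 1ℤ)) + (+ 8 * (X * (X * (X * 1ℤ))) + 0ℤ)))) ≡
    + 8 * (1ℤ * 1ℤ + (+ 14 * (X * 1ℤ) + (1ℤ * (X * (X * 1ℤ)) + 0ℤ))) * (1ℤ - + 5 * X) - + 24 * (1ℤ - X) * (0ℤ * 1ℤ + (+ 14 * (X * 1ℤ) + (+ 2 * (X * (X * 1ℤ)) + 0ℤ)))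
  J-def = solve-∀

est-24 : Estimates inv-24
est-24 = record
  { jd = 3 ; pE = 0 ; pP = 1 ; α = 5 ; β = 3456 ; Δ = 16
  ; len-J = ℕₚ.≤-refl ; hd-eq = refl
  ; E-nonNeg = ℤ.+≤+ z≤n ∷ ℤ.+≤+ z≤n ∷ []
  ; J-peak = ℤ.-<+ ; Z-peak = refl ; in-range = in-range }
  where
  rem-J rem-F : PosExp
  rem-J = con 7 ⊠ var₁ ⊠ var₁ ⊠ var₁ ⊞ con 597 ⊠ var₁ ⊠ var₁ ⊠ var₂ ⊞ con 13389 ⊠ var₁ ⊠ var₂ ⊠ var₂ ⊞ con 27847 ⊠ var₂ ⊠ var₂ ⊠ var₂
  rem-F = con 4 ⊠ var₁ ⊠ var₁ ⊞ con 302 ⊠ var₁ ⊠ var₂ ⊞ con 5663 ⊠ var₂ ⊠ var₂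
  F : ℤ → ℤ → ℤ
  F t m = ((t - + 5 * m) * (+ 5 * t - m))
  J-eq : ∀ r m → (+ 8 * (((r + m) * ((r + m) * ((r + m) * 1ℤ))) * 1ℤ) + (-[1+ 263 ] * (((r + m) * ((r + m) * 1ℤ)) * (m * 1ℤ)) + (-[1+ 263 ] * (((r + m) * 1ℤ) * (m * (m * 1ℤ))) + (+ 8 * (1ℤ * (m * (m * (m * 1ℤ)))) + 0ℤ)))) ≡ ((r + m) * ((r + m) * ((r + m) * 1ℤ))) + (+ 7 * (r - + 40 * m) * (r - + 40 * m) * (r - + 40 * m) + + 597 * (r - + 40 * m) * (r - + 40 * m) * m + + 13389 * (r - + 40 * m) * m * m + + 27847 * m * m * m)
  J-eq = solve-∀
  f-eq : ∀ r m → + 1 * (((r + m) - + 5 * m) * (+ 5 * (r + m) - m)) ≡ ((r + m) * ((r + m) * 1ℤ)) + (+ 4 * (r - + 40 * m) * (r - + 40 * m) + + 302 * (r - + 40 * m) * m + + 5663 * m * m)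
  f-eq = solve-∀
  Z-form : ∀ k α β ε p r → k * (α * (1ℤ * ε) - β * + 4 * (p * r)) ≡ k * (α * ε - β * (+ 4 * p) * r)
  Z-form = solve-∀
  regroup : ∀ t m u → t ^ 1 * (m * u) ≡ t * m * u
  regroup = expanded
    where
    expanded : ∀ t m u → t * 1ℤ * (m * u) ≡ t * m * u
    expanded = solve-∀
  ε-eq : ∀ r m → hom 1 2 (r + m) m (1ℤ ∷ + 14 ∷ 1ℤ ∷ []) ≡ + 4 * ((r + + 2 * m) * (r + + 2 * m)) - + 3 * (r * r)
  ε-eq = expanded
    where
    expanded : ∀ r m → (1ℤ * (((r + m) * ((r + m) * 1ℤ)) * 1ℤ) + (+ 14 * (((r + m) * 1ℤ) * (m * 1ℤ)) + (1ℤ * (1ℤ * (m * (m * 1ℤ))) + 0ℤ))) ≡ + 4 * ((r + + 2 * m) * (r + + 2 * m)) - + 3 * (r * r)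
    expanded = solve-∀
  p-eq : ∀ r m → + 4 * ((r + m) * m) ≡ (r + + 2 * m) * (r + + 2 * m) - r * r
  p-eq = solve-∀
  R-eq : ∀ r m → r + m - m ≡ r
  R-eq = solve-∀
  cubic : ∀ a b → + 5 * ((+ 4 * a - + 3 * b) * (+ 4 * a - + 3 * b) * (+ 4 * a - + 3 * b)) - + 864 * (a - b) * (b * b) ≡
    (+ 9 * b - + 4 * a) * (+ 81 * (b * b) - + 80 * (a * a))
  cubic = solve-∀
  absorb : ∀ k u x v y w → k * (u * (x * v - y * w)) ≡ u * ((k * x) * v - (k * y) * w)
  absorb = solve-∀
  f-form : ∀ r m → + 9 * (r * r) - + 4 * ((r + + 2 * m) * (r + + 2 * m)) ≡ (((r + m) - + 5 * m) * (+ 5 * (r + m) - m))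
  f-form = solve-∀
  fourth : ∀ k s → k * k * (k * k) * (s * s * (s * s)) ≡ (k * s) * (k * s) * ((k * s) * (k * s))
  fourth = solve-∀
  n-form : ∀ r m → + 4 * (r + + 2 * m) ≡ + 4 * r + + 8 * m
  n-form = solve-∀
  -- With a = (r + 2m)² and b = r² the identity becomes a cubic one in two variables, and the
  -- cofactor 9b - 4a is F.
  Z-core : ∀ a b ε p f → ε ≡ + 4 * a - + 3 * b → + 4 * p ≡ a - b → + 9 * b - + 4 * a ≡ f →
    + 16 * (+ 5 * (1ℤ * (ε * ε * ε)) - + 3456 * (p * (b * b))) ≡ f * (+ 6 * + 6 * (+ 6 * + 6) * (b * b) - + 5 * (+ 4 * + 4 * (+ 4 * + 4)) * (a * a))
  Z-core a b ε p f ε≡ p≡ f≡ = begin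
    + 16 * (+ 5 * (1ℤ * (ε * ε * ε)) - + 3456 * (p * (b * b)))
      ≡⟨ cong (λ k → + 16 * (+ 5 * (1ℤ * (ε * ε * ε)) - k * (p * (b * b)))) {+ 3456} {+ 864 * + 4} refl ⟩
    + 16 * (+ 5 * (1ℤ * (ε * ε * ε)) - + 864 * + 4 * (p * (b * b)))
      ≡⟨ Z-form (+ 16) (+ 5) (+ 864) (ε * ε * ε) p (b * b) ⟩
    + 16 * (+ 5 * (ε * ε * ε) - + 864 * (+ 4 * p) * (b * b))
      ≡⟨ cong₂ (λ u v → + 16 * (+ 5 * (u * u * u) - + 864 * v * (b * b))) ε≡ p≡ ⟩
    + 16 * (+ 5 * ((+ 4 * a - + 3 * b) * (+ 4 * a - + 3 * b) * (+ 4 * a - + 3 * b)) - + 864 * (a - b) * (b * b))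
      ≡⟨ cong (+ 16 *_) (cubic a b) ⟩
    + 16 * ((+ 9 * b - + 4 * a) * (+ 81 * (b * b) - + 80 * (a * a)))
      ≡⟨ absorb (+ 16) (+ 9 * b - + 4 * a) (+ 81) (b * b) (+ 80) (a * a) ⟩
    (+ 9 * b - + 4 * a) * (+ 16 * + 81 * (b * b) - + 16 * + 80 * (a * a))
      ≡⟨ cong₂ (λ k k′ → (+ 9 * b - + 4 * a) * (k * (b * b) - k′ * (a * a))) {+ 16 * + 81} {+ 6 * + 6 * (+ 6 * + 6)} {+ 16 * + 80} {+ 5 * (+ 4 * + 4 * (+ 4 * + 4))} refl refl ⟩
    (+ 9 * b - + 4 * a) * (+ 6 * + 6 * (+ 6 * + 6) * (b * b) - + 5 * (+ 4 * + 4 * (+ 4 * + 4)) * (a * a))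
      ≡⟨ cong (_* (+ 6 * + 6 * (+ 6 * + 6) * (b * b) - + 5 * (+ 4 * + 4 * (+ 4 * + 4)) * (a * a))) f≡ ⟩
    f * (+ 6 * + 6 * (+ 6 * + 6) * (b * b) - + 5 * (+ 4 * + 4 * (+ 4 * + 4)) * (a * a)) ∎
    where open ≡-Reasoning
  Z-eq : ∀ r m → + 16 * (+ 5 * (1ℤ * hom 1 2 (r + m) m (1ℤ ∷ + 14 ∷ 1ℤ ∷ []) ^ 3) - + 3456 * ((r + m) ^ 1 * (m * (r + m - m) ^ 4))) ≡
    (((r + m) - + 5 * m) * (+ 5 * (r + m) - m)) * ((+ 6 * r) ^ 4 - + 5 * (+ 4 * r + + 8 * m) ^ 4)
  Z-eq r m = trans
    (cong₂ (λ u v → + 16 * (+ 5 * (1ℤ * u) - + 3456 * v)) (cube (hom 1 2 (r + m) m (1ℤ ∷ + 14 ∷ 1ℤ ∷ [])))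
      (trans (regroup (r + m) m ((r + m - m) ^ 4)) (cong ((r + m) * m *_) (trans (cong (_^ 4) (R-eq r m)) (fourth-power r)))))
    (trans (Z-core ((r + + 2 * m) * (r + + 2 * m)) (r * r) (hom 1 2 (r + m) m (1ℤ ∷ + 14 ∷ 1ℤ ∷ [])) ((r + m) * m) (((r + m) - + 5 * m) * (+ 5 * (r + m) - m)) (ε-eq r m) (p-eq r m) (f-form r m))
      (cong₂ (λ u v → (((r + m) - + 5 * m) * (+ 5 * (r + m) - m)) * (u - v)) (trans (fourth (+ 6) r) (sym (fourth-power (+ 6 * r))))
        (trans (ℤₚ.*-assoc (+ 5) (+ 4 * + 4 * (+ 4 * + 4)) ((r + + 2 * m) * (r + + 2 * m) * ((r + + 2 * m) * (r + + 2 * m))))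
          (cong (+ 5 *_) (trans (fourth (+ 4) (r + + 2 * m)) (trans (sym (fourth-power (+ 4 * (r + + 2 * m)))) (cong (_^ 4) (n-form r m))))))))
  J≡ : ∀ r m t → t ≡ r + m → hom 1 3 t m (+ 8 ∷ -[1+ 263 ] ∷ -[1+ 263 ] ∷ + 8 ∷ []) ≡ t ^ 3 + ⟦ rem-J ⟧ (r - + 40 * m) m
  J≡ r m _ refl = J-eq r m
  F≡ : ∀ r m t → t ≡ r + m → + 1 * F t m ≡ t ^ 2 + ⟦ rem-F ⟧ (r - + 40 * m) m
  F≡ r m _ refl = f-eq r m
  Z≡ : ∀ r m t → t ≡ r + m → + 16 * (+ 5 * (t ^ 0 * hom 1 2 t m (1ℤ ∷ + 14 ∷ 1ℤ ∷ []) ^ 3) - + 3456 * (t ^ 1 * (m * (t - m) ^ 4))) ≡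
    F t m * ((+ 6 * r) ^ 4 - + 5 * (+ 4 * r + + 8 * m) ^ 4)
  Z≡ r m _ refl = Z-eq r m
  module R = Range 4 4 8 4 39 16 0 3 1
    (λ t m → hom 1 3 t m (+ 8 ∷ -[1+ 263 ] ∷ -[1+ 263 ] ∷ + 8 ∷ [])) F
    (λ t m → + 5 * (t ^ 0 * hom 1 2 t m (1ℤ ∷ + 14 ∷ 1ℤ ∷ []) ^ 3) - + 3456 * (t ^ 1 * (m * (t - m) ^ 4)))
    -- 10/7 lies below the fourth root of 5: 10000 < 5 · 2401.
    (far-from-peak 4 4 8 6 40 7 10 40 1 (ℕₚ.m≤m+n 10001 2004) ℕSolver.solve-∀ ℕSolver.solve-∀)
    (λ x m t t≡ ρ≥0 m≥0 t≥0 → ≤-scale 15 (^-nonNeg 3 t≥0) (≤-by rem-J {x - + 40 * m} {m} ρ≥0 m≥0 (J≡ x m t t≡)))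
    (λ x m t t≡ ρ≥0 m≥0 → ≤-by rem-F {x - + 40 * m} {m} ρ≥0 m≥0 (F≡ x m t t≡))
    Z≡
  in-range : ∀ (R M δ : ℕ) → 0 ℕ.< R →
    δ ℕ.* (5 ℕ.* numer 2 4 6 R M ℕ.^ 4) ℕ.+ denom 2 4 6 R M ℕ.^ 4 ℕ.≤ δ ℕ.* denom 2 4 6 R M ℕ.^ 4 → _
  in-range R M δ R>0 gap = R.in-range R M δ (numer 2 4 6 R M) (denom 2 4 6 R M) refl refl R>0 gap

-- The case c = 1

P-inv-1 : ∀ q₁ x y → σ₂ (suc q₁) x y * hom 1 1 (σ₁ (suc q₁) x y) (σ₂ (suc q₁) x y) 1-v ≡ + suc q₁ * (y * hom 1 1 x y 1-v)
P-inv-1 q₁ x y = trans (cong (σ₂ (suc q₁) x y *_) (hom-1-v (σ₁ (suc q₁) x y) (σ₂ (suc q₁) x y)))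
  (trans (eq (+ q₁) x y) (cong (λ u → + suc q₁ * (y * u)) (sym (hom-1-v x y))))
  where
  eq : ∀ a x y → (x - y) * (x + a * y - (x - y)) ≡ (1ℤ + a) * (y * (x - y))
  eq = solve-∀

sq≡^2 : ∀ q → q ℕ.* q ≡ q ℕ.^ 2
sq≡^2 q = cong (q ℕ.*_) (sym (ℕₚ.*-identityʳ q))

module CaseOne (q₂ : ℕ) where
  q = suc (suc q₂)

  nR≡ : (q ℕ.∸ 1) ℕ.* 2 ℕ.∸ q ≡ q₂
  nR≡ = trans (cong (ℕ._∸ q) (eq q₂)) (ℕₚ.m+n∸m≡n q q₂)
    where
    eq : ∀ q₂ → suc q₂ ℕ.* 2 ≡ suc (suc q₂) ℕ.+ q₂
    eq = ℕSolver.solve-∀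

  numer≡ : ∀ R M → numer q 1 2 R M ≡ q₂ ℕ.* R ℕ.+ q ℕ.* M
  numer≡ R M = cong₂ (λ u v → u ℕ.* R ℕ.+ v ℕ.* M) nR≡ (ℕₚ.*-identityˡ q)

  -- For c = 1 the boundary of the range is rational, so the cutoff follows from it without any
  -- approximation.
  far : ∀ R M n₁ d₁ → n₁ ≡ q₂ ℕ.* R ℕ.+ q ℕ.* M → d₁ ≡ suc (suc (q₂ ℕ.* 2)) ℕ.* R → 0 ℕ.< d₁ → 2 ℕ.* n₁ ℕ.^ 1 ℕ.< d₁ ℕ.^ 1 → q ℕ.* M ℕ.≤ R
  far R M n₁ d₁ n₁≡ d₁≡ d₁>0 strict = ℕₚ.<⇒≤ (ℕₚ.*-cancelˡ-< 2 (q ℕ.* M) R (ℕₚ.+-cancelˡ-< (2 ℕ.* (q₂ ℕ.* R)) (2 ℕ.* (q ℕ.* M)) (2 ℕ.* R)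
    (subst₂ ℕ._<_ (trans (cong (2 ℕ.*_) (trans (ℕₚ.*-identityʳ n₁) n₁≡)) (ℕₚ.*-distribˡ-+ 2 (q₂ ℕ.* R) (q ℕ.* M)))
      (trans (ℕₚ.*-identityʳ d₁) (trans d₁≡ (eq q₂ R))) strict)))
    where
    eq : ∀ q₂ R → suc (suc (q₂ ℕ.* 2)) ℕ.* R ≡ 2 ℕ.* (q₂ ℕ.* R) ℕ.+ 2 ℕ.* R
    eq = ℕSolver.solve-∀

  F : ℤ → ℤ → ℤ
  F t m = t - + 2 * m

  rem-F : PosExp
  rem-F = con 2 ⊠ var₁ ⊞ con 2 ⊠ con q₂ ⊠ var₂

  F≥ : ∀ x m t → t ≡ x + m → 0ℤ ℤ.≤ x - + q * m → 0ℤ ℤ.≤ m → t ^ 1 ℤ.≤ + 3 * F t m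
  F≥ x m _ refl ρ≥0 m≥0 = ≤-by rem-F {x - + q * m} {m} ρ≥0 m≥0 (trans (eq (+ q₂) x m) (cong (_+ ⟦ rem-F ⟧ (x - + q * m) m) (sym (ℤₚ.*-identityʳ (x + m)))))
    where
    eq : ∀ b x m → + 3 * (x + m - + 2 * m) ≡ (x + m) + (+ 2 * (x - (1ℤ + (1ℤ + b)) * m) + + 2 * b * m)
    eq = solve-∀

  gap-linear : ∀ x m → (+ suc (suc (q₂ ℕ.* 2)) * x) ^ 1 - + 2 * (+ q₂ * x + + q * m) ^ 1 ≡ + 2 * (x - + q * m)
  gap-linear x m = trans (cong₂ (λ u v → u - + 2 * v) (ℤₚ.*-identityʳ (+ suc (suc (q₂ ℕ.* 2)) * x)) (ℤₚ.*-identityʳ (+ q₂ * x + + q * m)))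
    (trans (cong (λ u → (+ 2 + u) * x - + 2 * (+ q₂ * x + + q * m)) (ℤₚ.pos-* q₂ 2)) (eq (+ q₂) x m))
    where
    eq : ∀ b x m → (+ 2 + b * + 2) * x - + 2 * (b * x + (1ℤ + (1ℤ + b)) * m) ≡ + 2 * (x - (1ℤ + (1ℤ + b)) * m)
    eq = solve-∀

  -- The Z-polynomial is (1-2v)(1-(q+1)v) for every choice of E.
  Z≡ : ∀ (Zf : ℤ → ℤ → ℤ) → (∀ x m → Zf (x + m) m ≡ F (x + m) m * (x - + q * m)) →
    ∀ x m t → t ≡ x + m → + 2 * Zf t m ≡ F t m * ((+ suc (suc (q₂ ℕ.* 2)) * x) ^ 1 - + 2 * (+ q₂ * x + + q * m) ^ 1)
  Z≡ Zf h x m _ refl = trans (cong (+ 2 *_) (h x m)) (trans (eq (F (x + m) m) (x - + q * m)) (cong (F (x + m) m *_) (sym (gap-linear x m))))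
    where
    eq : ∀ f u → + 2 * (f * u) ≡ f * (+ 2 * u)
    eq = solve-∀

-- E = x² + (q-1)y², for even lengths.
inv-1 : ∀ q₁ → Invariants (suc q₁) 1
inv-1 q₁ = record
  { N′ = 1 ; l = 2 ; b = 1 ; dE = 2 ; μ = suc q₁ ; ν = suc q₁
  ; E′ = 0ℤ ∷ + q₁ ∷ [] ; J = + 2 ∷ -[1+ 3 ] ∷ - (+ 2 * + q₁) ∷ []
  ; c≤N′ = ℕₚ.≤-refl ; len-E = ℕₚ.≤-refl ; c*dE≤l = ℕₚ.≤-refl ; l>0 = s≤s z≤n ; b>0 = s≤s z≤n
  ; l*b = refl ; μ² = sq≡^2 (suc q₁) ; ν² = sq≡^2 (suc q₁)
  ; P-inv = P-inv-1 q₁ ; E-inv = E-inv (+ q₁) ; J-def = J-def (+ q₁)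
  ; infinity = inj₁ refl }
  where
  E-inv : ∀ a x y →
    1ℤ * ((x + a * y) * ((x + a * y) * 1ℤ) * 1ℤ) + (0ℤ * ((x + a * y) * 1ℤ * ((x - y) * 1ℤ)) + (a * (1ℤ * ((x - y) * ((x - y) * 1ℤ))) + 0ℤ)) ≡
    (1ℤ + a) * (1ℤ * (x * (x * 1ℤ) * 1ℤ) + (0ℤ * (x * 1ℤ * (y * 1ℤ)) + (a * (1ℤ * (y * (y * 1ℤ))) + 0ℤ)))
  E-inv = solve-∀
  J-def : ∀ a X → + 2 * 1ℤ + (-[1+ 3 ] * (X * 1ℤ) + (- (+ 2 * a) * (X * (X * 1ℤ)) + 0ℤ)) ≡
    + 2 * (1ℤ * 1ℤ + (0ℤ * (X * 1ℤ) + (a * (X * (X * 1ℤ)) + 0ℤ))) * (1ℤ - + 2 * X)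
      - + 2 * (1ℤ - X) * (0ℤ * 1ℤ + ((0ℤ + 0ℤ) * (X * 1ℤ) + ((a + (a + 0ℤ)) * (X * (X * 1ℤ)) + 0ℤ)))
  J-def = solve-∀

est-1 : ∀ q₂ → Estimates (inv-1 (suc q₂))
est-1 q₂ = record
  { jd = 2 ; pE = 0 ; pP = 0 ; α = 1 ; β = q ℕ.+ 3 ; Δ = 6
  ; len-J = ℕₚ.≤-refl ; hd-eq = refl ; E-nonNeg = ℤ.+≤+ z≤n ∷ ℤ.+≤+ z≤n ∷ []
  ; J-peak = ℤₚ.≤-<-trans (ℤₚ.≤-reflexive (J-peak (+ suc q₂))) (ℤₚ.neg-mono-< {0ℤ} {+ 2 * + suc q₂} (*-pos {+ 2} {+ suc q₂} (ℤ.+<+ (s≤s z≤n)) (ℤ.+<+ (s≤s z≤n))))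
  ; Z-peak = Z-peak (+ suc q₂)
  ; in-range = in-range }
  where
  open CaseOne q₂
  J-peak : ∀ a → + 2 * (+ 2 * (+ 2 * 1ℤ) * 1ℤ) + (-[1+ 3 ] * (+ 2 * 1ℤ * (1ℤ * 1ℤ)) + (- (+ 2 * a) * (1ℤ * (1ℤ * (1ℤ * 1ℤ))) + 0ℤ)) ≡ - (+ 2 * a)
  J-peak = solve-∀
  Z-peak : ∀ a → 1ℤ * (1ℤ * ((1ℤ * (+ 2 * (+ 2 * 1ℤ) * 1ℤ) + (0ℤ * (+ 2 * 1ℤ * (1ℤ * 1ℤ)) + (a * (1ℤ * (1ℤ * (1ℤ * 1ℤ))) + 0ℤ))) * 1ℤ)) ≡
    (1ℤ + a + + 3) * (1ℤ * (1ℤ * ((+ 2 - 1ℤ) * 1ℤ)))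
  Z-peak = solve-∀
  J E : Poly
  J = + 2 ∷ -[1+ 3 ] ∷ - (+ 2 * + suc q₂) ∷ []
  E = 1ℤ ∷ 0ℤ ∷ + suc q₂ ∷ []
  rem-J : PosExp
  rem-J = con 11 ⊠ var₁ ⊠ var₁ ⊞ (con 22 ⊠ con q₂ ⊞ con 42) ⊠ var₁ ⊠ var₂ ⊞ (con 11 ⊠ con q₂ ⊠ con q₂ ⊞ con 30 ⊠ con q₂ ⊞ con 15) ⊠ var₂ ⊠ var₂
  J-eq : ∀ b x m → + 6 * (+ 2 * ((x + m) * ((x + m) * 1ℤ) * 1ℤ) + (-[1+ 3 ] * ((x + m) * 1ℤ * (m * 1ℤ)) + (- (+ 2 * (1ℤ + b)) * (1ℤ * (m * (m * 1ℤ))) + 0ℤ))) ≡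
    (x + m) * ((x + m) * 1ℤ) + (+ 11 * (x - (1ℤ + (1ℤ + b)) * m) * (x - (1ℤ + (1ℤ + b)) * m)
      + (+ 22 * b + + 42) * (x - (1ℤ + (1ℤ + b)) * m) * m + (+ 11 * b * b + + 30 * b + + 15) * m * m)
  J-eq = solve-∀
  J≡ : ∀ x m t → t ≡ x + m → + 6 * hom 1 2 t m J ≡ t ^ 2 + ⟦ rem-J ⟧ (x - + q * m) m
  J≡ x m _ refl = J-eq (+ q₂) x m
  Zf : ℤ → ℤ → ℤ
  Zf t m = 1ℤ * (1ℤ * hom 1 2 t m E ^ 1) - + (q ℕ.+ 3) * (1ℤ * (m * (t - m) ^ 1))
  Z-eq : ∀ b x m → 1ℤ * (1ℤ * ((1ℤ * ((x + m) * ((x + m) * 1ℤ) * 1ℤ) + (0ℤ * ((x + m) * 1ℤ * (m * 1ℤ)) + ((1ℤ + b) * (1ℤ * (m * (m * 1ℤ))) + 0ℤ))) * 1ℤ))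
      - (1ℤ + (1ℤ + b) + + 3) * (1ℤ * (m * ((x + m - m) * 1ℤ))) ≡
    (x + m - + 2 * m) * (x - (1ℤ + (1ℤ + b)) * m)
  Z-eq = solve-∀
  module R = Range 1 q₂ q (q₂ ℕ.* 2) (suc q₂) 2 2 2 0 (λ t m → hom 1 2 t m J) F Zf far
    (λ x m t t≡ ρ≥0 m≥0 _ → ≤-by rem-J {x - + q * m} {m} ρ≥0 m≥0 (J≡ x m t t≡))
    F≥ (Z≡ Zf (λ x m → Z-eq (+ q₂) x m))
  in-range : ∀ (R M δ : ℕ) → 0 ℕ.< R →
    δ ℕ.* (2 ℕ.* numer q 1 2 R M ℕ.^ 1) ℕ.+ denom q 1 2 R M ℕ.^ 1 ℕ.≤ δ ℕ.* denom q 1 2 R M ℕ.^ 1 → _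
  in-range R M δ R>0 gap = R.in-range R M δ (numer q 1 2 R M) (denom q 1 2 R M) (numer≡ R M) refl R>0 gap

pos-square : ∀ p₁ → + (p₁ ℕ.+ p₁ ℕ.* suc p₁) ≡ + p₁ + + p₁ * (1ℤ + + p₁)
pos-square p₁ = trans (ℤₚ.pos-+ p₁ (p₁ ℕ.* suc p₁)) (cong (_+_ (+ p₁)) (ℤₚ.pos-* p₁ (suc p₁)))

-- Odd lengths occur only for q = p², where E = x + (p-1)y is available.
inv-square : ∀ p₁ → Invariants (suc p₁ ℕ.* suc p₁) 1
inv-square p₁ = record
  { N′ = 1 ; l = 1 ; b = 2 ; dE = 1 ; μ = suc p₁ ; ν = suc p₁ ℕ.* suc p₁
  ; E′ = + p₁ ∷ [] ; J = 1ℤ ∷ - (+ 2 + + p₁) ∷ []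
  ; c≤N′ = ℕₚ.≤-refl ; len-E = ℕₚ.≤-refl ; c*dE≤l = ℕₚ.≤-refl ; l>0 = s≤s z≤n ; b>0 = s≤s z≤n
  ; l*b = refl ; μ² = sym (ℕₚ.*-identityʳ (suc p₁ ℕ.* suc p₁)) ; ν² = sq≡^2 (suc p₁ ℕ.* suc p₁)
  ; P-inv = P-inv-1 (p₁ ℕ.+ p₁ ℕ.* suc p₁)
  ; E-inv = λ x y → E-inv (+ p₁) (+ (p₁ ℕ.+ p₁ ℕ.* suc p₁)) (pos-square p₁) x y
  ; J-def = J-def (+ p₁)
  ; infinity = inj₁ refl }
  where
  E-inv : ∀ a A → A ≡ a + a * (1ℤ + a) → ∀ x y →
    1ℤ * ((x + A * y) * 1ℤ * 1ℤ) + (a * (1ℤ * ((x - y) * 1ℤ)) + 0ℤ) ≡ (1ℤ + a) * (1ℤ * (x * 1ℤ * 1ℤ) + (a * (1ℤ * (y * 1ℤ)) + 0ℤ))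
  E-inv a _ refl x y = eq a x y
    where
    eq : ∀ a x y → 1ℤ * ((x + (a + a * (1ℤ + a)) * y) * 1ℤ * 1ℤ) + (a * (1ℤ * ((x - y) * 1ℤ)) + 0ℤ) ≡ (1ℤ + a) * (1ℤ * (x * 1ℤ * 1ℤ) + (a * (1ℤ * (y * 1ℤ)) + 0ℤ))
    eq = solve-∀
  J-def : ∀ a X → 1ℤ * 1ℤ + (- (+ 2 + a) * (X * 1ℤ) + 0ℤ) ≡
    1ℤ * (1ℤ * 1ℤ + (a * (X * 1ℤ) + 0ℤ)) * (1ℤ - + 2 * X) - + 2 * (1ℤ - X) * (0ℤ * 1ℤ + ((a + 0ℤ) * (X * 1ℤ) + 0ℤ))
  J-def = solve-∀

est-square : ∀ p₂ → Estimates (inv-square (suc p₂))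
est-square p₂ = record
  { jd = 1 ; pE = 0 ; pP = 0 ; α = 1 ; β = (3 ℕ.+ p₂) ℕ.* (3 ℕ.+ p₂) ; Δ = 6
  ; len-J = ℕₚ.≤-refl ; hd-eq = refl ; E-nonNeg = ℤ.+≤+ z≤n ∷ []
  ; J-peak = ℤₚ.≤-<-trans (ℤₚ.≤-reflexive (J-peak (+ suc p₂))) (ℤₚ.neg-mono-< {0ℤ} {+ suc p₂} (ℤ.+<+ (s≤s z≤n)))
  ; Z-peak = trans (Z-peak (+ p₂)) (cong (λ u → u * (1ℤ * (1ℤ * ((+ 2 - 1ℤ) * 1ℤ)))) (sym (ℤₚ.pos-* (3 ℕ.+ p₂) (3 ℕ.+ p₂))))
  ; in-range = in-range }
  where
  p = suc (suc p₂)
  q₂ = p₂ ℕ.+ suc p₂ ℕ.* p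
  open CaseOne q₂
  q≡ : + q ≡ (1ℤ + (1ℤ + + p₂)) * (1ℤ + (1ℤ + + p₂))
  q≡ = ℤₚ.pos-* p p
  J-peak : ∀ a → 1ℤ * (+ 2 * 1ℤ * 1ℤ) + (- (+ 2 + a) * (1ℤ * (1ℤ * 1ℤ)) + 0ℤ) ≡ - a
  J-peak = solve-∀
  Z-peak : ∀ b → 1ℤ * (1ℤ * ((1ℤ * (+ 2 * 1ℤ * 1ℤ) + ((1ℤ + b) * (1ℤ * (1ℤ * 1ℤ)) + 0ℤ)) * ((1ℤ * (+ 2 * 1ℤ * 1ℤ) + ((1ℤ + b) * (1ℤ * (1ℤ * 1ℤ)) + 0ℤ)) * 1ℤ))) ≡
    ((+ 3 + b) * (+ 3 + b)) * (1ℤ * (1ℤ * ((+ 2 - 1ℤ) * 1ℤ)))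
  Z-peak = solve-∀
  J E : Poly
  J = 1ℤ ∷ - (+ 2 + + suc p₂) ∷ []
  E = 1ℤ ∷ + suc p₂ ∷ []
  rem-J : PosExp
  rem-J = con 5 ⊠ var₁ ⊞ (con 5 ⊠ con p₂ ⊠ con p₂ ⊞ con 14 ⊠ con p₂ ⊞ con 7) ⊠ var₂
  J-eq : ∀ b x m → + 6 * (1ℤ * ((x + m) * 1ℤ * 1ℤ) + (- (+ 2 + (1ℤ + b)) * (1ℤ * (m * 1ℤ)) + 0ℤ)) ≡
    (x + m) * 1ℤ + (+ 5 * (x - (1ℤ + (1ℤ + b)) * (1ℤ + (1ℤ + b)) * m) + (+ 5 * b * b + + 14 * b + + 7) * m)
  J-eq = solve-∀
  J≡ : ∀ x m t → t ≡ x + m → + 6 * hom 1 1 t m J ≡ t ^ 1 + ⟦ rem-J ⟧ (x - + q * m) m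
  J≡ x m _ refl = trans (J-eq (+ p₂) x m) (cong (λ Q → (x + m) ^ 1 + ⟦ rem-J ⟧ (x - Q * m) m) (sym q≡))
  Zf : ℤ → ℤ → ℤ
  Zf t m = 1ℤ * (1ℤ * hom 1 1 t m E ^ 2) - + ((3 ℕ.+ p₂) ℕ.* (3 ℕ.+ p₂)) * (1ℤ * (m * (t - m) ^ 1))
  Z-eq : ∀ b B Q x m → B ≡ (+ 3 + b) * (+ 3 + b) → Q ≡ (1ℤ + (1ℤ + b)) * (1ℤ + (1ℤ + b)) →
    1ℤ * (1ℤ * hom 1 1 (x + m) m (1ℤ ∷ 1ℤ + b ∷ []) ^ 2) - B * (1ℤ * (m * (x + m - m) ^ 1)) ≡ (x + m - + 2 * m) * (x - Q * m)
  Z-eq b _ _ x m refl refl = eq b x m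
    where
    eq : ∀ b x m → 1ℤ * (1ℤ * ((1ℤ * ((x + m) * 1ℤ * 1ℤ) + ((1ℤ + b) * (1ℤ * (m * 1ℤ)) + 0ℤ)) * ((1ℤ * ((x + m) * 1ℤ * 1ℤ) + ((1ℤ + b) * (1ℤ * (m * 1ℤ)) + 0ℤ)) * 1ℤ)))
      - (+ 3 + b) * (+ 3 + b) * (1ℤ * (m * ((x + m - m) * 1ℤ))) ≡
      (x + m - + 2 * m) * (x - (1ℤ + (1ℤ + b)) * (1ℤ + (1ℤ + b)) * m)
    eq = solve-∀
  module R = Range 1 q₂ q (q₂ ℕ.* 2) (suc q₂) 2 2 1 0 (λ t m → hom 1 1 t m J) F Zf far
    (λ x m t t≡ ρ≥0 m≥0 _ → ≤-by rem-J {x - + q * m} {m} ρ≥0 m≥0 (J≡ x m t t≡))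
    F≥ (Z≡ Zf (λ x m → Z-eq (+ p₂) (+ ((3 ℕ.+ p₂) ℕ.* (3 ℕ.+ p₂))) (+ q) x m (ℤₚ.pos-* (3 ℕ.+ p₂) (3 ℕ.+ p₂)) q≡))
  in-range : ∀ (R M δ : ℕ) → 0 ℕ.< R →
    δ ℕ.* (2 ℕ.* numer q 1 2 R M ℕ.^ 1) ℕ.+ denom q 1 2 R M ℕ.^ 1 ℕ.≤ δ ℕ.* denom q 1 2 R M ℕ.^ 1 → _
  in-range R M δ R>0 gap = R.in-range R M δ (numer q 1 2 R M) (denom q 1 2 R M) (numer≡ R M) refl R>0 gap

-- Divisibility of the length

parity : ∀ n → ∃ (λ k → n ≡ 2 ℕ.* k) ⊎ ∃ (λ k → n ≡ suc (2 ℕ.* k))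
parity zero    = inj₁ (0 , refl)
parity (suc n) with parity n
... | inj₁ (k , refl) = inj₂ (k , refl)
... | inj₂ (k , refl) = inj₁ (suc k , sym (ℕₚ.*-suc 2 k))

-- A rational square root of an integer is an integer: in lowest terms y′ divides x′², hence x′,
-- hence y′ = 1.
coprime-square-ratio : ∀ q g x′ y′ {x y} → 0 ℕ.< g → Coprime x′ y′ → x′ ℕ.* g ≡ x → y′ ℕ.* g ≡ y → x ℕ.* x ≡ q ℕ.* (y ℕ.* y) → x′ ℕ.* x′ ≡ q
coprime-square-ratio q g x′ y′ g>0 coprime refl refl h = begin
  x′ ℕ.* x′             ≡⟨ reduced ⟩
  q ℕ.* (y′ ℕ.* y′)     ≡⟨ cong (λ u → q ℕ.* (u ℕ.* u)) y′≡1 ⟩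
  q ℕ.* 1               ≡⟨ ℕₚ.*-identityʳ q ⟩
  q                     ∎
  where
  open ≡-Reasoning
  eq₁ : ∀ a g → g ℕ.* g ℕ.* (a ℕ.* a) ≡ a ℕ.* g ℕ.* (a ℕ.* g)
  eq₁ = ℕSolver.solve-∀
  eq₂ : ∀ q a g → q ℕ.* (a ℕ.* g ℕ.* (a ℕ.* g)) ≡ g ℕ.* g ℕ.* (q ℕ.* (a ℕ.* a))
  eq₂ = ℕSolver.solve-∀
  reduced : x′ ℕ.* x′ ≡ q ℕ.* (y′ ℕ.* y′)
  reduced = ℕₚ.*-cancelˡ-≡ (x′ ℕ.* x′) (q ℕ.* (y′ ℕ.* y′)) (g ℕ.* g) {{ℕ.>-nonZero (ℕₚ.*-mono-< g>0 g>0)}} (trans (eq₁ x′ g) (trans h (eq₂ q y′ g)))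
  y′≡1 : y′ ≡ 1
  y′≡1 = coprime (coprime-divisor (Coprimality.sym coprime) (divides (q ℕ.* y′) (trans reduced (sym (ℕₚ.*-assoc q y′ y′)))) , ∣-refl)

square-ratio⇒square : ∀ q x y → 0 ℕ.< y → x ℕ.* x ≡ q ℕ.* (y ℕ.* y) → ∃ λ p → p ℕ.* p ≡ q
square-ratio⇒square q x y y>0 h = x DivMod./ gcd x y ,
  coprime-square-ratio q (gcd x y) (x DivMod./ gcd x y) (y DivMod./ gcd x y) (ℕₚ.n≢0⇒n>0 g≢0) (coprime-/gcd x y)
    (DivMod.m/n*n≡m (gcd[m,n]∣m x y)) (DivMod.m/n*n≡m (gcd[m,n]∣n x y)) h
  where
  g≢0 : gcd x y ≢ 0
  g≢0 = gcd[m,n]≢0 x y (inj₂ (ℕₚ.m<n⇒n≢0 y>0))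
  instance
    g-nonZero : ℕ.NonZero (gcd x y)
    g-nonZero = ℕ.≢-nonZero g≢0

odd-power-square⇒square : ∀ q s k → 0 ℕ.< q → s ℕ.* s ≡ q ℕ.^ suc (2 ℕ.* k) → ∃ λ p → p ℕ.* p ≡ q
odd-power-square⇒square q s k q>0 h = square-ratio⇒square q s (q ℕ.^ k) (ℕₚ.m^n>0 q {{ℕ.>-nonZero q>0}} k)
  (trans h (cong (q ℕ.*_) (trans (cong (q ℕ.^_) (cong (k ℕ.+_) (ℕₚ.+-identityʳ k))) (ℕₚ.^-distribˡ-+-* q k k))))

even-length : ∀ q → 0 ℕ.< q → (∀ p → p ℕ.* p ≢ q) → ∀ s n → s ℕ.* s ≡ q ℕ.^ n → ∃ λ k → n ≡ 2 ℕ.* k × s ≡ q ℕ.^ k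
even-length q q>0 nonsquare s n h with parity n
... | inj₁ (k , refl) = k , refl , *-self-injective (trans h (trans (cong (λ u → q ℕ.^ (k ℕ.+ u)) (ℕₚ.+-identityʳ k)) (ℕₚ.^-distribˡ-+-* q k k)))
... | inj₂ (k , refl) with odd-power-square⇒square q s k q>0 h
...   | p , p²≡q = ⊥-elim (nonsquare p p²≡q)

-- Congruences in place of complex roots of unity

infix 4 _≡_⟨mod_⟩
record _≡_⟨mod_⟩ (a b m : ℤ) : Set where
  constructor _by_
  field
    multiple : ℤ
    equation : a ≡ b + m * multiple
open _≡_⟨mod_⟩

module _ {m : ℤ} where
  mod-refl : ∀ a → a ≡ a ⟨mod m ⟩
  mod-refl a = 0ℤ by eq a m
    where
    eq : ∀ a m → a ≡ a + m * 0ℤ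
    eq = solve-∀

  mod-sym : ∀ {a b} → a ≡ b ⟨mod m ⟩ → b ≡ a ⟨mod m ⟩
  mod-sym {a} {b} (k by e) = (- k) by trans (eq b m k) (cong (_+ m * - k) (sym e))
    where
    eq : ∀ b m k → b ≡ b + m * k + m * - k
    eq = solve-∀

  mod-trans : ∀ {a b c} → a ≡ b ⟨mod m ⟩ → b ≡ c ⟨mod m ⟩ → a ≡ c ⟨mod m ⟩
  mod-trans {a} {b} {c} (k by e) (k′ by e′) = (k′ + k) by trans e (trans (cong (_+ m * k) e′) (eq c m k k′))
    where
    eq : ∀ c m k k′ → c + m * k′ + m * k ≡ c + m * (k′ + k)
    eq = solve-∀

  mod-+ : ∀ {a b c d} → a ≡ b ⟨mod m ⟩ → c ≡ d ⟨mod m ⟩ → a + c ≡ b + d ⟨mod m ⟩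
  mod-+ {a} {b} {c} {d} (k by e) (k′ by e′) = (k + k′) by trans (cong₂ _+_ e e′) (eq b d m k k′)
    where
    eq : ∀ b d m k k′ → (b + m * k) + (d + m * k′) ≡ b + d + m * (k + k′)
    eq = solve-∀

  mod-* : ∀ {a b c d} → a ≡ b ⟨mod m ⟩ → c ≡ d ⟨mod m ⟩ → a * c ≡ b * d ⟨mod m ⟩
  mod-* {a} {b} {c} {d} (k by e) (k′ by e′) = (b * k′ + k * d + m * k * k′) by trans (cong₂ _*_ e e′) (eq b d m k k′)
    where
    eq : ∀ b d m k k′ → (b + m * k) * (d + m * k′) ≡ b * d + m * (b * k′ + k * d + m * k * k′)
    eq = solve-∀

  mod-^ : ∀ {a b} k → a ≡ b ⟨mod m ⟩ → a ^ k ≡ b ^ k ⟨mod m ⟩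
  mod-^ zero    h = mod-refl 1ℤ
  mod-^ {a} {b} (suc k) h = mod-* {a} {b} {a ^ k} {b ^ k} h (mod-^ k h)

-- Evaluating the MacWilliams identity at a y with y^c ≡ 1 and (1 - y)^c ≡ (1 + (q-1)y)^c.
size-congruence : ∀ {q n c} (C : Code q n) → FormallySelfDual C → WeightsDivisibleBy c C → ∀ y m →
  y ^ c ≡ 1ℤ ⟨mod m ⟩ → σ₂ q 1ℤ y ^ c ≡ σ₁ q 1ℤ y ^ c ⟨mod m ⟩ →
  + size C * + size C ≡ + size C * σ₁ q 1ℤ y ^ n ⟨mod m ⟩
size-congruence {q} {n} {c} C (_ , mac) c∣wt y m y^c Y^c =
  mod-trans (mod-sym (mod-* {a = + size C} {+ size C} (mod-refl (+ size C)) left))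
    (subst (λ u → u ≡ + size C * X ^ n ⟨mod m ⟩) (sym (mac 1ℤ y)) right)
  where
  X = σ₁ q 1ℤ y
  Y = σ₂ q 1ℤ y
  sum-mod : ∀ (f : Word q n → ℤ) a us → (∀ u → c ∣ wt u → f u ≡ a ⟨mod m ⟩) → All (λ u → c ∣ wt u) us → sumOver f us ≡ + length us * a ⟨mod m ⟩
  sum-mod f a []       h []       = 0ℤ by eq a m
    where
    eq : ∀ a m → 0ℤ ≡ 0ℤ * a + m * 0ℤ
    eq = solve-∀
  sum-mod f a (u ∷ us) h (hu ∷ hs) = subst (λ v → sumOver f (u ∷ us) ≡ v ⟨mod m ⟩) (eq a (+ length us))
    (mod-+ {m} {f u} {a} {sumOver f us} {+ length us * a} (h u hu) (sum-mod f a us h hs))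
    where
    eq : ∀ a l → a + l * a ≡ (1ℤ + l) * a
    eq = solve-∀
  power : ∀ a b → a ^ c ≡ b ^ c ⟨mod m ⟩ → ∀ w → c ∣ w → a ^ w ≡ b ^ w ⟨mod m ⟩
  power a b h w (divides j refl) = subst₂ (λ u v → u ≡ v ⟨mod m ⟩) (assoc a) (assoc b) (mod-^ {m} {a ^ c} {b ^ c} j h)
    where
    assoc : ∀ a → (a ^ c) ^ j ≡ a ^ (j ℕ.* c)
    assoc a = trans (ℤₚ.^-*-assoc a c j) (cong (a ^_) (ℕₚ.*-comm c j))
  left : W C 1ℤ y ≡ + size C ⟨mod m ⟩
  left = subst₂ (λ u v → u ≡ v ⟨mod m ⟩) (sym (W-sum C 1ℤ y)) (ℤₚ.*-identityʳ (+ size C))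
    (sum-mod (λ u → 1ℤ ^ (n ℕ.∸ wt u) * y ^ wt u) 1ℤ (words C) (λ u hu → subst (λ v → 1ℤ ^ (n ℕ.∸ wt u) * y ^ wt u ≡ v ⟨mod m ⟩)
      (cong₂ _*_ (ℤₚ.^-zeroˡ (n ℕ.∸ wt u)) (ℤₚ.^-zeroˡ (wt u)))
      (mod-* {a = 1ℤ ^ (n ℕ.∸ wt u)} {1ℤ ^ (n ℕ.∸ wt u)} {y ^ wt u} {1ℤ ^ wt u} (mod-refl (1ℤ ^ (n ℕ.∸ wt u)))
        (power y 1ℤ (subst (λ v → y ^ c ≡ v ⟨mod m ⟩) (sym (ℤₚ.^-zeroˡ c)) y^c) (wt u) hu))) c∣wt)
  right : W C X Y ≡ + size C * X ^ n ⟨mod m ⟩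
  right = subst (λ u → u ≡ + size C * X ^ n ⟨mod m ⟩) (sym (W-sum C X Y))
    (sum-mod (λ u → X ^ (n ℕ.∸ wt u) * Y ^ wt u) (X ^ n) (words C) (λ u hu → subst (λ v → X ^ (n ℕ.∸ wt u) * Y ^ wt u ≡ v ⟨mod m ⟩)
      (trans (sym (ℤₚ.^-distribˡ-+-* X (n ℕ.∸ wt u) (wt u))) (cong (X ^_) (ℕₚ.m∸n+n≡m (wt≤n u))))
      (mod-* {a = X ^ (n ℕ.∸ wt u)} {X ^ (n ℕ.∸ wt u)} {Y ^ wt u} {X ^ wt u} (mod-refl (X ^ (n ℕ.∸ wt u))) (power Y X Y^c (wt u) hu))) c∣wt)

-- 2N would be divisible by the modulus at y = 2N, which is larger than 2N.
not-self-negative : ∀ N → 0 ℕ.< N → (m : ℕ → ℕ) → (∀ y → y ℕ.≤ m y) → ¬ (∀ y → + N ≡ - + N ⟨mod + suc (m y) ⟩)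
not-self-negative N N>0 m m≥ h = ℕₚ.<-irrefl (sym (ℤₚ.+-injective 2N≡0)) (ℕₚ.≤-trans N>0 (ℕₚ.m≤m+n N N))
  where
  y = N ℕ.+ N
  k = multiple (h y)
  eq : ∀ N x → N ≡ - N + x → N + N ≡ x
  eq N x e = trans (cong (_+ N) e) (eq′ N x)
    where
    eq′ : ∀ N x → - N + x + N ≡ x
    eq′ = solve-∀
  2N≡ : + (N ℕ.+ N) ≡ + suc (m y) * k
  2N≡ = eq (+ N) (+ suc (m y) * k) (equation (h y))
  2N≡0 : + (N ℕ.+ N) ≡ 0ℤ
  2N≡0 = small-multiple⇒zero (+ (N ℕ.+ N)) (m y) k 2N≡ (m≥ y)

neg-odd-^ : ∀ a k → (- a) ^ suc (2 ℕ.* k) ≡ - (a ^ suc (2 ℕ.* k))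
neg-odd-^ a k = trans (cong (- a *_) even) (sym (ℤₚ.neg-distribˡ-* a (a ^ (2 ℕ.* k))))
  where
  sq : ∀ a → - a * (- a * 1ℤ) ≡ a * (a * 1ℤ)
  sq = solve-∀
  even : (- a) ^ (2 ℕ.* k) ≡ a ^ (2 ℕ.* k)
  even = trans (sym (ℤₚ.^-*-assoc (- a) 2 k)) (trans (cong (_^ k) (sq a)) (ℤₚ.^-*-assoc a 2 k))

small-nonsquare : ∀ {q} → 2 ℕ.≤ q → q ℕ.≤ 3 → ∀ p → p ℕ.* p ≢ q
small-nonsquare q≥2 q≤3 zero          refl = ℕₚ.n≮0 q≥2
small-nonsquare q≥2 q≤3 (suc zero)    refl = ℕₚ.<-irrefl refl q≥2
small-nonsquare q≥2 q≤3 (suc (suc p)) refl = ℕₚ.<⇒≱ (ℕₚ.n<1+n 3) (ℕₚ.≤-trans (ℕₚ.*-mono-≤ {2} {suc (suc p)} {2} (s≤s (s≤s z≤n)) (s≤s (s≤s z≤n))) q≤3)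

size-sq : ∀ {q n} (C : Code q n) → FormallySelfDual C → size C ℕ.* size C ≡ q ℕ.^ n
size-sq C (s² , _) = trans (cong (size C ℕ.*_) (sym (ℕₚ.*-identityʳ (size C)))) s²

y≤y*y : ∀ y → y ℕ.≤ y ℕ.* y
y≤y*y zero    = z≤n
y≤y*y (suc y) = ℕₚ.m≤m*n (suc y) (suc y)

module _ (s : ℕ) (s>0 : 0 ℕ.< s) (m : ℕ → ℕ) (m≥ : ∀ y → y ℕ.≤ m y) (Z : ℕ → ℤ)
         (hs : ∀ y → + s * + s ≡ + s * Z y ⟨mod + suc (m y) ⟩) where

  not-negative : ¬ (∀ y → Z y ≡ - + s ⟨mod + suc (m y) ⟩)
  not-negative hZ = not-self-negative (s ℕ.* s) (ℕₚ.*-mono-< s>0 s>0) m m≥ (λ y →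
    subst₂ (λ u v → u ≡ v ⟨mod + suc (m y) ⟩) (sym (ℤₚ.pos-* s s))
      (trans (sym (ℤₚ.neg-distribʳ-* (+ s) (+ s))) (cong -_ (sym (ℤₚ.pos-* s s))))
      (mod-trans (hs y) (mod-* (mod-refl (+ s)) (hZ y))))

  -- From s² ≡ sZ follows s³ ≡ s²Z ≡ sZ² ≡ -s³. The factor s is carried along because it need not be
  -- invertible modulo m.
  not-imaginary : ¬ (∀ y → Z y * Z y ≡ - (+ s * + s) ⟨mod + suc (m y) ⟩)
  not-imaginary hZ = not-self-negative (s ℕ.* (s ℕ.* s)) (ℕₚ.*-mono-< s>0 (ℕₚ.*-mono-< s>0 s>0)) m m≥ (λ y →
    subst₂ (λ u v → u ≡ v ⟨mod + suc (m y) ⟩) (sym cast) (trans (sym (ℤₚ.neg-distribʳ-* (+ s) (+ s * + s))) (cong -_ (sym cast)))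
      (mod-trans (mod-* (mod-refl (+ s)) (hs y)) (subst (λ u → u ≡ + s * - (+ s * + s) ⟨mod + suc (m y) ⟩) (eq (+ s) (Z y))
        (mod-trans (mod-* (hs y) (mod-refl (Z y))) (subst (λ u → u ≡ + s * - (+ s * + s) ⟨mod + suc (m y) ⟩) (sym (ℤₚ.*-assoc (+ s) (Z y) (Z y))) (mod-* (mod-refl (+ s)) (hZ y)))))))
    where
    cast : + (s ℕ.* (s ℕ.* s)) ≡ + s * (+ s * + s)
    cast = trans (ℤₚ.pos-* s (s ℕ.* s)) (cong (+ s *_) (ℤₚ.pos-* s s))
    eq : ∀ s z → s * s * z ≡ s * (s * z)
    eq = solve-∀

neg-pow : ∀ {m a k} j → a ≡ - + k ⟨mod m ⟩ → a ^ suc (2 ℕ.* j) ≡ - + (k ℕ.^ suc (2 ℕ.* j)) ⟨mod m ⟩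
neg-pow {m} {a} {k} j h = subst (λ u → a ^ suc (2 ℕ.* j) ≡ u ⟨mod m ⟩) (trans (neg-odd-^ (+ k) j) (cong -_ (sym (pos-^ k (suc (2 ℕ.* j)))))) (mod-^ (suc (2 ℕ.* j)) h)

-- At y = -1 the form σ₁ is -2, and for odd n its power (-2)^n is -|C|, whereas the MacWilliams
-- identity demands |C|. The modulus is arbitrary here.
2∣length-42 : ∀ {n} (C : Code 4 n) → FormallySelfDual C → WeightsDivisibleBy 2 C → ∃ λ k → n ≡ 2 ℕ.* k
2∣length-42 {n} C fsd 2∣wt with parity n
... | inj₁ even = even
... | inj₂ (k , refl) = ⊥-elim (not-negative (size C) (size-pos C (s≤s (s≤s z≤n)) fsd) (λ y → y) (λ _ → ℕₚ.≤-refl) (λ _ → -[1+ 1 ] ^ n)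
    (λ y → size-congruence C fsd 2∣wt -1ℤ (+ suc y) (mod-refl 1ℤ) (mod-refl (+ 4)))
    (λ y → subst (λ t → -[1+ 1 ] ^ n ≡ - + t ⟨mod + suc y ⟩) (sym size≡) (neg-pow k (mod-refl -[1+ 1 ]))))
  where
  size≡ : size C ≡ 2 ℕ.^ n
  size≡ = *-self-injective (trans (size-sq C fsd) (ℕ-^-distrib-* 2 2 n))

-- Modulo y² + y + 1 the integer y is a primitive cube root of unity, and X = 1 + 2y has square -3.
-- With n = 2k this gives X^n = (-3)^k against |C| = 3^k, so k is even.
4∣length-33 : ∀ {n} (C : Code 3 n) → FormallySelfDual C → WeightsDivisibleBy 3 C → ∃ λ k → n ≡ 4 ℕ.* k
4∣length-33 {n} C fsd 3∣wt = split (even-length 3 (s≤s z≤n) (small-nonsquare (s≤s (s≤s z≤n)) ℕₚ.≤-refl) (size C) n (size-sq C fsd))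
  where
  m : ℕ → ℕ
  m y = y ℕ.* y ℕ.+ y
  X : ℕ → ℤ
  X y = σ₁ 3 1ℤ (+ y)
  m≡ : ∀ y → 1ℤ + (+ y * + y + + y) ≡ + suc (m y)
  m≡ y = cong (λ u → 1ℤ + (u + + y)) (sym (ℤₚ.pos-* y y))
  y³ : ∀ y → y * (y * (y * 1ℤ)) ≡ 1ℤ + (1ℤ + (y * y + y)) * (y - 1ℤ)
  y³ = solve-∀
  Y³ : ∀ y → (1ℤ - y) * ((1ℤ - y) * ((1ℤ - y) * 1ℤ)) ≡ (1ℤ + + 2 * y) * ((1ℤ + + 2 * y) * ((1ℤ + + 2 * y) * 1ℤ)) + (1ℤ + (y * y + y)) * (-[1+ 8 ] * y)
  Y³ = solve-∀
  X² : ∀ y → (1ℤ + + 2 * y) * ((1ℤ + + 2 * y) * 1ℤ) ≡ -[1+ 2 ] + (1ℤ + (y * y + y)) * + 4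
  X² = solve-∀
  congruence : ∀ y → + size C * + size C ≡ + size C * X y ^ n ⟨mod + suc (m y) ⟩
  congruence y = subst (λ M → + size C * + size C ≡ + size C * X y ^ n ⟨mod M ⟩) (m≡ y)
    (size-congruence C fsd 3∣wt (+ y) (1ℤ + (+ y * + y + + y)) (_ by y³ (+ y)) (_ by Y³ (+ y)))
  split : (∃ λ k → n ≡ 2 ℕ.* k × size C ≡ 3 ℕ.^ k) → ∃ λ k → n ≡ 4 ℕ.* k
  split (k , n≡ , size≡) with parity k
  ... | inj₁ (j , refl) = j , trans n≡ (sym (ℕₚ.*-assoc 2 2 j))
  ... | inj₂ (j , refl) = ⊥-elim (not-negative (size C) (size-pos C (s≤s (s≤s z≤n)) fsd) m (λ y → ℕₚ.m≤n+m y (y ℕ.* y)) (λ y → X y ^ n) congruence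
      (λ y → subst₂ (λ u t → u ≡ - + t ⟨mod + suc (m y) ⟩) (trans (ℤₚ.^-*-assoc (X y) 2 k) (cong (X y ^_) (sym n≡))) (sym size≡)
        (neg-pow j (subst (λ M → X y ^ 2 ≡ -[1+ 2 ] ⟨mod M ⟩) (m≡ y) ((+ 4) by X² (+ y))))))

-- Modulo y² + 1 the integer y is a square root of -1, and X = 1 + y has fourth power -4. With n =
-- 2k and |C| = 2^k, an odd k makes X^(2n) = -|C|², and k = 2j with odd j makes X^n = -|C|; both
-- contradict the MacWilliams identity.
8∣length-24 : ∀ {n} (C : Code 2 n) → FormallySelfDual C → WeightsDivisibleBy 4 C → ∃ λ k → n ≡ 8 ℕ.* k
8∣length-24 {n} C fsd 4∣wt = split (even-length 2 (s≤s z≤n) (small-nonsquare ℕₚ.≤-refl (s≤s (s≤s z≤n))) (size C) n (size-sq C fsd))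
  where
  m : ℕ → ℕ
  m y = y ℕ.* y
  X : ℕ → ℤ
  X y = σ₁ 2 1ℤ (+ y)
  m≡ : ∀ y → 1ℤ + + y * + y ≡ + suc (m y)
  m≡ y = cong (_+_ 1ℤ) (sym (ℤₚ.pos-* y y))
  y⁴ : ∀ y → y * (y * (y * (y * 1ℤ))) ≡ 1ℤ + (1ℤ + y * y) * (y * y - 1ℤ)
  y⁴ = solve-∀
  Y⁴ : ∀ y → (1ℤ - y) * ((1ℤ - y) * ((1ℤ - y) * ((1ℤ - y) * 1ℤ))) ≡
    (1ℤ + 1ℤ * y) * ((1ℤ + 1ℤ * y) * ((1ℤ + 1ℤ * y) * ((1ℤ + 1ℤ * y) * 1ℤ))) + (1ℤ + y * y) * (-[1+ 7 ] * y)
  Y⁴ = solve-∀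
  X⁴ : ∀ y → (1ℤ + 1ℤ * y) * ((1ℤ + 1ℤ * y) * ((1ℤ + 1ℤ * y) * ((1ℤ + 1ℤ * y) * 1ℤ))) ≡ -[1+ 3 ] + (1ℤ + y * y) * (y * y + + 4 * y + + 5)
  X⁴ = solve-∀
  congruence : ∀ y → + size C * + size C ≡ + size C * X y ^ n ⟨mod + suc (m y) ⟩
  congruence y = subst (λ M → + size C * + size C ≡ + size C * X y ^ n ⟨mod M ⟩) (m≡ y)
    (size-congruence C fsd 4∣wt (+ y) (1ℤ + + y * + y) (_ by y⁴ (+ y)) (_ by Y⁴ (+ y)))
  X⁴≡-4 : ∀ y → X y ^ 4 ≡ -[1+ 3 ] ⟨mod + suc (m y) ⟩
  X⁴≡-4 y = subst (λ M → X y ^ 4 ≡ -[1+ 3 ] ⟨mod M ⟩) (m≡ y) (_ by X⁴ (+ y))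
  size>0 = size-pos C (s≤s (s≤s z≤n)) fsd
  split : (∃ λ k → n ≡ 2 ℕ.* k × size C ≡ 2 ℕ.^ k) → ∃ λ k → n ≡ 8 ℕ.* k
  split (k , n≡ , size≡) with parity k
  ... | inj₂ (j , refl) = ⊥-elim (not-imaginary (size C) size>0 m y≤y*y (λ y → X y ^ n) congruence
      (λ y → subst₂ (λ u v → u ≡ - v ⟨mod + suc (m y) ⟩) (X^4k y) size²≡ (neg-pow j (X⁴≡-4 y))))
    where
    X^4k : ∀ y → (X y ^ 4) ^ k ≡ X y ^ n * X y ^ n
    X^4k y = trans (ℤₚ.^-*-assoc (X y) 4 k) (trans (cong (X y ^_) (trans (eq k) (cong₂ ℕ._+_ (sym n≡) (sym n≡)))) (ℤₚ.^-distribˡ-+-* (X y) n n))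
      where
      eq : ∀ k → 4 ℕ.* k ≡ 2 ℕ.* k ℕ.+ 2 ℕ.* k
      eq = ℕSolver.solve-∀
    size²≡ : + (4 ℕ.^ k) ≡ + size C * + size C
    size²≡ = trans (cong +_ (trans (ℕ-^-distrib-* 2 2 k) (cong₂ ℕ._*_ (sym size≡) (sym size≡)))) (ℤₚ.pos-* (size C) (size C))
  ... | inj₁ (j , refl) with parity j
  ...   | inj₁ (i , refl) = i , trans n≡ (eq i)
    where
    eq : ∀ i → 2 ℕ.* (2 ℕ.* (2 ℕ.* i)) ≡ 8 ℕ.* i
    eq = ℕSolver.solve-∀
  ...   | inj₂ (i , refl) = ⊥-elim (not-negative (size C) size>0 m y≤y*y (λ y → X y ^ n) congruence
      (λ y → subst₂ (λ u t → u ≡ - + t ⟨mod + suc (m y) ⟩)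
        (trans (ℤₚ.^-*-assoc (X y) 4 j) (cong (X y ^_) (trans (ℕₚ.*-assoc 2 2 j) (sym n≡))))
        (trans (ℕₚ.^-*-assoc 2 2 j) (sym size≡)) (neg-pow i (X⁴≡-4 y))))

-- Assembly of the cases

square? : ∀ q b → ∃ (λ p → p ℕ.* p ≡ q) ⊎ (∀ p → p ℕ.≤ b → p ℕ.* p ≢ q)
square? q zero with 0 ℕₚ.≟ q
... | yes e = inj₁ (0 , e)
... | no  h = inj₂ (λ { zero z≤n e → h e })
square? q (suc b) with suc b ℕ.* suc b ℕₚ.≟ q
... | yes e = inj₁ (suc b , e)
... | no  h with square? q b
...   | inj₁ r  = inj₁ r
...   | inj₂ h′ = inj₂ (λ p p≤ e → [ (λ p< → h′ p (ℕₚ.≤-pred p<) e) , (λ { refl → h e }) ]′ (ℕₚ.m≤n⇒m<n∨m≡n p≤))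

theorem2-c≡1 : (q : ℕ) → 2 ℕ.≤ q → (n : ℕ → ℕ) (C : ∀ i → Code q (n i)) → (∀ i → FormallySelfDual (C i)) →
  (∀ i → WeightsDivisibleBy 1 (C i)) → TendsToInfinity n → LimsupRatioLeBound q 1 (λ i → d (C i)) n
theorem2-c≡1 q@(suc (suc q₂)) q≥2@(s≤s (s≤s _)) n C fsd div n→∞ with square? q q
... | inj₁ (zero , ())
... | inj₁ (suc zero , ())
... | inj₁ (suc (suc p₂) , refl) = Bound.limsup-bound (inv-square (suc p₂)) (est-square p₂) q≥2 n C fsd div (λ i → n i , sym (ℕₚ.*-identityˡ (n i))) n→∞
... | inj₂ nonsquare = Bound.limsup-bound (inv-1 (suc q₂)) (est-1 q₂) q≥2 n C fsd div (λ i → even i) n→∞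
  where
  even : ∀ i → ∃ λ n′ → n i ≡ 2 ℕ.* n′
  even i with even-length q (s≤s z≤n) (λ p e → nonsquare p (ℕₚ.≤-trans (y≤y*y p) (ℕₚ.≤-reflexive e)) e) (size (C i)) (n i) (size-sq (C i) (fsd i))
  ... | k , n≡ , _ = k , n≡

theorem2 : (q c : ℕ) → 2 ≤ q → Admissible q c →
    (n : ℕ → ℕ) → (C : (i : ℕ) → Code q (n i)) →
    (∀ i → FormallySelfDual (C i)) →
    (∀ i → WeightsDivisibleBy c (C i)) →
    TendsToInfinity n →
    LimsupRatioLeBound q c (λ i → d (C i)) n
theorem2 q c q≥2 (inj₁ refl) n C fsd div n→∞ = theorem2-c≡1 q q≥2 n C fsd div n→∞
theorem2 q c q≥2 (inj₂ (inj₁ (refl , refl))) n C fsd div n→∞ =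
  Bound.limsup-bound inv-22 est-22 q≥2 n C fsd div
    (λ i → let k , n≡ , _ = even-length 2 (s≤s z≤n) (small-nonsquare ℕₚ.≤-refl (s≤s (s≤s z≤n))) (size (C i)) (n i) (size-sq (C i) (fsd i)) in k , n≡) n→∞
theorem2 q c q≥2 (inj₂ (inj₂ (inj₁ (refl , refl)))) n C fsd div n→∞ =
  Bound.limsup-bound inv-24 est-24 q≥2 n C fsd div (λ i → 8∣length-24 (C i) (fsd i) (div i)) n→∞
theorem2 q c q≥2 (inj₂ (inj₂ (inj₂ (inj₁ (refl , refl))))) n C fsd div n→∞ =
  Bound.limsup-bound inv-33 est-33 q≥2 n C fsd div (λ i → 4∣length-33 (C i) (fsd i) (div i)) n→∞
theorem2 q c q≥2 (inj₂ (inj₂ (inj₂ (inj₂ (refl , refl))))) n C fsd div n→∞ =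
  Bound.limsup-bound inv-42 est-42 q≥2 n C fsd div (λ i → 2∣length-42 (C i) (fsd i) (div i)) n→∞
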